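{- Let $\varepsilon>0$, let $r>1$, and let $(a_n)_{n\in\mathbb{N}}$ be an increasing sequence of positive integers which is lacunary with growth factor $r$. Then for Lebesgue-almost all $\alpha\in[0,1]$ there exists $N_0(\alpha)\in\mathbb{N}$ such that $$G(\{\alpha a_n\}_{n\le N})\le\frac{(\log N)^{2+\varepsilon}}{N}$$ for all $N\in\mathbb{N}$ with $N\ge N_0(\alpha)$.
   Context: A sequence $(a_n)_{n\in\mathbb{N}}$ is lacunary with growth factor $r>1$ if $a_{n+1}\ge r a_n$ for every $n\in\mathbb{N}$. Maximal gap: for a finite family of real numbers $z_1,\dots,z_m$ ($m\ge1$), reduce each $z_i$ modulo $1$ to a representative in $[0,1)$ and sort these representatives as $0\le y_1\le y_2\le\dots\le y_m<1$; put $y_{m+1}:=1+y_1$. Then $G(\{z_i\}_{i\le m}):=\max_{2\le k\le m+1}(y_k-y_{k-1})$ is the largest gap between neighbouring points on the unit torus. Thus $G(\{\alpha a_n\}_{n\le N})$ is the maximal gap of the points $\alpha a_1,\dots,\alpha a_N$ modulo $1$. -}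

module Defs where

open import Data.Fin.Base using (Fin; zero; suc; inject₁)
import Data.Fin.Base as Fin
open import Data.Fin.Permutation using (Permutation′; _⟨$⟩ʳ_)
import Data.Integer.Base as ℤ
import Data.Integer.Properties as ℤ
open import Data.Integer.Base using (ℤ; +_)
import Data.Nat.Base as ℕ
open import Data.Nat.Base using (ℕ; zero; suc)
import Data.Nat.Properties as ℕ
open import Data.Product.Base using (∃; _×_; _,_; proj₁; proj₂)
import Data.Rational.Base as ℚ
open import Data.Rational.Base using (ℚ; 0ℚ; 1ℚ; ½; ∣_∣)
import Data.Rational.Properties as ℚ
import Data.Rational.Unnormalised.Base as ℚᵘ
import Data.Rational.Unnormalised.Properties as ℚᵘ
open import Data.Rational.Solver using (module +-*-Solver)
open import Data.Vec.Functional using (insertAt)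
open import Function.Base using (_∘_)
open import Relation.Binary.PropositionalEquality
  using (_≡_; refl; sym; trans; cong; cong₂; subst)
open import Relation.Nullary.Negation.Core using (¬_)

*-mono : ∀ {a b c d} → 0ℚ ℚ.≤ a → 0ℚ ℚ.≤ d → a ℚ.≤ b → c ℚ.≤ d →
         a ℚ.* c ℚ.≤ b ℚ.* d
*-mono {a} {b} {c} {d} 0≤a 0≤d a≤b c≤d = ℚ.≤-trans
  (ℚ.*-monoˡ-≤-nonNeg a {{ℚ.nonNegative 0≤a}} c≤d)
  (ℚ.*-monoʳ-≤-nonNeg d {{ℚ.nonNegative 0≤d}} a≤b)

*-0≤ : ∀ {a b} → 0ℚ ℚ.≤ a → 0ℚ ℚ.≤ b → 0ℚ ℚ.≤ a ℚ.* b
*-0≤ {a} {b} 0≤a 0≤b =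
  subst (ℚ._≤ a ℚ.* b) (ℚ.*-zeroˡ b) (ℚ.*-monoʳ-≤-nonNeg b {{ℚ.nonNegative 0≤b}} 0≤a)

*-0< : ∀ {a b} → 0ℚ ℚ.< a → 0ℚ ℚ.< b → 0ℚ ℚ.< a ℚ.* b
*-0< {a} {b} 0<a 0<b =
  subst (ℚ._< a ℚ.* b) (ℚ.*-zeroˡ b) (ℚ.*-monoˡ-<-pos b {{ℚ.positive 0<b}} 0<a)

½-split : ∀ ε → ½ ℚ.* ε ℚ.+ ½ ℚ.* ε ≡ ε
½-split = solve 1 (λ ε → con ½ :* ε :+ con ½ :* ε := ε) refl
  where open +-*-Solver

½-pos : ∀ {ε} → 0ℚ ℚ.< ε → 0ℚ ℚ.< ½ ℚ.* ε
½-pos = *-0< {½} (ℚ.positive⁻¹ ½)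

triangle : ∀ p q r → ∣ p ℚ.- r ∣ ℚ.≤ ∣ p ℚ.- q ∣ ℚ.+ ∣ q ℚ.- r ∣
triangle p q r = subst (λ t → ∣ t ∣ ℚ.≤ ∣ p ℚ.- q ∣ ℚ.+ ∣ q ℚ.- r ∣)
  (solve 3 (λ p q r → (p :- q) :+ (q :- r) := p :- r) refl p q r)
  (ℚ.∣p+q∣≤∣p∣+∣q∣ (p ℚ.- q) (q ℚ.- r))
  where open +-*-Solver

∣-∣-sym : ∀ p q → ∣ p ℚ.- q ∣ ≡ ∣ q ℚ.- p ∣
∣-∣-sym p q = trans (sym (ℚ.∣-p∣≡∣p∣ (p ℚ.- q)))
  (cong ∣_∣ (solve 2 (λ p q → :- (p :- q) := q :- p) refl p q))
  where open +-*-Solver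

fromℕℚ : ℕ → ℚ
fromℕℚ n = + n ℚ./ 1

fromℕℚ-suc : ∀ n → fromℕℚ (suc n) ≡ fromℕℚ n ℚ.+ 1ℚ
fromℕℚ-suc n = ℚ.toℚᵘ-injective (ℚᵘ.≃-trans (ℚ.toℚᵘ-fromℚᵘ (ℚᵘ.mkℚᵘ (+ suc n) 0))
  (ℚᵘ.≃-sym (ℚᵘ.≃-trans (ℚ.toℚᵘ-homo-+ (fromℕℚ n) 1ℚ)
    (ℚᵘ.≃-trans (ℚᵘ.+-congˡ (ℚ.toℚᵘ 1ℚ) (ℚ.toℚᵘ-fromℚᵘ (ℚᵘ.mkℚᵘ (+ n) 0))) aux))))
  where
  aux : ℚᵘ.mkℚᵘ (+ n) 0 ℚᵘ.+ ℚᵘ.mkℚᵘ (+ 1) 0 ℚᵘ.≃ ℚᵘ.mkℚᵘ (+ suc n) 0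
  aux = ℚᵘ.*≡* (cong (ℤ._* + 1) (trans (cong (ℤ._+ + 1) (ℤ.*-identityʳ (+ n)))
                                       (cong +_ (ℕ.+-comm n 1))))


fromℕℚ-nonNeg : ∀ n → 0ℚ ℚ.≤ fromℕℚ n
fromℕℚ-nonNeg n = ℚ.nonNegative⁻¹ (fromℕℚ n) {{ℚ.normalize-nonNeg n 1}}

fromℕℚ-mono : ∀ {m n} → m ℕ.≤ n → fromℕℚ m ℚ.≤ fromℕℚ n
fromℕℚ-mono {m} {n} m≤n = go (ℕ.≤⇒≤′ m≤n)
  where
  go : ∀ {n} → m ℕ.≤′ n → fromℕℚ m ℚ.≤ fromℕℚ n
  go ℕ.≤′-refl = ℚ.≤-refl
  go {suc n} (ℕ.≤′-step m≤′n) = ℚ.≤-trans (go m≤′n)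
    (subst (fromℕℚ n ℚ.≤_) (sym (fromℕℚ-suc n))
      (subst (ℚ._≤ fromℕℚ n ℚ.+ 1ℚ) (ℚ.+-identityʳ (fromℕℚ n))
        (ℚ.+-monoʳ-≤ (fromℕℚ n) (ℚ.nonNegative⁻¹ 1ℚ))))

1≤fromℕℚ-suc : ∀ n → 1ℚ ℚ.≤ fromℕℚ (suc n)
1≤fromℕℚ-suc n = fromℕℚ-mono {1} {suc n} (ℕ.s≤s ℕ.z≤n)

0<fromℕℚ-suc : ∀ n → 0ℚ ℚ.< fromℕℚ (suc n)
0<fromℕℚ-suc n = ℚ.<-≤-trans (ℚ.positive⁻¹ 1ℚ) (1≤fromℕℚ-suc n)

archimedean : ∀ q → ∃ λ n → q ℚ.≤ fromℕℚ n
archimedean q@(ℚ.mkℚ p d-1 _) = ℤ.∣ p ∣ , ℚ.toℚᵘ-cancel-≤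
  (ℚᵘ.≤-respʳ-≃ (ℚᵘ.≃-sym (ℚ.toℚᵘ-fromℚᵘ (ℚᵘ.mkℚᵘ (+ ℤ.∣ p ∣) 0)))
    (ℚᵘ.*≤* (ℤ.≤-trans (ℤ.≤-reflexive (ℤ.*-identityʳ p)) (ℤ.≤-trans (p≤∣p∣ p)
      (subst (+ ℤ.∣ p ∣ ℤ.≤_) (ℤ.pos-* ℤ.∣ p ∣ (suc d-1))
        (ℤ.+≤+ (ℕ.m≤m*n ℤ.∣ p ∣ (suc d-1))))))))
  where
  p≤∣p∣ : ∀ p → p ℤ.≤ + ℤ.∣ p ∣
  p≤∣p∣ (+ n)       = ℤ.≤-refl
  p≤∣p∣ ℤ.-[1+ n ] = ℤ.-≤+

1/suc : ℕ → ℚ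
1/suc n = + 1 ℚ./ suc n

1/suc-pos : ∀ n → 0ℚ ℚ.< 1/suc n
1/suc-pos n = ℚ.positive⁻¹ (1/suc n) {{ℚ.normalize-pos 1 (suc n)}}

1/suc-inverse : ∀ n → fromℕℚ (suc n) ℚ.* 1/suc n ≡ 1ℚ
1/suc-inverse n = ℚ.toℚᵘ-injective
  (ℚᵘ.≃-trans (ℚ.toℚᵘ-homo-* (fromℕℚ (suc n)) (1/suc n))
    (ℚᵘ.≃-trans (ℚᵘ.*-cong (ℚ.toℚᵘ-fromℚᵘ (ℚᵘ.mkℚᵘ (+ suc n) 0))
                            (ℚ.toℚᵘ-fromℚᵘ (ℚᵘ.mkℚᵘ (+ 1) n)))
      (ℚᵘ.*≡* (cong +_ (trans (ℕ.*-identityʳ _) (trans (ℕ.*-identityʳ (suc n))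
        (sym (trans (ℕ.*-identityˡ _) (ℕ.*-identityˡ (suc n))))))))))

archimedean-* : ∀ B {ε} → 0ℚ ℚ.< ε → ∃ λ j → B ℚ.≤ ε ℚ.* fromℕℚ (suc j)
archimedean-* B {ε} 0<ε = j , (begin
  B                            ≡⟨ sym (ℚ.*-identityˡ B) ⟩
  1ℚ ℚ.* B                     ≡⟨ cong (ℚ._* B) (sym (ℚ.*-inverseʳ ε)) ⟩
  (ε ℚ.* (ℚ.1/ ε)) ℚ.* B       ≡⟨ ℚ.*-assoc ε (ℚ.1/ ε) B ⟩
  ε ℚ.* ((ℚ.1/ ε) ℚ.* B)       ≤⟨ ℚ.*-monoˡ-≤-nonNeg ε {{ℚ.nonNegative (ℚ.<⇒≤ 0<ε)}}
                                   (ℚ.≤-trans (proj₂ arch) (fromℕℚ-mono (ℕ.n≤1+n j))) ⟩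
  ε ℚ.* fromℕℚ (suc j)         ∎)
  where
  open ℚ.≤-Reasoning
  instance
    ε≢0 : ℚ.NonZero ε
    ε≢0 = ℚ.>-nonZero 0<ε
  arch = archimedean ((ℚ.1/ ε) ℚ.* B)
  j = proj₁ arch

shrink : ∀ B {ε} → 0ℚ ℚ.< ε → ∃ λ η → 0ℚ ℚ.< η × B ℚ.* η ℚ.≤ ε
shrink B {ε} 0<ε = 1/suc j , 1/suc-pos j , (begin
  B ℚ.* 1/suc j                          ≤⟨ ℚ.*-monoʳ-≤-nonNeg (1/suc j)
                                             {{ℚ.nonNegative (ℚ.<⇒≤ (1/suc-pos j))}} (proj₂ arch) ⟩
  (ε ℚ.* fromℕℚ (suc j)) ℚ.* 1/suc j     ≡⟨ ℚ.*-assoc ε _ _ ⟩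
  ε ℚ.* (fromℕℚ (suc j) ℚ.* 1/suc j)     ≡⟨ cong (ε ℚ.*_) (1/suc-inverse j) ⟩
  ε ℚ.* 1ℚ                               ≡⟨ ℚ.*-identityʳ ε ⟩
  ε                                      ∎)
  where
  open ℚ.≤-Reasoning
  arch = archimedean-* B 0<ε
  j = proj₁ arch

*-lipschitz : ∀ {A B} p q r s → 0ℚ ℚ.≤ A → 0ℚ ℚ.≤ B → ∣ p ∣ ℚ.≤ A → ∣ s ∣ ℚ.≤ B →
              ∣ p ℚ.* q ℚ.- r ℚ.* s ∣ ℚ.≤ A ℚ.* ∣ q ℚ.- s ∣ ℚ.+ B ℚ.* ∣ p ℚ.- r ∣
*-lipschitz {A} {B} p q r s 0≤A 0≤B p≤A s≤B = begin
  ∣ p ℚ.* q ℚ.- r ℚ.* s ∣                           ≡⟨ cong ∣_∣ (split p q r s) ⟩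
  ∣ p ℚ.* (q ℚ.- s) ℚ.+ s ℚ.* (p ℚ.- r) ∣           ≤⟨ ℚ.∣p+q∣≤∣p∣+∣q∣ (p ℚ.* (q ℚ.- s)) _ ⟩
  ∣ p ℚ.* (q ℚ.- s) ∣ ℚ.+ ∣ s ℚ.* (p ℚ.- r) ∣       ≡⟨ cong₂ ℚ._+_ (ℚ.∣p*q∣≡∣p∣*∣q∣ p _)
                                                                    (ℚ.∣p*q∣≡∣p∣*∣q∣ s _) ⟩
  ∣ p ∣ ℚ.* ∣ q ℚ.- s ∣ ℚ.+ ∣ s ∣ ℚ.* ∣ p ℚ.- r ∣   ≤⟨ ℚ.+-mono-≤
                                                        (*-mono (ℚ.0≤∣p∣ p) (ℚ.0≤∣p∣ _) p≤A ℚ.≤-refl)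
                                                        (*-mono (ℚ.0≤∣p∣ s) (ℚ.0≤∣p∣ _) s≤B ℚ.≤-refl) ⟩
  A ℚ.* ∣ q ℚ.- s ∣ ℚ.+ B ℚ.* ∣ p ℚ.- r ∣           ∎
  where
  open ℚ.≤-Reasoning
  split : ∀ p q r s → p ℚ.* q ℚ.- r ℚ.* s ≡ p ℚ.* (q ℚ.- s) ℚ.+ s ℚ.* (p ℚ.- r)
  split = solve 4 (λ p q r s → p :* q :- r :* s := p :* (q :- s) :+ s :* (p :- r)) refl
    where open +-*-Solver

-- ∑ f n = f 0 + f 1 + ⋯ + f (n − 1)
∑ : (ℕ → ℚ) → ℕ → ℚ
∑ f zero    = 0ℚ
∑ f (suc n) = ∑ f n ℚ.+ f n

-- expTerm q k = qᵏ / k!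
expTerm : ℚ → ℕ → ℚ
expTerm q zero    = 1ℚ
expTerm q (suc k) = expTerm q k ℚ.* (q ℚ.* 1/suc k)

expSum : ℚ → ℕ → ℚ
expSum q = ∑ (expTerm q)

module ExpEstimates (M : ℚ) (0≤M : 0ℚ ℚ.≤ M) where
  open ℚ.≤-Reasoning

  expTerm-nonNeg : ∀ k → 0ℚ ℚ.≤ expTerm M k
  expTerm-nonNeg zero    = ℚ.nonNegative⁻¹ 1ℚ
  expTerm-nonNeg (suc k) = *-0≤ (expTerm-nonNeg k) (*-0≤ 0≤M (ℚ.<⇒≤ (1/suc-pos k)))

  ∣step∣ : ∀ {q} k → ∣ q ∣ ℚ.≤ M → ∣ q ℚ.* 1/suc k ∣ ℚ.≤ M ℚ.* 1/suc k
  ∣step∣ {q} k q≤M = begin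
    ∣ q ℚ.* 1/suc k ∣        ≡⟨ ℚ.∣p*q∣≡∣p∣*∣q∣ q _ ⟩
    ∣ q ∣ ℚ.* ∣ 1/suc k ∣    ≡⟨ cong (∣ q ∣ ℚ.*_) (ℚ.0≤p⇒∣p∣≡p (ℚ.<⇒≤ (1/suc-pos k))) ⟩
    ∣ q ∣ ℚ.* 1/suc k        ≤⟨ *-mono (ℚ.0≤∣p∣ q) (ℚ.<⇒≤ (1/suc-pos k)) q≤M ℚ.≤-refl ⟩
    M ℚ.* 1/suc k            ∎

  expTerm-bound : ∀ {q} k → ∣ q ∣ ℚ.≤ M → ∣ expTerm q k ∣ ℚ.≤ expTerm M k
  expTerm-bound zero q≤M = ℚ.≤-refl
  expTerm-bound {q} (suc k) q≤M = begin
    ∣ expTerm q k ℚ.* (q ℚ.* 1/suc k) ∣        ≡⟨ ℚ.∣p*q∣≡∣p∣*∣q∣ (expTerm q k) _ ⟩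
    ∣ expTerm q k ∣ ℚ.* ∣ q ℚ.* 1/suc k ∣      ≤⟨ *-mono (ℚ.0≤∣p∣ _) (*-0≤ 0≤M (ℚ.<⇒≤ (1/suc-pos k)))
                                                  (expTerm-bound k q≤M) (∣step∣ k q≤M) ⟩
    expTerm M k ℚ.* (M ℚ.* 1/suc k)            ∎

  expTerm-lipschitz : ∀ k → ∃ λ L → 0ℚ ℚ.≤ L × (∀ {p q} → ∣ p ∣ ℚ.≤ M → ∣ q ∣ ℚ.≤ M →
                      ∣ expTerm p k ℚ.- expTerm q k ∣ ℚ.≤ L ℚ.* ∣ p ℚ.- q ∣)
  expTerm-lipschitz zero = 0ℚ , ℚ.≤-refl , λ {p} {q} _ _ →
    ℚ.≤-reflexive (sym (ℚ.*-zeroˡ ∣ p ℚ.- q ∣))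
  expTerm-lipschitz (suc k) with expTerm-lipschitz k
  ... | L , 0≤L , lip = L′ , ℚ.+-mono-≤ (*-0≤ 0≤T 0≤c) (*-0≤ (*-0≤ 0≤M 0≤c) 0≤L) , bound
    where
    c = 1/suc k
    0≤c = ℚ.<⇒≤ (1/suc-pos k)
    T = expTerm M k
    0≤T = expTerm-nonNeg k
    L′ = T ℚ.* c ℚ.+ (M ℚ.* c) ℚ.* L
    bound : ∀ {p q} → ∣ p ∣ ℚ.≤ M → ∣ q ∣ ℚ.≤ M →
            ∣ expTerm p (suc k) ℚ.- expTerm q (suc k) ∣ ℚ.≤ L′ ℚ.* ∣ p ℚ.- q ∣
    bound {p} {q} p≤M q≤M = begin
      ∣ expTerm p k ℚ.* (p ℚ.* c) ℚ.- expTerm q k ℚ.* (q ℚ.* c) ∣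
        ≤⟨ *-lipschitz (expTerm p k) (p ℚ.* c) (expTerm q k) (q ℚ.* c) 0≤T (*-0≤ 0≤M 0≤c)
             (expTerm-bound k p≤M) (∣step∣ k q≤M) ⟩
      T ℚ.* ∣ p ℚ.* c ℚ.- q ℚ.* c ∣ ℚ.+ (M ℚ.* c) ℚ.* ∣ expTerm p k ℚ.- expTerm q k ∣
        ≤⟨ ℚ.+-mono-≤ (ℚ.≤-reflexive (cong (T ℚ.*_) factor))
             (ℚ.*-monoˡ-≤-nonNeg (M ℚ.* c) {{ℚ.nonNegative (*-0≤ 0≤M 0≤c)}} (lip p≤M q≤M)) ⟩
      T ℚ.* (∣ p ℚ.- q ∣ ℚ.* c) ℚ.+ (M ℚ.* c) ℚ.* (L ℚ.* ∣ p ℚ.- q ∣)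
        ≡⟨ solve 5 (λ T d c M L → T :* (d :* c) :+ (M :* c) :* (L :* d)
                               := (T :* c :+ (M :* c) :* L) :* d) refl T ∣ p ℚ.- q ∣ c M L ⟩
      L′ ℚ.* ∣ p ℚ.- q ∣ ∎
      where
      open +-*-Solver
      factor : ∣ p ℚ.* c ℚ.- q ℚ.* c ∣ ≡ ∣ p ℚ.- q ∣ ℚ.* c
      factor = trans
        (cong ∣_∣ (solve 3 (λ p q c → p :* c :- q :* c := (p :- q) :* c) refl p q c))
        (trans (ℚ.∣p*q∣≡∣p∣*∣q∣ (p ℚ.- q) c) (cong (∣ p ℚ.- q ∣ ℚ.*_) (ℚ.0≤p⇒∣p∣≡p 0≤c)))

  expSum-lipschitz : ∀ n → ∃ λ L → 0ℚ ℚ.≤ L × (∀ {p q} → ∣ p ∣ ℚ.≤ M → ∣ q ∣ ℚ.≤ M →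
                     ∣ expSum p n ℚ.- expSum q n ∣ ℚ.≤ L ℚ.* ∣ p ℚ.- q ∣)
  expSum-lipschitz zero = 0ℚ , ℚ.≤-refl , λ {p} {q} _ _ →
    ℚ.≤-reflexive (sym (ℚ.*-zeroˡ ∣ p ℚ.- q ∣))
  expSum-lipschitz (suc n) with expSum-lipschitz n | expTerm-lipschitz n
  ... | L , 0≤L , lip | L′ , 0≤L′ , lip′ = L ℚ.+ L′ , ℚ.+-mono-≤ 0≤L 0≤L′ , bound
    where
    bound : ∀ {p q} → ∣ p ∣ ℚ.≤ M → ∣ q ∣ ℚ.≤ M →
            ∣ expSum p (suc n) ℚ.- expSum q (suc n) ∣ ℚ.≤ (L ℚ.+ L′) ℚ.* ∣ p ℚ.- q ∣
    bound {p} {q} p≤M q≤M = begin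
      ∣ (expSum p n ℚ.+ expTerm p n) ℚ.- (expSum q n ℚ.+ expTerm q n) ∣
        ≡⟨ cong ∣_∣ (solve 4 (λ a b c d → (a :+ b) :- (c :+ d) := (a :- c) :+ (b :- d)) refl
             (expSum p n) (expTerm p n) (expSum q n) (expTerm q n)) ⟩
      ∣ (expSum p n ℚ.- expSum q n) ℚ.+ (expTerm p n ℚ.- expTerm q n) ∣
        ≤⟨ ℚ.∣p+q∣≤∣p∣+∣q∣ (expSum p n ℚ.- expSum q n) _ ⟩
      ∣ expSum p n ℚ.- expSum q n ∣ ℚ.+ ∣ expTerm p n ℚ.- expTerm q n ∣
        ≤⟨ ℚ.+-mono-≤ (lip p≤M q≤M) (lip′ p≤M q≤M) ⟩
      L ℚ.* ∣ p ℚ.- q ∣ ℚ.+ L′ ℚ.* ∣ p ℚ.- q ∣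
        ≡⟨ sym (ℚ.*-distribʳ-+ ∣ p ℚ.- q ∣ L L′) ⟩
      (L ℚ.+ L′) ℚ.* ∣ p ℚ.- q ∣ ∎
      where open +-*-Solver

  module _ (K : ℕ) (M≤½K : M ℚ.≤ ½ ℚ.* fromℕℚ K) where

    expTerm-halving : ∀ k → K ℕ.≤ suc k → expTerm M (suc k) ℚ.≤ ½ ℚ.* expTerm M k
    expTerm-halving k K≤1+k = begin
      expTerm M k ℚ.* (M ℚ.* 1/suc k)
        ≤⟨ ℚ.*-monoˡ-≤-nonNeg (expTerm M k) {{ℚ.nonNegative (expTerm-nonNeg k)}} step ⟩
      expTerm M k ℚ.* ½  ≡⟨ ℚ.*-comm (expTerm M k) ½ ⟩
      ½ ℚ.* expTerm M k  ∎
      where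
      step : M ℚ.* 1/suc k ℚ.≤ ½
      step = begin
        M ℚ.* 1/suc k
          ≤⟨ ℚ.*-monoʳ-≤-nonNeg (1/suc k) {{ℚ.nonNegative (ℚ.<⇒≤ (1/suc-pos k))}}
               (ℚ.≤-trans M≤½K (ℚ.*-monoˡ-≤-nonNeg ½ (fromℕℚ-mono K≤1+k))) ⟩
        (½ ℚ.* fromℕℚ (suc k)) ℚ.* 1/suc k   ≡⟨ ℚ.*-assoc ½ (fromℕℚ (suc k)) _ ⟩
        ½ ℚ.* (fromℕℚ (suc k) ℚ.* 1/suc k)   ≡⟨ cong (½ ℚ.*_) (1/suc-inverse k) ⟩
        ½ ℚ.* 1ℚ                             ≡⟨ ℚ.*-identityʳ ½ ⟩
        ½                                    ∎

    expTerm-decay : ∀ j → fromℕℚ (suc j) ℚ.* expTerm M (j ℕ.+ K) ℚ.≤ expTerm M K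
    expTerm-decay zero    = ℚ.≤-reflexive (ℚ.*-identityˡ (expTerm M K))
    expTerm-decay (suc j) = begin
      fromℕℚ (suc (suc j)) ℚ.* expTerm M (suc (j ℕ.+ K))
        ≤⟨ ℚ.*-monoˡ-≤-nonNeg (fromℕℚ (suc (suc j)))
             {{ℚ.nonNegative (fromℕℚ-nonNeg (suc (suc j)))}}
             (expTerm-halving (j ℕ.+ K) (ℕ.m≤n⇒m≤1+n (ℕ.m≤n+m K j))) ⟩
      fromℕℚ (suc (suc j)) ℚ.* (½ ℚ.* T)   ≡⟨ sym (ℚ.*-assoc (fromℕℚ (suc (suc j))) ½ T) ⟩
      (fromℕℚ (suc (suc j)) ℚ.* ½) ℚ.* T
        ≤⟨ ℚ.*-monoʳ-≤-nonNeg T {{ℚ.nonNegative (expTerm-nonNeg (j ℕ.+ K))}} half ⟩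
      fromℕℚ (suc j) ℚ.* T                 ≤⟨ expTerm-decay j ⟩
      expTerm M K                          ∎
      where
      T = expTerm M (j ℕ.+ K)
      a = fromℕℚ (suc j)
      half : fromℕℚ (suc (suc j)) ℚ.* ½ ℚ.≤ a
      half = begin
        fromℕℚ (suc (suc j)) ℚ.* ½  ≡⟨ cong (ℚ._* ½) (fromℕℚ-suc (suc j)) ⟩
        (a ℚ.+ 1ℚ) ℚ.* ½
          ≤⟨ ℚ.*-monoʳ-≤-nonNeg ½ (ℚ.+-monoʳ-≤ a (1≤fromℕℚ-suc j)) ⟩
        (a ℚ.+ a) ℚ.* ½
          ≡⟨ solve 1 (λ a → (a :+ a) :* con ½ := a) refl a ⟩
        a                           ∎
        where open +-*-Solver

    expSum-tail : ∀ {q} → ∣ q ∣ ℚ.≤ M → ∀ m → K ℕ.≤ m → ∀ i →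
                  ∣ expSum q (i ℕ.+ m) ℚ.- expSum q m ∣
                    ℚ.+ (expTerm M (i ℕ.+ m) ℚ.+ expTerm M (i ℕ.+ m))
                  ℚ.≤ expTerm M m ℚ.+ expTerm M m
    expSum-tail {q} q≤M m K≤m zero = ℚ.≤-reflexive
      (trans (cong (λ t → ∣ t ∣ ℚ.+ (expTerm M m ℚ.+ expTerm M m)) (ℚ.+-inverseʳ (expSum q m)))
             (ℚ.+-identityˡ _))
    expSum-tail {q} q≤M m K≤m (suc i) = begin
      ∣ (E ℚ.+ t) ℚ.- E₀ ∣ ℚ.+ (T′ ℚ.+ T′)
        ≤⟨ ℚ.+-mono-≤ tri (ℚ.≤-trans (ℚ.+-mono-≤ halve halve) (ℚ.≤-reflexive (½-split T))) ⟩
      (∣ E ℚ.- E₀ ∣ ℚ.+ T) ℚ.+ T   ≡⟨ ℚ.+-assoc ∣ E ℚ.- E₀ ∣ T T ⟩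
      ∣ E ℚ.- E₀ ∣ ℚ.+ (T ℚ.+ T)   ≤⟨ expSum-tail q≤M m K≤m i ⟩
      expTerm M m ℚ.+ expTerm M m  ∎
      where
      open +-*-Solver
      E = expSum q (i ℕ.+ m)
      E₀ = expSum q m
      t = expTerm q (i ℕ.+ m)
      T = expTerm M (i ℕ.+ m)
      T′ = expTerm M (suc (i ℕ.+ m))
      halve : T′ ℚ.≤ ½ ℚ.* T
      halve = expTerm-halving (i ℕ.+ m) (ℕ.m≤n⇒m≤1+n (ℕ.≤-trans K≤m (ℕ.m≤n+m m i)))
      tri : ∣ (E ℚ.+ t) ℚ.- E₀ ∣ ℚ.≤ ∣ E ℚ.- E₀ ∣ ℚ.+ T
      tri = begin
        ∣ (E ℚ.+ t) ℚ.- E₀ ∣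
          ≡⟨ cong ∣_∣ (solve 3 (λ E t E₀ → (E :+ t) :- E₀ := (E :- E₀) :+ t) refl E t E₀) ⟩
        ∣ (E ℚ.- E₀) ℚ.+ t ∣         ≤⟨ ℚ.∣p+q∣≤∣p∣+∣q∣ (E ℚ.- E₀) t ⟩
        ∣ E ℚ.- E₀ ∣ ℚ.+ ∣ t ∣       ≤⟨ ℚ.+-monoʳ-≤ ∣ E ℚ.- E₀ ∣ (expTerm-bound (i ℕ.+ m) q≤M) ⟩
        ∣ E ℚ.- E₀ ∣ ℚ.+ T           ∎

  expSum-uniform : ∀ {δ} → 0ℚ ℚ.< δ → ∃ λ m → ∀ {q} → ∣ q ∣ ℚ.≤ M → ∀ n → m ℕ.≤ n →
                   ∣ expSum q n ℚ.- expSum q m ∣ ℚ.≤ δ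
  expSum-uniform {δ} 0<δ = m , bound
    where
    arch = archimedean-* M (ℚ.positive⁻¹ ½)
    K = suc (proj₁ arch)
    M≤½K = proj₂ arch
    decay = archimedean-* (expTerm M K ℚ.+ expTerm M K) 0<δ
    j = proj₁ decay
    m = j ℕ.+ K
    T = expTerm M m
    small : T ℚ.+ T ℚ.≤ δ
    small = ℚ.*-cancelˡ-≤-pos (fromℕℚ (suc j)) {{ℚ.positive (0<fromℕℚ-suc j)}} (begin
      fromℕℚ (suc j) ℚ.* (T ℚ.+ T)   ≡⟨ ℚ.*-distribˡ-+ (fromℕℚ (suc j)) T T ⟩
      fromℕℚ (suc j) ℚ.* T ℚ.+ fromℕℚ (suc j) ℚ.* T
        ≤⟨ ℚ.+-mono-≤ (expTerm-decay K M≤½K j) (expTerm-decay K M≤½K j) ⟩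
      expTerm M K ℚ.+ expTerm M K    ≤⟨ proj₂ decay ⟩
      δ ℚ.* fromℕℚ (suc j)           ≡⟨ ℚ.*-comm δ _ ⟩
      fromℕℚ (suc j) ℚ.* δ           ∎)
    bound : ∀ {q} → ∣ q ∣ ℚ.≤ M → ∀ n → m ℕ.≤ n → ∣ expSum q n ℚ.- expSum q m ∣ ℚ.≤ δ
    bound {q} q≤M n m≤n = ℚ.≤-trans (subst (λ n → ∣ expSum q n ℚ.- expSum q m ∣ ℚ.≤ T ℚ.+ T)
      (ℕ.m∸n+n≡m m≤n)
      (ℚ.≤-trans (ℚ.≤-trans (ℚ.≤-reflexive (sym (ℚ.+-identityʳ _)))
          (ℚ.+-monoʳ-≤ ∣ expSum q (n ℕ.∸ m ℕ.+ m) ℚ.- expSum q m ∣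
             (ℚ.+-mono-≤ (expTerm-nonNeg (n ℕ.∸ m ℕ.+ m)) (expTerm-nonNeg (n ℕ.∸ m ℕ.+ m)))))
        (expSum-tail K M≤½K q≤M m (ℕ.m≤n+m K j) (n ℕ.∸ m))))
      small

IsCauchy : (ℕ → ℚ) → Set
IsCauchy x = ∀ {ε} → 0ℚ ℚ.< ε →
  ∃ λ N → ∀ {m n} → N ℕ.≤ m → N ℕ.≤ n → ∣ x m ℚ.- x n ∣ ℚ.≤ ε

-- Abstract, so that conversion checking never unfolds the moduli.
abstract
  const-cauchy : ∀ q → IsCauchy (λ _ → q)
  const-cauchy q 0<ε = 0 , λ _ _ →
    subst (ℚ._≤ _) (sym (cong ∣_∣ (ℚ.+-inverseʳ q))) (ℚ.<⇒≤ 0<ε)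

  +-cauchy : ∀ {x y} → IsCauchy x → IsCauchy y → IsCauchy (λ n → x n ℚ.+ y n)
  +-cauchy {x} {y} cx cy {ε} 0<ε =
    let Nx , px = cx (½-pos 0<ε)
        Ny , py = cy (½-pos 0<ε)
    in Nx ℕ.⊔ Ny , λ {m} {n} N≤m N≤n → begin
      ∣ (x m ℚ.+ y m) ℚ.- (x n ℚ.+ y n) ∣
        ≡⟨ cong ∣_∣ (solve 4 (λ a b c d → (a :+ b) :- (c :+ d) := (a :- c) :+ (b :- d)) refl
             (x m) (y m) (x n) (y n)) ⟩
      ∣ (x m ℚ.- x n) ℚ.+ (y m ℚ.- y n) ∣      ≤⟨ ℚ.∣p+q∣≤∣p∣+∣q∣ (x m ℚ.- x n) _ ⟩
      ∣ x m ℚ.- x n ∣ ℚ.+ ∣ y m ℚ.- y n ∣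
        ≤⟨ ℚ.+-mono-≤ (px (ℕ.m⊔n≤o⇒m≤o Nx Ny N≤m) (ℕ.m⊔n≤o⇒m≤o Nx Ny N≤n))
                      (py (ℕ.m⊔n≤o⇒n≤o Nx Ny N≤m) (ℕ.m⊔n≤o⇒n≤o Nx Ny N≤n)) ⟩
      ½ ℚ.* ε ℚ.+ ½ ℚ.* ε                      ≡⟨ ½-split ε ⟩
      ε                                        ∎
    where
    open ℚ.≤-Reasoning
    open +-*-Solver

  neg-cauchy : ∀ {x} → IsCauchy x → IsCauchy (λ n → ℚ.- x n)
  neg-cauchy {x} cx 0<ε =
    let N , p = cx 0<ε in N , λ {m} {n} N≤m N≤n → subst (ℚ._≤ _)
      (trans (∣-∣-sym (x m) (x n))
        (cong ∣_∣ (solve 2 (λ a b → b :- a := :- a :- (:- b)) refl (x m) (x n))))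
      (p N≤m N≤n)
    where open +-*-Solver

  bounded : ∀ {x} → IsCauchy x → ∃ λ B → 0ℚ ℚ.≤ B × ∃ λ N → ∀ {n} → N ℕ.≤ n → ∣ x n ∣ ℚ.≤ B
  bounded {x} cx =
    let N , p = cx (ℚ.positive⁻¹ 1ℚ)
    in ∣ x N ∣ ℚ.+ 1ℚ , ℚ.+-mono-≤ (ℚ.0≤∣p∣ (x N)) (ℚ.nonNegative⁻¹ 1ℚ) , N , λ {n} N≤n → begin
      ∣ x n ∣                          ≡⟨ cong ∣_∣ (solve 2 (λ a b → a := b :+ (a :- b)) refl (x n) (x N)) ⟩
      ∣ x N ℚ.+ (x n ℚ.- x N) ∣        ≤⟨ ℚ.∣p+q∣≤∣p∣+∣q∣ (x N) _ ⟩
      ∣ x N ∣ ℚ.+ ∣ x n ℚ.- x N ∣      ≤⟨ ℚ.+-monoʳ-≤ ∣ x N ∣ (p N≤n ℕ.≤-refl) ⟩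
      ∣ x N ∣ ℚ.+ 1ℚ                   ∎
    where
    open ℚ.≤-Reasoning
    open +-*-Solver

  *-cauchy : ∀ {x y} → IsCauchy x → IsCauchy y → IsCauchy (λ n → x n ℚ.* y n)
  *-cauchy {x} {y} cx cy {ε} 0<ε =
    let A , 0≤A , Na , pa = bounded cx
        B , 0≤B , Nb , pb = bounded cy
        η , 0<η , Aη≤½ε   = shrink A (½-pos 0<ε)
        θ , 0<θ , Bθ≤½ε   = shrink B (½-pos 0<ε)
        Nx , px           = cx 0<θ
        Ny , py           = cy 0<η
    in (Na ℕ.⊔ Nb) ℕ.⊔ (Nx ℕ.⊔ Ny) , λ {m} {n} N≤m N≤n →
      let ab≤m = ℕ.m⊔n≤o⇒m≤o (Na ℕ.⊔ Nb) (Nx ℕ.⊔ Ny) N≤m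
          ab≤n = ℕ.m⊔n≤o⇒m≤o (Na ℕ.⊔ Nb) (Nx ℕ.⊔ Ny) N≤n
          xy≤m = ℕ.m⊔n≤o⇒n≤o (Na ℕ.⊔ Nb) (Nx ℕ.⊔ Ny) N≤m
          xy≤n = ℕ.m⊔n≤o⇒n≤o (Na ℕ.⊔ Nb) (Nx ℕ.⊔ Ny) N≤n
      in begin
      ∣ x m ℚ.* y m ℚ.- x n ℚ.* y n ∣
        ≤⟨ *-lipschitz (x m) (y m) (x n) (y n) 0≤A 0≤B
             (pa (ℕ.m⊔n≤o⇒m≤o Na Nb ab≤m)) (pb (ℕ.m⊔n≤o⇒n≤o Na Nb ab≤n)) ⟩
      A ℚ.* ∣ y m ℚ.- y n ∣ ℚ.+ B ℚ.* ∣ x m ℚ.- x n ∣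
        ≤⟨ ℚ.+-mono-≤
             (*-mono 0≤A (ℚ.<⇒≤ 0<η) (ℚ.≤-refl {A})
                (py (ℕ.m⊔n≤o⇒n≤o Nx Ny xy≤m) (ℕ.m⊔n≤o⇒n≤o Nx Ny xy≤n)))
             (*-mono 0≤B (ℚ.<⇒≤ 0<θ) (ℚ.≤-refl {B})
                (px (ℕ.m⊔n≤o⇒m≤o Nx Ny xy≤m) (ℕ.m⊔n≤o⇒m≤o Nx Ny xy≤n))) ⟩
      A ℚ.* η ℚ.+ B ℚ.* θ      ≤⟨ ℚ.+-mono-≤ Aη≤½ε Bθ≤½ε ⟩
      ½ ℚ.* ε ℚ.+ ½ ℚ.* ε      ≡⟨ ½-split ε ⟩
      ε                        ∎
    where open ℚ.≤-Reasoning

  exp-cauchy : ∀ {x} → IsCauchy x → IsCauchy (λ n → expSum (x n) n)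
  exp-cauchy {x} cx {ε} 0<ε =
    let M , 0≤M , N₀ , bd = bounded cx
        open ExpEstimates M 0≤M
        m , unif          = expSum-uniform (½-pos (½-pos 0<ε))
        L , 0≤L , lip     = expSum-lipschitz m
        η , 0<η , Lη≤½ε   = shrink L (½-pos 0<ε)
        N₁ , close        = cx 0<η
        N = m ℕ.⊔ (N₀ ℕ.⊔ N₁)
        m≤ : ∀ {a} → N ℕ.≤ a → m ℕ.≤ a
        m≤ = ℕ.m⊔n≤o⇒m≤o m (N₀ ℕ.⊔ N₁)
        N₀≤ : ∀ {a} → N ℕ.≤ a → N₀ ℕ.≤ a
        N₀≤ N≤a = ℕ.m⊔n≤o⇒m≤o N₀ N₁ (ℕ.m⊔n≤o⇒n≤o m (N₀ ℕ.⊔ N₁) N≤a)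
        N₁≤ : ∀ {a} → N ℕ.≤ a → N₁ ℕ.≤ a
        N₁≤ N≤a = ℕ.m⊔n≤o⇒n≤o N₀ N₁ (ℕ.m⊔n≤o⇒n≤o m (N₀ ℕ.⊔ N₁) N≤a)
        δ = ½ ℚ.* (½ ℚ.* ε)
    in N , λ {a} {b} N≤a N≤b → begin
      ∣ expSum (x a) a ℚ.- expSum (x b) b ∣
        ≤⟨ triangle (expSum (x a) a) (expSum (x a) m) (expSum (x b) b) ⟩
      ∣ expSum (x a) a ℚ.- expSum (x a) m ∣ ℚ.+ ∣ expSum (x a) m ℚ.- expSum (x b) b ∣
        ≤⟨ ℚ.+-monoʳ-≤ ∣ expSum (x a) a ℚ.- expSum (x a) m ∣
             (triangle (expSum (x a) m) (expSum (x b) m) (expSum (x b) b)) ⟩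
      ∣ expSum (x a) a ℚ.- expSum (x a) m ∣ ℚ.+
        (∣ expSum (x a) m ℚ.- expSum (x b) m ∣ ℚ.+ ∣ expSum (x b) m ℚ.- expSum (x b) b ∣)
        ≤⟨ ℚ.+-mono-≤ (unif (bd (N₀≤ N≤a)) a (m≤ N≤a))
             (ℚ.+-mono-≤
               (ℚ.≤-trans (lip (bd (N₀≤ N≤a)) (bd (N₀≤ N≤b)))
                 (ℚ.≤-trans (ℚ.*-monoˡ-≤-nonNeg L {{ℚ.nonNegative 0≤L}} (close (N₁≤ N≤a) (N₁≤ N≤b)))
                            Lη≤½ε))
               (subst (ℚ._≤ δ) (∣-∣-sym (expSum (x b) b) (expSum (x b) m))
                 (unif (bd (N₀≤ N≤b)) b (m≤ N≤b)))) ⟩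
      δ ℚ.+ (½ ℚ.* ε ℚ.+ δ)
        ≡⟨ solve 1 (λ ε → con ½ :* (con ½ :* ε) :+ (con ½ :* ε :+ con ½ :* (con ½ :* ε)) := ε) refl ε ⟩
      ε ∎
    where
    open ℚ.≤-Reasoning
    open +-*-Solver

record ℝ : Set where
  no-eta-equality
  constructor mkℝ
  field
    seq    : ℕ → ℚ
    cauchy : IsCauchy seq

open ℝ public

infix  4 _≤_ _<_ _≈_
infixl 7 _*_
infixl 6 _+_ _-_
infix  8 -_

_≤_ : ℝ → ℝ → Set
x ≤ y = ∀ {ε} → 0ℚ ℚ.< ε → ∃ λ N → ∀ {n} → N ℕ.≤ n → seq x n ℚ.≤ seq y n ℚ.+ ε

_<_ : ℝ → ℝ → Set
x < y = ∃ λ ε → 0ℚ ℚ.< ε × ∃ λ N → ∀ {n} → N ℕ.≤ n → seq x n ℚ.+ ε ℚ.≤ seq y n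

_≈_ : ℝ → ℝ → Set
x ≈ y = x ≤ y × y ≤ x

fromℚ : ℚ → ℝ
fromℚ q = mkℝ (λ _ → q) (const-cauchy q)

fromℤ : ℤ → ℝ
fromℤ k = fromℚ (k ℚ./ 1)

fromℕ : ℕ → ℝ
fromℕ n = fromℤ (+ n)

0ℝ 1ℝ : ℝ
0ℝ = fromℕ 0
1ℝ = fromℕ 1

_+_ : ℝ → ℝ → ℝ
x + y = mkℝ (λ n → seq x n ℚ.+ seq y n) (+-cauchy {seq x} {seq y} (cauchy x) (cauchy y))

-_ : ℝ → ℝ
- x = mkℝ (λ n → ℚ.- seq x n) (neg-cauchy {seq x} (cauchy x))

_-_ : ℝ → ℝ → ℝ
x - y = x + (- y)

_*_ : ℝ → ℝ → ℝ
x * y = mkℝ (λ n → seq x n ℚ.* seq y n) (*-cauchy {seq x} {seq y} (cauchy x) (cauchy y))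

-- exp x = lim_n ∑_{k<n} xₙᵏ / k!, the exponential series evaluated along the
-- approximations xₙ of x.
exp : ℝ → ℝ
exp x = mkℝ (λ n → expSum (seq x n) n) (exp-cauchy {seq x} (cauchy x))

IsLog : ℝ → ℝ → Set
IsLog x ℓ = exp ℓ ≈ x

-- p = xʸ, for a base x ≥ 0.  The base log N occurring in the bound vanishes
-- at N = 1, where the convention 0ʸ = 0 for y > 0 is needed.
data IsPower (x y p : ℝ) : Set where
  zero-base     : x ≈ 0ℝ → 0ℝ < y → p ≈ 0ℝ → IsPower x y p
  positive-base : ∀ {ℓ} → 0ℝ < x → IsLog x ℓ → p ≈ exp (y * ℓ) → IsPower x y p

-- y lists, in increasing order, the representatives in [0,1) of the z i mod 1.
record SortedRepresentatives {m} (z y : Fin m → ℝ) : Set where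
  field
    reorder   : Permutation′ m
    congruent : ∀ i → ∃ λ (k : ℤ) → z (reorder ⟨$⟩ʳ i) ≈ y i + fromℤ k
    0≤y       : ∀ i → 0ℝ ≤ y i
    y<1       : ∀ i → y i < 1ℝ
    sorted    : ∀ {i j} → i Fin.≤ j → y i ≤ y j

-- y₁, …, y_m followed by y_{m+1} = 1 + y₁.
closeUp : ∀ {m} → (Fin (suc m) → ℝ) → Fin (suc (suc m)) → ℝ
closeUp {m} y = insertAt y (Fin.fromℕ (suc m)) (1ℝ + y zero)

gaps : ∀ {m} → (Fin (suc m) → ℝ) → Fin (suc m) → ℝ
gaps y i = closeUp y (suc i) - closeUp y (inject₁ i)

IsMaximum : ∀ {m} → (Fin m → ℝ) → ℝ → Set
IsMaximum f g = (∀ i → f i ≤ g) × (∃ λ i → g ≈ f i)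

-- G(z) = g.  The value g is determined by z up to ≈.  It is given as a relation
-- because reducing an arbitrary real modulo 1 requires deciding whether it is
-- an integer.
IsMaximalGap : ∀ {m} → (Fin (suc m) → ℝ) → ℝ → Set
IsMaximalGap z g = ∃ λ y → SortedRepresentatives z y × IsMaximum (gaps y) g

record Interval : Set where
  field
    lower upper : ℚ
    lower≤upper : lower ℚ.≤ upper

  width : ℚ
  width = upper ℚ.- lower

open Interval public

_∈°_ : ℝ → Interval → Set
α ∈° I = fromℚ (lower I) < α × α < fromℚ (upper I)

-- The exceptional set has outer measure zero: for every δ > 0 there are open
-- intervals of total length at most δ such that P holds at each point of [0,1]
-- outside all of them.  Classically this says that the intervals
-- cover the points of [0,1] where P fails; the contrapositive is used so that P
-- itself, and not only its double negation, is asserted off the intervals.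
AlmostAll[0,1] : (ℝ → Set) → Set
AlmostAll[0,1] P = ∀ {δ} → 0ℚ ℚ.< δ → ∃ λ (I : ℕ → Interval) →
  (∀ n → ∑ (width ∘ I) n ℚ.≤ δ) ×
  (∀ α → 0ℝ ≤ α → α ≤ 1ℝ → (∀ k → ¬ (α ∈° I k)) → P α)

-- Indices start at 0: the terms a₁, a₂, … are a 0, a 1, ….
Lacunary : ℝ → (ℕ → ℕ) → Set
Lacunary r a = ∀ n → r * fromℕ (a n) ≤ fromℕ (a (suc n))

-- Let K be such that 4 a n ≤ a (n + K), and put L = ⌊log₂ (N - 1)⌋.  Among the first
-- 2 ^ L terms choose a subsequence A₀, A₁, …, A_J with ratios ≥ 4 ^ (L + 1), where
-- J = 4 Q L and Q is of order 2 ^ L / L².  The α for which every α Aⱼ avoids, modulo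
-- 1, a fixed arc [c/Q, (c + 1)/Q] lie in nested families of grid cells k/(Q Aⱼ),
-- whose total length shrinks by a factor 1 - 1/2Q at each step, hence to O(4 ^ (-L)).
-- Summing over the Q arcs and over all large L gives small total length, so off these
-- cells no gap exceeds 4/Q = O(L² / N).  This is below (log N) ^ (2 + ε) / N because
-- (log N) ^ ε outgrows every constant.  That last fact only needs the inequalities
-- (1 + h) exp x ≤ exp (x + h) ≤ exp x / (1 - h), which hold for the partial sums of
-- the exponential series.  All inequalities between reals are tested on rational
-- approximations at a single large index.

module Submission where

open import Data.Fin.Base using (toℕ)
open import Data.Nat.Base as ℕ using (ℕ; suc)
open import Data.Product.Base using (∃)

-- The exponent 2 comes from two separate factors L. Avoiding one arc of length 1/Q gains only 1 -
-- 1/2Q per scale, so of the order of Q L scales are needed before the union over Q ≤ 2 ^ L arcs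
-- becomes summable in L. Consecutive scales must differ by 4 Q², which costs of the order of L
-- indices each. This uses up Q L² terms out of 2 ^ L. In place of probabilistic independence there
-- is a comparison of neighbouring scales: a cell contains whole periods of the next scale except at
-- its two ends, and the ratio 4 Q² keeps the cost of these ends to half of the gain. The surplus ε
-- only has to absorb a constant, yet log N and log log N are accessible only through the
-- exponential series. Upper bounds by powers of 1/(1 - h) and lower bounds by powers of 1 + h
-- differ by order h² per step; with 4 h ≤ ε the surplus exponent supplies an extra 4 h² per step,
-- which is more than the difference. Comparison of reals is undecidable, so the gap estimate
-- refutes the opposite strict inequality, at one index where every comparison is between rationals.

module NestedCells where
  open import Data.List.Base using (List; []; _∷_; length; map; concatMap; upTo; _++_; cartesianProductWith)
  open import Data.List.Membership.Propositional using (_∈_; lose)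
  open import Data.List.Membership.Propositional.Properties using (∈-cartesianProductWith⁺; ∈-upTo⁺; ∈-concatMap⁺)
  open import Data.List.Properties using (length-++; length-map; length-upTo)
  open import Data.Nat.Base
  open import Data.Nat.DivMod
  open import Data.Nat.Properties
  open import Data.Nat.Tactic.RingSolver using (solve-∀)
  open import Data.Product.Base using (_×_; _,_)
  open import Relation.Binary.PropositionalEquality using (_≡_; _≢_; refl; sym; trans; cong; cong₂; subst; module ≡-Reasoning)
  open import Relation.Nullary.Decidable.Core using (yes; no)

  -- Counting the grid cells of points that avoid an arc modulo 1

  length-concatMap-* : ∀ {a b} {A : Set a} {B : Set b} (f : A → List B) w {n} →
    (∀ x → length (f x) * w ≤ n) → ∀ xs → length (concatMap f xs) * w ≤ length xs * n
  length-concatMap-* f w f≤n []       = z≤n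
  length-concatMap-* f w f≤n (x ∷ xs) = begin
    length (f x ++ concatMap f xs) * w              ≡⟨ cong (_* w) (length-++ (f x)) ⟩
    (length (f x) + length (concatMap f xs)) * w    ≡⟨ *-distribʳ-+ w (length (f x)) _ ⟩
    length (f x) * w + length (concatMap f xs) * w  ≤⟨ +-mono-≤ (f≤n x) (length-concatMap-* f w f≤n xs) ⟩
    _                                               ∎
    where open ≤-Reasoning

  <[1+/]* : ∀ m n .{{_ : NonZero n}} → m < suc (m / n) * n
  <[1+/]* m n = begin-strict
    m                      ≡⟨ m≡m%n+[m/n]*n m n ⟩
    m % n + m / n * n      <⟨ +-monoˡ-< (m / n * n) (m%n<n m n) ⟩
    n + m / n * n          ∎
    where open ≤-Reasoning

  ≤/ : ∀ {m n o} .{{_ : NonZero n}} → o * n ≤ m → o ≤ m / n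
  ≤/ {m} {n} {o} o*n≤m = begin
    o          ≡⟨ m*n/n≡m o n ⟨
    o * n / n  ≤⟨ /-monoˡ-≤ n o*n≤m ⟩
    m / n      ∎
    where open ≤-Reasoning

  -- The offset `d` selects the arc: `k + d ≡ q` modulo `suc q` is the excluded residue, so the
  -- values 0, ..., q of `d` run through all arcs. Truncated subtraction may produce spurious
  -- entries, which is harmless because only completeness and the length matter.
  block : ℕ → ℕ → ℕ → ℕ → List ℕ
  block q d p₀ t = cartesianProductWith (λ s i → (p₀ + s) * suc q + i ∸ d) (upTo t) (upTo q)

  length-block : ∀ q d p₀ t → length (block q d p₀ t) ≡ t * q
  length-block q d p₀ t = trans (go (upTo t)) (cong₂ _*_ (length-upTo t) (length-upTo q))
    where
    go : ∀ xs → length (cartesianProductWith (λ s i → (p₀ + s) * suc q + i ∸ d) xs (upTo q)) ≡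
         length xs * length (upTo q)
    go []       = refl
    go (x ∷ xs) = trans (length-++ (map _ (upTo q))) (cong₂ _+_ (length-map _ (upTo q)) (go xs))

  ∈-block : ∀ {q d p₀ t k} → (k + d) % suc q ≢ q →
            p₀ ≤ (k + d) / suc q → (k + d) / suc q < p₀ + t → k ∈ block q d p₀ t
  ∈-block {q} {d} {p₀} {t} {k} avoids lo hi = subst (_∈ block q d p₀ t) eq
    (∈-cartesianProductWith⁺ _
      (∈-upTo⁺ (+-cancelˡ-< p₀ (p ∸ p₀) t (subst (_< p₀ + t) (sym (m+[n∸m]≡n lo)) hi)))
      (∈-upTo⁺ (≤∧≢⇒< (s≤s⁻¹ (m%n<n (k + d) (suc q))) avoids)))
    where
    open ≡-Reasoning
    p = (k + d) / suc q
    i = (k + d) % suc q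
    eq : (p₀ + (p ∸ p₀)) * suc q + i ∸ d ≡ k
    eq = begin
      (p₀ + (p ∸ p₀)) * suc q + i ∸ d ≡⟨ cong (λ x → x * suc q + i ∸ d) (m+[n∸m]≡n lo) ⟩
      p * suc q + i ∸ d               ≡⟨ cong (_∸ d) (+-comm (p * suc q) i) ⟩
      i + p * suc q ∸ d               ≡⟨ cong (_∸ d) (m≡m%n+[m/n]*n (k + d) (suc q)) ⟨
      k + d ∸ d                       ≡⟨ m+n∸n≡m k d ⟩
      k                               ∎

  -- Each cell k at scale A stands for the real numbers x with k ≤ x Q A < k + 1.
  module Cells (q : ℕ) (B : ℕ → ℕ) where

    Q : ℕ
    Q = suc q

    A : ℕ → ℕ
    A j = suc (B j)

    -- A cell of width 1/(Q a) spans a′/(Q a) periods of length 1/a′ at the next scale. The two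
    -- additional periods cover the rounding of this quotient and the cut-off periods at both ends.
    children : ℕ → ℕ → ℕ → List ℕ
    children d j k = block q d ((k * A (suc j) / A j + d) / Q) (A (suc j) / (Q * A j) + 2)

    cells : ℕ → ℕ → List ℕ
    -- Room for all x < 2: rational approximations of a number in [0,1] may exceed 1. One more
    -- period accommodates the offset `d`.
    cells d zero    = block q d 0 (2 * A 0 + 1)
    cells d (suc j) = concatMap (children d j) (cells d j)

    module _ (P D : ℕ) .{{_ : NonZero D}} where

      cellOf : ℕ → ℕ
      cellOf j = P * Q * A j / D

      ∈-cells-zero : ∀ {d} → d ≤ q → P < 2 * D → (cellOf 0 + d) % Q ≢ q → cellOf 0 ∈ cells d 0
      ∈-cells-zero {d} d≤q P<2D avoids = ∈-block {t = 2 * A 0 + 1} avoids z≤n (m<n*o⇒m/o<n (begin-strict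
        cellOf 0 + d            <⟨ +-mono-<-≤ cell< d≤q ⟩
        2 * A 0 * Q + q         ≤⟨ +-monoʳ-≤ (2 * A 0 * Q) (n≤1+n q) ⟩
        2 * A 0 * Q + Q         ≡⟨ lem (2 * A 0) Q ⟩
        (2 * A 0 + 1) * Q       ∎))
        where
        open ≤-Reasoning
        lem : ∀ x y → x * y + y ≡ (x + 1) * y
        lem = solve-∀
        lem₂ : ∀ D A Q → 2 * D * Q * A ≡ 2 * A * Q * D
        lem₂ = solve-∀
        cell< : cellOf 0 < 2 * A 0 * Q
        cell< = m<n*o⇒m/o<n (begin-strict
          P * Q * A 0       <⟨ *-monoˡ-< (A 0) (*-monoˡ-< Q P<2D) ⟩
          2 * D * Q * A 0   ≡⟨ lem₂ D (A 0) Q ⟩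
          2 * A 0 * Q * D   ∎)

      -- With x = P/D, scaling k ≤ x Q a < k + 1 by a′/a confines x Q a′ to an interval of length
      -- a′/a that starts at k a′/a. All comparisons are made after multiplying by `D` or `a`.
      ∈-children : ∀ {d j} → (cellOf (suc j) + d) % Q ≢ q →
                   cellOf (suc j) ∈ children d j (cellOf j)
      ∈-children {d} {j} avoids = ∈-block avoids
        (/-monoˡ-≤ Q (+-monoˡ-≤ d lower))
        (m<n*o⇒m/o<n upper)
        where
        open ≤-Reasoning
        k = cellOf j
        k′ = cellOf (suc j)
        a = A j
        a′ = A (suc j)
        l = k * a′ / a
        p₀ = (l + d) / Q
        t = a′ / (Q * a)
        lower : l ≤ k′
        lower = ≤/ (*-cancelʳ-≤ (l * D) (P * Q * a′) a (begin
          l * D * a          ≡⟨ lem l D a ⟩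
          l * a * D          ≤⟨ *-monoˡ-≤ D (m/n*n≤m (k * a′) a) ⟩
          k * a′ * D         ≡⟨ lem k a′ D ⟩
          k * D * a′         ≤⟨ *-monoˡ-≤ a′ (m/n*n≤m (P * Q * a) D) ⟩
          P * Q * a * a′     ≡⟨ lem (P * Q) a a′ ⟩
          P * Q * a′ * a     ∎))
          where
          lem : ∀ x y z → x * y * z ≡ x * z * y
          lem = solve-∀
        k′a<[k+1]a′ : k′ * a < suc k * a′
        k′a<[k+1]a′ = *-cancelʳ-< D (k′ * a) (suc k * a′) (begin-strict
          k′ * a * D         ≡⟨ lem k′ a D ⟩
          k′ * D * a         ≤⟨ *-monoˡ-≤ a (m/n*n≤m (P * Q * a′) D) ⟩
          P * Q * a′ * a     ≡⟨ lem (P * Q) a′ a ⟩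
          P * Q * a * a′     <⟨ *-monoˡ-< a′ (<[1+/]* (P * Q * a) D) ⟩
          suc k * D * a′     ≡⟨ lem (suc k) D a′ ⟩
          suc k * a′ * D     ∎)
          where
          lem : ∀ x y z → x * y * z ≡ x * z * y
          lem = solve-∀
        k′< : k′ < suc l + suc t * Q
        k′< = *-cancelʳ-< a k′ (suc l + suc t * Q) (begin-strict
          k′ * a                     <⟨ k′a<[k+1]a′ ⟩
          a′ + k * a′                <⟨ +-mono-< (<[1+/]* a′ (Q * a)) (<[1+/]* (k * a′) a) ⟩
          suc t * (Q * a) + suc l * a ≡⟨ lem (suc t) Q a (suc l) ⟩
          (suc l + suc t * Q) * a    ∎)
          where
          lem : ∀ t Q a l → t * (Q * a) + l * a ≡ (l + t * Q) * a
          lem = solve-∀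
        upper : k′ + d < (p₀ + (t + 2)) * Q
        upper = begin-strict
          k′ + d                      <⟨ +-monoˡ-< d k′< ⟩
          suc l + suc t * Q + d       ≡⟨ lem l (suc t * Q) d ⟩
          suc (l + d) + suc t * Q     ≤⟨ +-monoˡ-≤ (suc t * Q) (<[1+/]* (l + d) Q) ⟩
          suc p₀ * Q + suc t * Q      ≡⟨ lem₂ p₀ t Q ⟩
          (p₀ + (t + 2)) * Q          ∎
          where
          lem : ∀ x y z → suc x + y + z ≡ suc (x + z) + y
          lem = solve-∀
          lem₂ : ∀ p t Q → suc p * Q + suc t * Q ≡ (p + (t + 2)) * Q
          lem₂ = solve-∀

      ∈-cells : ∀ {d} → d ≤ q → P < 2 * D → ∀ j → (∀ {i} → i ≤ j → (cellOf i + d) % Q ≢ q) →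
                cellOf j ∈ cells d j
      ∈-cells d≤q P<2D zero    avoids = ∈-cells-zero d≤q P<2D (avoids ≤-refl)
      ∈-cells {d} d≤q P<2D (suc j) avoids = ∈-concatMap⁺ (children d j)
        (lose (∈-cells d≤q P<2D j (λ i≤j → avoids (m≤n⇒m≤1+n i≤j)))
              (∈-children (avoids ≤-refl)))

    module _ (lacunary : ∀ j → 4 * (Q * Q) * A j ≤ A (suc j)) where

      -- Passing from one scale to the next multiplies the total length of the
      -- cells by at most (2Q - 1) / 2Q.
      children-decay : ∀ j → (A (suc j) / (Q * A j) + 2) * q * (2 * Q) * A j ≤ suc (2 * q) * A (suc j)
      children-decay j = begin
        (t + 2) * q * (2 * Q) * a              ≡⟨ lem t q Q a ⟩
        2 * q * (t * (Q * a)) + 4 * (q * Q) * a ≤⟨ +-mono-≤ (*-monoʳ-≤ (2 * q) (m/n*n≤m a′ (Q * a)))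
                                                   (*-monoˡ-≤ a (*-monoʳ-≤ 4 (*-monoˡ-≤ Q (n≤1+n q)))) ⟩
        -- Leaving out one arc saves 2 a′ of the full 2 Q a′; the two additional periods give back
        -- at most one a′.
        2 * q * a′ + 4 * (Q * Q) * a           ≤⟨ +-monoʳ-≤ (2 * q * a′) (lacunary j) ⟩
        2 * q * a′ + a′                        ≡⟨ +-comm (2 * q * a′) a′ ⟩
        suc (2 * q) * a′                       ∎
        where
        open ≤-Reasoning
        a = A j
        a′ = A (suc j)
        t = a′ / (Q * a)
        lem : ∀ t q Q a → (t + 2) * q * (2 * Q) * a ≡ 2 * q * (t * (Q * a)) + 4 * (q * Q) * a
        lem = solve-∀

      -- Iterates `children-decay`. Since a cell has width 1/(Q A j), the total length is thereby at
      -- most 3 (1 - 1/2Q) ^ j; the 3 comes from `2 * A 0 + 1 ≤ 3 * A 0`.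
      length-cells : ∀ d j → length (cells d j) * (2 * Q) ^ j ≤ 3 * suc (2 * q) ^ j * (Q * A j)
      length-cells d zero = begin
        length (cells d 0) * 1      ≡⟨ *-identityʳ (length (cells d 0)) ⟩
        length (cells d 0)          ≡⟨ length-block q d 0 (2 * A 0 + 1) ⟩
        (2 * A 0 + 1) * q           ≤⟨ *-mono-≤ (+-monoʳ-≤ (2 * A 0) (s≤s (z≤n {B 0}))) (n≤1+n q) ⟩
        (2 * A 0 + A 0) * Q         ≡⟨ lem (A 0) Q ⟩
        3 * (Q * A 0)               ∎
        where
        open ≤-Reasoning
        lem : ∀ a Q → (2 * a + a) * Q ≡ 3 * (Q * a)
        lem = solve-∀
      length-cells d (suc j) = *-cancelʳ-≤ _ _ (A j) (begin
        length (cells d (suc j)) * R * A j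
          ≤⟨ *-monoˡ-≤ (A j) (length-concatMap-* (children d j) R
               (λ k → ≤-reflexive (cong (_* R) (length-block q d ((k * A (suc j) / A j + d) / Q) T)))
               (cells d j)) ⟩
        C * (T * q * R) * A j
          ≡⟨ lem C (T * q) (2 * Q) ((2 * Q) ^ j) (A j) ⟩
        C * (2 * Q) ^ j * (T * q * (2 * Q) * A j)
          ≤⟨ *-mono-≤ (length-cells d j) (children-decay j) ⟩
        3 * suc (2 * q) ^ j * (Q * A j) * (suc (2 * q) * A (suc j))
          ≡⟨ lem₂ (suc (2 * q) ^ j) Q (A j) (suc (2 * q)) (A (suc j)) ⟩
        3 * (suc (2 * q) * suc (2 * q) ^ j) * (Q * A (suc j)) * A j ∎)
        where
        open ≤-Reasoning
        C = length (cells d j)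
        T = A (suc j) / (Q * A j) + 2
        R = (2 * Q) ^ suc j
        lem : ∀ C T Q R a → C * (T * (Q * R)) * a ≡ C * R * (T * Q * a)
        lem = solve-∀
        lem₂ : ∀ R Q a s a′ → 3 * R * (Q * a) * (s * a′) ≡ 3 * (s * R) * (Q * a′) * a
        lem₂ = solve-∀

  -- Elementary growth estimates in ℕ

  bernoulli-ℕ : ∀ m n → (m + n) * m ^ n ≤ m * suc m ^ n
  bernoulli-ℕ m zero = ≤-reflexive (cong (_* 1) (+-identityʳ m))
  bernoulli-ℕ m (suc n) = begin
    (m + suc n) * (m * m ^ n)     ≡⟨ lem m n (m ^ n) ⟩
    (m * m + m + n * m) * m ^ n         ≤⟨ *-monoˡ-≤ (m ^ n) (m≤m+n (m * m + m + n * m) n) ⟩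
    (m * m + m + n * m + n) * m ^ n   ≡⟨ lem₂ m n (m ^ n) ⟩
    suc m * ((m + n) * m ^ n)     ≤⟨ *-monoʳ-≤ (suc m) (bernoulli-ℕ m n) ⟩
    suc m * (m * suc m ^ n)       ≡⟨ lem₃ (suc m) m (suc m ^ n) ⟩
    m * (suc m * suc m ^ n)       ∎
    where
    open ≤-Reasoning
    lem : ∀ m n r → (m + suc n) * (m * r) ≡ (m * m + m + n * m) * r
    lem = solve-∀
    lem₂ : ∀ m n r → (m * m + m + n * m + n) * r ≡ suc m * ((m + n) * r)
    lem₂ = solve-∀
    lem₃ : ∀ x y z → x * (y * z) ≡ y * (x * z)
    lem₃ = solve-∀

  -- Bernoulli's inequality for (1 + 1 / (2q + 1)) ^ (2q + 2).
  halving : ∀ q → 2 * suc (2 * q) ^ (2 * suc q) ≤ (2 * suc q) ^ (2 * suc q)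
  halving q = *-cancelˡ-≤ m (begin
    m * (2 * m ^ n)           ≤⟨ m≤m+n _ (m ^ n) ⟩
    m * (2 * m ^ n) + m ^ n   ≡⟨ lem q (m ^ n) ⟩
    (m + n) * m ^ n           ≤⟨ bernoulli-ℕ m n ⟩
    m * suc m ^ n             ≡⟨ cong (λ x → m * x ^ n) (lem₂ q) ⟩
    m * n ^ n                 ∎)
    where
    open ≤-Reasoning
    m = suc (2 * q)
    n = 2 * suc q
    lem : ∀ q r → suc (2 * q) * (2 * r) + r ≡ (suc (2 * q) + 2 * suc q) * r
    lem = solve-∀
    lem₂ : ∀ q → suc (suc (2 * q)) ≡ 2 * suc q
    lem₂ = solve-∀

  *-distrib-^ : ∀ m n i → (m * n) ^ i ≡ m ^ i * n ^ i
  *-distrib-^ m n zero    = refl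
  *-distrib-^ m n (suc i) = trans (cong (m * n *_) (*-distrib-^ m n i)) (lem m n (m ^ i) (n ^ i))
    where
    lem : ∀ a b c d → a * b * (c * d) ≡ a * c * (b * d)
    lem = solve-∀

  halving-^ : ∀ q i → 2 ^ i * suc (2 * q) ^ (2 * suc q * i) ≤ (2 * suc q) ^ (2 * suc q * i)
  halving-^ q i = begin
    2 ^ i * m ^ (n * i)      ≡⟨ cong (2 ^ i *_) (^-*-assoc m n i) ⟨
    2 ^ i * (m ^ n) ^ i      ≡⟨ *-distrib-^ 2 (m ^ n) i ⟨
    (2 * m ^ n) ^ i          ≤⟨ ^-monoˡ-≤ i (halving q) ⟩
    (n ^ n) ^ i              ≡⟨ ^-*-assoc n n i ⟩
    n ^ (n * i)              ∎
    where
    open ≤-Reasoning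
    m = suc (2 * q)
    n = 2 * suc q

  module Growth (a : ℕ → ℕ) (increasing : ∀ n → a n < a (suc n)) where

    a-mono : ∀ n i → a n ≤ a (i + n)
    a-mono n zero    = ≤-refl
    a-mono n (suc i) = ≤-trans (a-mono n i) (<⇒≤ (increasing (i + n)))

    -- Each step adds at least 1/M of the current term, hence at least a n / M because the sequence
    -- increases. At i = 3 M this already quadruples `a n`.
    linear-growth : ∀ M → (∀ n → suc M * a n ≤ M * a (suc n)) → ∀ n i → (M + i) * a n ≤ M * a (i + n)
    linear-growth M ratio n zero    = ≤-reflexive (cong (_* a n) (+-identityʳ M))
    linear-growth M ratio n (suc i) = begin
      (M + suc i) * a n         ≡⟨ lem M i (a n) ⟩
      a n + (M + i) * a n       ≤⟨ +-mono-≤ (a-mono n i) (linear-growth M ratio n i) ⟩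
      suc M * a (i + n)         ≤⟨ ratio (i + n) ⟩
      M * a (suc (i + n))       ∎
      where
      open ≤-Reasoning
      lem : ∀ M i a → (M + suc i) * a ≡ a + (M + i) * a
      lem = solve-∀

    quadrupling : ∀ m → (∀ n → suc (suc m) * a n ≤ suc m * a (suc n)) →
                  ∀ n → 4 * a n ≤ a (3 * suc m + n)
    quadrupling m ratio n = *-cancelˡ-≤ M (begin
      M * (4 * a n)         ≡⟨ lem M (a n) ⟩
      (M + 3 * M) * a n     ≤⟨ linear-growth M ratio n (3 * M) ⟩
      M * a (3 * M + n)     ∎)
      where
      open ≤-Reasoning
      M = suc m
      lem : ∀ M a → M * (4 * a) ≡ (M + 3 * M) * a
      lem = solve-∀

  1+n≤2^n : ∀ n → suc n ≤ 2 ^ n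
  1+n≤2^n zero    = ≤-refl
  1+n≤2^n (suc n) = begin
    suc (suc n)    ≤⟨ s≤s (m≤n+m (suc n) n) ⟩
    suc n + suc n  ≤⟨ +-mono-≤ (1+n≤2^n n) (1+n≤2^n n) ⟩
    2 ^ n + 2 ^ n  ≡⟨ cong (2 ^ n +_) (+-identityʳ (2 ^ n)) ⟨
    2 * 2 ^ n      ∎
    where open ≤-Reasoning

  -- At l₀ = 3 N the cubic bound (N + 1)³ ≤ 2 ^ (3 N) beats the quadratic. Beyond l₀ the right side
  -- doubles while l (l + 1) grows by the factor (l + 2)/l ≤ 2.
  quadratic≤2^ : ∀ c → ∃ λ l₀ → ∀ l → l₀ ≤ l → c * (l * suc l) ≤ 2 ^ l
  quadratic≤2^ c = l₀ , λ l l₀≤l → subst (λ l → c * (l * suc l) ≤ 2 ^ l) (m∸n+n≡m l₀≤l) (go (l ∸ l₀))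
    where
    open ≤-Reasoning
    N = suc (9 * c)
    l₀ = 3 * N
    go : ∀ i → c * ((i + l₀) * suc (i + l₀)) ≤ 2 ^ (i + l₀)
    go zero = begin
      c * (l₀ * suc l₀)                    ≤⟨ m≤m+n _ _ ⟩
      c * (l₀ * suc l₀) + (33 * c * N + 7 * N + 1)
          ≡⟨ lem c ⟩
      suc N * suc N * suc N                ≤⟨ *-mono-≤ (*-mono-≤ (1+n≤2^n N) (1+n≤2^n N)) (1+n≤2^n N) ⟩
      2 ^ N * 2 ^ N * 2 ^ N                ≡⟨ lem₂ (2 ^ N) ⟩
      (2 ^ N) ^ 3                          ≡⟨ ^-*-assoc 2 N 3 ⟩
      2 ^ (N * 3)                          ≡⟨ cong (2 ^_) (*-comm N 3) ⟩
      2 ^ l₀                               ∎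
      where
      lem : ∀ c → c * (3 * suc (9 * c) * suc (3 * suc (9 * c))) + (33 * c * suc (9 * c) + 7 * suc (9 * c) + 1) ≡ suc (suc (9 * c)) * suc (suc (9 * c)) * suc (suc (9 * c))
      lem = solve-∀
      lem₂ : ∀ x → x * x * x ≡ x * (x * (x * 1))
      lem₂ = solve-∀
    go (suc i) = begin
      c * (suc l * suc (suc l))     ≤⟨ *-monoʳ-≤ c (*-monoʳ-≤ (suc l) (+-monoˡ-≤ l 2≤l)) ⟩
      c * (suc l * (l + l))         ≡⟨ lem c l ⟩
      2 * (c * (l * suc l))         ≤⟨ *-monoʳ-≤ 2 (go i) ⟩
      2 * 2 ^ l                     ∎
      where
      l = i + l₀
      2≤l : 2 ≤ l
      2≤l = ≤-trans (≤-trans (m≤n+m 2 1) (*-monoʳ-≤ 3 (s≤s (z≤n {9 * c})))) (m≤n+m l₀ i)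
      lem : ∀ c l → c * (suc l * (l + l)) ≡ 2 * (c * (l * suc l))
      lem = solve-∀

  -- The first 2 ^ L terms contain a subsequence A₀, …, A_J with ratios at least
  -- 4Q², where Q is of order 2 ^ L / L²; J is chosen so that the (1 - 1/2Q) ^ J
  -- lost in measure is at most 4 ^ (-L).
  module Scale (b : ℕ → ℕ) (K′ : ℕ) (growth : ∀ n → 4 * suc (b n) ≤ suc (b (suc K′ + n))) (l : ℕ)
    (large : 4 * suc K′ * (suc l * suc (suc l)) ≤ 2 ^ suc l) where

    K L X s q : ℕ
    K = suc K′
    L = suc l
    -- `Q * X` equals `J * s`, so Q = ⌊2 ^ L / X⌋ is the largest number of arcs for which the last
    -- sampled index is at most 2 ^ L. The stride `s` allows L + 1 quadruplings.
    X = 4 * K * (L * suc L)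
    s = suc L * K
    q = pred (2 ^ L / X)

    open Cells q (λ j → b (j * s)) public

    J : ℕ
    J = 2 * Q * (2 * L)

    Q≡ : Q ≡ 2 ^ L / X
    Q≡ = suc-pred (2 ^ L / X) {{>-nonZero (m≥n⇒m/n>0 large)}}

    Q≤2^L : Q ≤ 2 ^ L
    Q≤2^L = subst (_≤ 2 ^ L) (sym Q≡) (m/n≤m (2 ^ L) X)

    -- Rounding down to an integer Q ≥ 1 loses at most a factor 2. This turns 1/Q back into a
    -- multiple of L² / 2 ^ L.
    2^L≤2QX : 2 ^ L ≤ 2 * Q * X
    2^L≤2QX = begin
      2 ^ L                  ≤⟨ <⇒≤ (<[1+/]* (2 ^ L) X) ⟩
      suc (2 ^ L / X) * X    ≡⟨ cong (λ x → suc x * X) Q≡ ⟨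
      suc Q * X              ≤⟨ *-monoˡ-≤ X (s≤s (m≤n+m Q q)) ⟩
      suc (q + Q) * X        ≡⟨ lem q X ⟩
      2 * Q * X              ∎
      where
      open ≤-Reasoning
      lem : ∀ q X → suc (q + suc q) * X ≡ 2 * suc q * X
      lem = solve-∀

    Js≤2^L : J * s ≤ 2 ^ L
    Js≤2^L = begin
      J * s            ≡⟨ lem Q L K ⟩
      Q * X            ≡⟨ cong (_* X) Q≡ ⟩
      2 ^ L / X * X    ≤⟨ m/n*n≤m (2 ^ L) X ⟩
      2 ^ L            ∎
      where
      open ≤-Reasoning
      lem : ∀ Q L K → 2 * Q * (2 * L) * (suc L * K) ≡ Q * (4 * K * (L * suc L))
      lem = solve-∀

    growth-^ : ∀ n i → 4 ^ i * suc (b n) ≤ suc (b (i * K + n))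
    growth-^ n zero    = ≤-reflexive (*-identityˡ (suc (b n)))
    growth-^ n (suc i) = begin
      4 * 4 ^ i * suc (b n)         ≡⟨ *-assoc 4 (4 ^ i) _ ⟩
      4 * (4 ^ i * suc (b n))       ≤⟨ *-monoʳ-≤ 4 (growth-^ n i) ⟩
      4 * suc (b (i * K + n))       ≤⟨ growth (i * K + n) ⟩
      suc (b (K + (i * K + n)))     ≡⟨ cong (λ x → suc (b x)) (+-assoc K (i * K) n) ⟨
      suc (b (K + i * K + n))       ∎
      where open ≤-Reasoning

    sparse : ∀ j → 4 * (Q * Q) * A j ≤ A (suc j)
    sparse j = begin
      4 * (Q * Q) * A j           ≤⟨ *-monoˡ-≤ (A j) (*-monoʳ-≤ 4 (*-mono-≤ Q≤2^L Q≤2^L)) ⟩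
      4 * (2 ^ L * 2 ^ L) * A j   ≡⟨ cong (λ x → 4 * x * A j) (*-distrib-^ 2 2 L) ⟨
      4 ^ suc L * A j             ≤⟨ growth-^ (j * s) (suc L) ⟩
      A (suc j)                   ∎
      where open ≤-Reasoning

    allCells : List ℕ
    allCells = concatMap (λ d → cells d J) (upTo Q)

    -- `J` consists of 2 L runs of 2 Q steps, and each run halves the total length by `halving`.
    length-cells-J : ∀ d → length (cells d J) * 4 ^ L ≤ 3 * (Q * A J)
    length-cells-J d = *-cancelʳ-≤ _ _ (r ^ J) {{m^n≢0 r J}} (begin
      length (cells d J) * 4 ^ L * r ^ J
        ≡⟨ *-assoc (length (cells d J)) (4 ^ L) (r ^ J) ⟩
      length (cells d J) * (4 ^ L * r ^ J)
        ≤⟨ *-monoʳ-≤ (length (cells d J)) (subst (λ x → x * r ^ J ≤ (2 * Q) ^ J) (sym (^-*-assoc 2 2 L)) (halving-^ q (2 * L))) ⟩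
      length (cells d J) * (2 * Q) ^ J
        ≤⟨ length-cells sparse d J ⟩
      3 * r ^ J * (Q * A J)
        ≡⟨ lem 3 (r ^ J) (Q * A J) ⟩
      3 * (Q * A J) * r ^ J  ∎)
      where
      open ≤-Reasoning
      r = suc (2 * q)
      lem : ∀ x y z → x * y * z ≡ x * z * y
      lem = solve-∀

    -- One of the two factors 2 ^ L in 4 ^ L pays for the union over the arcs; the other leaves a
    -- geometric series in L.
    length-allCells : length allCells * 2 ^ L ≤ 3 * (Q * A J)
    length-allCells = *-cancelʳ-≤ _ _ (2 ^ L) {{m^n≢0 2 L}} (begin
      length allCells * 2 ^ L * 2 ^ L    ≡⟨ *-assoc (length allCells) (2 ^ L) (2 ^ L) ⟩
      length allCells * (2 ^ L * 2 ^ L)  ≡⟨ cong (length allCells *_) (*-distrib-^ 2 2 L) ⟨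
      length allCells * 4 ^ L            ≤⟨ length-concatMap-* (λ d → cells d J) (4 ^ L) length-cells-J (upTo Q) ⟩
      length (upTo Q) * (3 * (Q * A J))  ≡⟨ cong (_* (3 * (Q * A J))) (length-upTo Q) ⟩
      Q * (3 * (Q * A J))                ≤⟨ *-monoˡ-≤ (3 * (Q * A J)) Q≤2^L ⟩
      2 ^ L * (3 * (Q * A J))            ≡⟨ *-comm (2 ^ L) _ ⟩
      3 * (Q * A J) * 2 ^ L              ∎)
      where open ≤-Reasoning

    ∈-allCells : ∀ P D .{{_ : NonZero D}} → P < 2 * D → ∀ {d} → d ≤ q →
                 (∀ {n} → n ≤ 2 ^ L → (P * Q * suc (b n) / D + d) % Q ≢ q) → cellOf P D J ∈ allCells
    ∈-allCells P D P<2D {d} d≤q avoids = ∈-concatMap⁺ (λ d → cells d J)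
      (lose (∈-upTo⁺ (s≤s d≤q))
        (∈-cells P D d≤q P<2D J λ i≤J → avoids (≤-trans (*-monoˡ-≤ s i≤J) Js≤2^L)))

  bracket : ∀ {m} l → 2 ^ suc l ≤ m → ∃ λ i → 2 ^ suc (i + l) ≤ m × m < 2 ^ suc (suc (i + l))
  -- The search descends from i = m, where m < 2 ^ m makes the upper bound hold.
  bracket {m} l 2^≤m = go m (≤-trans (1+n≤2^n m) (^-monoʳ-≤ 2 (m≤n⇒m≤1+n (m≤n⇒m≤1+n (m≤m+n m l)))))
    where
    go : ∀ i → m < 2 ^ suc (suc (i + l)) → ∃ λ i → 2 ^ suc (i + l) ≤ m × m < 2 ^ suc (suc (i + l))
    go zero    m< = zero , 2^≤m , m<
    go (suc i) m< with 2 ^ suc (suc (i + l)) ≤? m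
    ... | yes ≤m = suc i , ≤m , m<
    ... | no  ≰m = go i (≰⇒> ≰m)

module GapBound where
  open import Algebra.Bundles using (module CommutativeRing)
  open import Data.Empty using (⊥; ⊥-elim)
  open import Data.Fin.Base using (Fin; inject₁)
  import Data.Fin.Base as Fin
  open import Data.Fin.Permutation using (_⟨$⟩ʳ_; _⟨$⟩ˡ_; inverseʳ)
  import Data.Fin.Properties as Fin
  open import Data.Fin.Relation.Unary.Top using (view; ‵fromℕ; ‵inject₁)
  open import Data.Integer.Base using (-[1+_]) renaming (+_ to pos)
  import Data.Integer.Base as ℤ
  import Data.Integer.Properties as ℤ
  open import Data.List.Base using (List; []; _∷_; map; length)
  open import Data.List.Membership.Propositional using (_∈_)
  open import Data.List.Membership.Propositional.Properties using (∈-map⁺)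
  open import Data.List.Relation.Unary.Any using (here; there)
  open import Data.Nat.Base using (zero)
  import Data.Nat.DivMod as ℕ
  import Data.Nat.Properties as ℕ
  open import Data.Nat.Tactic.RingSolver using () renaming (solve-∀ to ℕ-solve-∀)
  open import Data.Product.Base using (∃₂; _×_; _,_; proj₁; proj₂)
  open import Data.Rational.Base using (ℚ; 0ℚ; 1ℚ; ½; _+_; _*_; _-_; -_; _≤_; _<_; ∣_∣; _⊓_; _⊔_; mkℚ; nonNegative)
  import Data.Rational.Base as ℚ
  import Data.Rational.Properties as ℚ
  import Data.Rational.Unnormalised.Base as ℚᵘ
  import Data.Rational.Unnormalised.Properties as ℚᵘ
  open import Algebra.Definitions.RawSemiring ℚ.+-*-rawSemiring using (_^_)
  open import Algebra.Properties.CommutativeSemiring.Exp (CommutativeRing.commutativeSemiring ℚ.+-*-commutativeRing) using (^-distrib-*)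
  open import Data.Sum.Base using (_⊎_; inj₁; inj₂)
  open import Data.Vec.Functional using (insertAt)
  open import Function.Base using (_∘_)
  open import Relation.Binary.PropositionalEquality using (_≡_; refl; sym; trans; cong; cong₂; subst; module ≡-Reasoning)
  open import Relation.Nullary.Decidable.Core using (yes; no; dec⇒maybe; toWitness)
  open import Relation.Nullary.Negation.Core using (¬_)
  open import Tactic.RingSolver using (solve-∀)
  open import Tactic.RingSolver.Core.AlmostCommutativeRing using (AlmostCommutativeRing; fromCommutativeRing)
  open import Defs hiding (_+_; _*_; _-_; -_; _≤_; _<_)
  import Defs as Real
  open NestedCells using (<[1+/]*; 1+n≤2^n; quadratic≤2^; bracket; module Growth; module Scale)

  ring : AlmostCommutativeRing _ _
  ring = fromCommutativeRing ℚ.+-*-commutativeRing λ x → dec⇒maybe (0ℚ ℚ.≟ x)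

  -- Opaque copies, so that conversion checking never unfolds the witnesses.
  abstract
    archimedeanᵃ : ∀ q → ∃ λ n → q ≤ fromℕℚ n
    archimedeanᵃ = archimedean

    archimedean-*ᵃ : ∀ B {ε} → 0ℚ < ε → ∃ λ j → B ≤ ε * fromℕℚ (suc j)
    archimedean-*ᵃ = archimedean-*

    shrinkᵃ : ∀ B {ε} → 0ℚ < ε → ∃ λ η → 0ℚ < η × B * η ≤ ε
    shrinkᵃ = shrink

  -- Inequalities in ℚ

  ≤-by-slack : ∀ {p q} e → 0ℚ ≤ e → p + e ≡ q → p ≤ q
  ≤-by-slack {p} e 0≤e p+e≡q = subst (p ≤_) p+e≡q (subst (_≤ p + e) (ℚ.+-identityʳ p) (ℚ.+-monoʳ-≤ p 0≤e))

  0≤1 : 0ℚ ≤ 1ℚ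
  0≤1 = ℚ.nonNegative⁻¹ 1ℚ

  +-0≤ : ∀ {p q} → 0ℚ ≤ p → 0ℚ ≤ q → 0ℚ ≤ p + q
  +-0≤ = ℚ.+-mono-≤

  *-monoˡ : ∀ {r p q} → 0ℚ ≤ r → p ≤ q → r * p ≤ r * q
  *-monoˡ {r} 0≤r = ℚ.*-monoˡ-≤-nonNeg r {{nonNegative 0≤r}}

  *-monoʳ : ∀ {r p q} → 0ℚ ≤ r → p ≤ q → p * r ≤ q * r
  *-monoʳ {r} 0≤r = ℚ.*-monoʳ-≤-nonNeg r {{nonNegative 0≤r}}

  p≤q⇒0≤q-p : ∀ {p q} → p ≤ q → 0ℚ ≤ q - p
  p≤q⇒0≤q-p {p} {q} p≤q = subst (_≤ q - p) (ℚ.+-inverseʳ p) (ℚ.+-monoˡ-≤ (- p) p≤q)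

  0≤q-p⇒p≤q : ∀ {p q} → 0ℚ ≤ q - p → p ≤ q
  0≤q-p⇒p≤q {p} {q} 0≤q-p = ≤-by-slack (q - p) 0≤q-p (lem p q)
    where
    lem : ∀ p q → p + (q - p) ≡ q
    lem = solve-∀ ring

  ^-0≤ : ∀ {q} → 0ℚ ≤ q → ∀ n → 0ℚ ≤ q ^ n
  ^-0≤ 0≤q zero    = 0≤1
  ^-0≤ 0≤q (suc n) = *-0≤ 0≤q (^-0≤ 0≤q n)

  ∑-mono : ∀ {f g : ℕ → ℚ} → (∀ k → f k ≤ g k) → ∀ n → ∑ f n ≤ ∑ g n
  ∑-mono f≤g zero    = ℚ.≤-refl
  ∑-mono f≤g (suc n) = ℚ.+-mono-≤ (∑-mono f≤g n) (f≤g n)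

  ∑-0≤ : ∀ {f : ℕ → ℚ} → (∀ k → 0ℚ ≤ f k) → ∀ n → 0ℚ ≤ ∑ f n
  ∑-0≤ 0≤f zero    = ℚ.≤-refl
  ∑-0≤ 0≤f (suc n) = +-0≤ (∑-0≤ 0≤f n) (0≤f n)

  ∣∑∣≤∑ : ∀ {f g : ℕ → ℚ} → (∀ k → ∣ f k ∣ ≤ g k) → ∀ n → ∣ ∑ f n ∣ ≤ ∑ g n
  ∣∑∣≤∑ f≤g zero    = ℚ.≤-refl
  ∣∑∣≤∑ {f} f≤g (suc n) = ℚ.≤-trans (ℚ.∣p+q∣≤∣p∣+∣q∣ (∑ f n) (f n)) (ℚ.+-mono-≤ (∣∑∣≤∑ f≤g n) (f≤g n))

  -- Partial sums of the exponential series

  0≤1/suc : ∀ k → 0ℚ ≤ 1/suc k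
  0≤1/suc k = ℚ.<⇒≤ (1/suc-pos k)

  expTerm-0≤ : ∀ {q} → 0ℚ ≤ q → ∀ k → 0ℚ ≤ expTerm q k
  expTerm-0≤ {q} 0≤q = ExpEstimates.expTerm-nonNeg q 0≤q

  expTerm-suc : ∀ q k → q * expTerm q k ≡ fromℕℚ (suc k) * expTerm q (suc k)
  expTerm-suc q k = begin
    q * T                ≡⟨ lem₁ q T ⟩
    1ℚ * (T * q)         ≡⟨ cong (_* (T * q)) (1/suc-inverse k) ⟨
    n * c * (T * q)      ≡⟨ lem₂ n c T q ⟩
    n * (T * (q * c))    ∎
    where
    open ≡-Reasoning
    T = expTerm q k
    n = fromℕℚ (suc k)
    c = 1/suc k
    lem₁ : ∀ q T → q * T ≡ 1ℚ * (T * q)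
    lem₁ = solve-∀ ring
    lem₂ : ∀ n c T q → n * c * (T * q) ≡ n * (T * (q * c))
    lem₂ = solve-∀ ring

  -- Its recursion (tangentGap-suc) holds for x and u of any sign; it yields both
  -- the convexity bounds for x, u ≥ 0 and the second-order bound needed for x < 0.
  tangentGap : ℚ → ℚ → ℕ → ℚ
  tangentGap x u k = expTerm u (suc k) - expTerm x (suc k) - (u - x) * expTerm x k

  tangentGap-zero : ∀ x u → tangentGap x u 0 ≡ 0ℚ
  tangentGap-zero = lem
    where
    lem : ∀ x u → 1ℚ * (u * 1ℚ) - 1ℚ * (x * 1ℚ) - (u - x) * 1ℚ ≡ 0ℚ
    lem = solve-∀ ring

  -- Writing 1 as (k + 2)/(k + 2) and using `expTerm-suc` lowers every degree by one; what remains
  -- beside u times the previous gap is a perfect square times `expTerm x k`.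
  tangentGap-suc : ∀ x u k → tangentGap x u (suc k) ≡
    (u * tangentGap x u k + (u - x) * (u - x) * expTerm x k) * 1/suc (suc k)
  tangentGap-suc x u k = begin
    A * (u * c) - B * (x * c) - (u - x) * B
      ≡⟨ lem₁ A B u x c ⟩
    (u * A - x * B) * c - (u - x) * B * 1ℚ
      ≡⟨ cong (λ t → (u * A - x * B) * c - (u - x) * B * t) (1/suc-inverse (suc k)) ⟨
    (u * A - x * B) * c - (u - x) * B * (fromℕℚ (suc (suc k)) * c)
      ≡⟨ cong (λ t → (u * A - x * B) * c - (u - x) * B * (t * c)) (fromℕℚ-suc (suc k)) ⟩
    (u * A - x * B) * c - (u - x) * B * ((n + 1ℚ) * c)
      ≡⟨ lem₂ A B u x c n ⟩
    (u * A - u * B - (u - x) * (n * B)) * c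
      ≡⟨ cong (λ t → (u * A - u * B - (u - x) * t) * c) (expTerm-suc x k) ⟨
    (u * A - u * B - (u - x) * (x * C)) * c
      ≡⟨ lem₃ A B C u x c ⟩
    (u * (A - B - (u - x) * C) + (u - x) * (u - x) * C) * c ∎
    where
    open ≡-Reasoning
    A = expTerm u (suc k)
    B = expTerm x (suc k)
    C = expTerm x k
    c = 1/suc (suc k)
    n = fromℕℚ (suc k)
    lem₁ : ∀ A B u x c → A * (u * c) - B * (x * c) - (u - x) * B ≡ (u * A - x * B) * c - (u - x) * B * 1ℚ
    lem₁ = solve-∀ ring
    lem₂ : ∀ A B u x c n → (u * A - x * B) * c - (u - x) * B * ((n + 1ℚ) * c) ≡ (u * A - u * B - (u - x) * (n * B)) * c
    lem₂ = solve-∀ ring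
    lem₃ : ∀ A B C u x c → (u * A - u * B - (u - x) * (x * C)) * c ≡ (u * (A - B - (u - x) * C) + (u - x) * (u - x) * C) * c
    lem₃ = solve-∀ ring

  -- The partial sum with n terms is the derivative of the one with n + 1 terms, so this is the
  -- first-order expansion at x with its exact remainder.
  ∑-tangentGap : ∀ x u n →
    expSum u (suc n) ≡ expSum x (suc n) + (u - x) * expSum x n + ∑ (tangentGap x u) n
  ∑-tangentGap x u zero = lem x u
    where
    lem : ∀ x u → 0ℚ + 1ℚ ≡ 0ℚ + 1ℚ + (u - x) * 0ℚ + 0ℚ
    lem = solve-∀ ring
  ∑-tangentGap x u (suc n) = trans (cong (_+ expTerm u (suc n)) (∑-tangentGap x u n))
    (lem (expSum x (suc n)) (u - x) (expSum x n) (∑ (tangentGap x u) n)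
         (expTerm u (suc n)) (expTerm x (suc n)) (expTerm x n))
    where
    lem : ∀ E h E′ S A B C → E + h * E′ + S + A ≡ E + B + h * (E′ + C) + (S + (A - B - h * C))
    lem = solve-∀ ring


  square-0≤ : ∀ q → 0ℚ ≤ q * q
  square-0≤ q with ℚ.≤-total 0ℚ q
  ... | inj₁ 0≤q = *-0≤ 0≤q 0≤q
  ... | inj₂ q≤0 = subst (0ℚ ≤_) (lem q) (*-0≤ (ℚ.neg-antimono-≤ q≤0) (ℚ.neg-antimono-≤ q≤0))
    where
    lem : ∀ q → - q * - q ≡ q * q
    lem = solve-∀ ring

  tangentGap-0≤ : ∀ {x u} → 0ℚ ≤ x → 0ℚ ≤ u → ∀ k → 0ℚ ≤ tangentGap x u k
  tangentGap-0≤ {x} {u} 0≤x 0≤u zero = ℚ.≤-reflexive (sym (tangentGap-zero x u))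
  tangentGap-0≤ {x} {u} 0≤x 0≤u (suc k) = subst (0ℚ ≤_) (sym (tangentGap-suc x u k))
    (*-0≤ (+-0≤ (*-0≤ 0≤u (tangentGap-0≤ 0≤x 0≤u k)) (*-0≤ (square-0≤ (u - x)) (expTerm-0≤ 0≤x k)))
          (0≤1/suc (suc k)))

  module _ {M x u} (∣x∣≤M : ∣ x ∣ ≤ M) (∣u∣≤M : ∣ u ∣ ≤ M) where
    private
      0≤M = ℚ.≤-trans (ℚ.0≤∣p∣ x) ∣x∣≤M
      h² = (u - x) * (u - x)

    ∣tangentGap-suc∣≤ : ∀ k {B} → ∣ tangentGap x u k ∣ ≤ B →
                        ∣ tangentGap x u (suc k) ∣ ≤ (M * B + h² * expTerm M k) * 1/suc (suc k)
    ∣tangentGap-suc∣≤ k {B} gap≤B = begin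
      ∣ tangentGap x u (suc k) ∣
        ≡⟨ cong ∣_∣ (tangentGap-suc x u k) ⟩
      ∣ (u * tangentGap x u k + h² * expTerm x k) * c ∣
        ≡⟨ ℚ.∣p*q∣≡∣p∣*∣q∣ (u * tangentGap x u k + h² * expTerm x k) c ⟩
      ∣ u * tangentGap x u k + h² * expTerm x k ∣ * ∣ c ∣
        ≡⟨ cong (∣ u * tangentGap x u k + h² * expTerm x k ∣ *_) (ℚ.0≤p⇒∣p∣≡p 0≤c) ⟩
      ∣ u * tangentGap x u k + h² * expTerm x k ∣ * c
        ≤⟨ *-monoʳ 0≤c (ℚ.∣p+q∣≤∣p∣+∣q∣ (u * tangentGap x u k) (h² * expTerm x k)) ⟩
      (∣ u * tangentGap x u k ∣ + ∣ h² * expTerm x k ∣) * c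
        ≡⟨ cong₂ (λ s t → (s + t) * c) (ℚ.∣p*q∣≡∣p∣*∣q∣ u _)
             (trans (ℚ.∣p*q∣≡∣p∣*∣q∣ h² _) (cong (_* ∣ expTerm x k ∣) (ℚ.0≤p⇒∣p∣≡p (square-0≤ (u - x))))) ⟩
      (∣ u ∣ * ∣ tangentGap x u k ∣ + h² * ∣ expTerm x k ∣) * c
        ≤⟨ *-monoʳ 0≤c (ℚ.+-mono-≤
             (*-mono (ℚ.0≤∣p∣ u) (ℚ.≤-trans (ℚ.0≤∣p∣ (tangentGap x u k)) gap≤B) ∣u∣≤M gap≤B)
             (*-monoˡ (square-0≤ (u - x)) (ExpEstimates.expTerm-bound M 0≤M k ∣x∣≤M))) ⟩
      (M * B + h² * expTerm M k) * c ∎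
      where
      open ℚ.≤-Reasoning
      c = 1/suc (suc k)
      0≤c = 0≤1/suc (suc k)

    -- A Taylor remainder: the second derivative of t ^ (k + 2)/(k + 2)! is t ^ k/k!. The induction
    -- closes because M times `expTerm M k` is k + 1 times the next term, and (k + 1) + 1 ≤ k + 3.
    ∣tangentGap∣≤ : ∀ k → ∣ tangentGap x u (suc k) ∣ ≤ h² * expTerm M k
    ∣tangentGap∣≤ zero = ℚ.≤-trans
      (∣tangentGap-suc∣≤ 0 {0ℚ} (ℚ.≤-reflexive (cong ∣_∣ (tangentGap-zero x u))))
      (≤-by-slack (h² * ½) (*-0≤ (square-0≤ (u - x)) (ℚ.nonNegative⁻¹ ½)) (lem M h²))
      where
      lem : ∀ M h → (M * 0ℚ + h * 1ℚ) * ½ + h * ½ ≡ h * 1ℚ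
      lem = solve-∀ ring
    ∣tangentGap∣≤ (suc k) = begin
      ∣ tangentGap x u (suc (suc k)) ∣
        ≤⟨ ∣tangentGap-suc∣≤ (suc k) (∣tangentGap∣≤ k) ⟩
      (M * (h² * expTerm M k) + h² * T) * c
        ≡⟨ lem M h² (expTerm M k) T c ⟩
      h² * (M * expTerm M k + T) * c
        ≡⟨ cong (λ t → h² * (t + T) * c) (expTerm-suc M k) ⟩
      h² * (n * T + T) * c
        ≡⟨ lem₂ h² n T c ⟩
      h² * T * ((n + 1ℚ) * c)
        ≤⟨ *-monoˡ (*-0≤ (square-0≤ (u - x)) (expTerm-0≤ 0≤M (suc k)))
             (≤-by-slack c (0≤1/suc (suc (suc k))) (trans (lem₃ n c) inverse)) ⟩
      h² * T * 1ℚ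
        ≡⟨ ℚ.*-identityʳ (h² * T) ⟩
      h² * T ∎
      where
      open ℚ.≤-Reasoning
      T = expTerm M (suc k)
      c = 1/suc (suc (suc k))
      n = fromℕℚ (suc k)
      inverse : (n + 1ℚ + 1ℚ) * c ≡ 1ℚ
      inverse = trans (cong (_* c) (sym (trans (fromℕℚ-suc (suc (suc k))) (cong (_+ 1ℚ) (fromℕℚ-suc (suc k))))))
                      (1/suc-inverse (suc (suc k)))
      lem : ∀ M h T₀ T c → (M * (h * T₀) + h * T) * c ≡ h * (M * T₀ + T) * c
      lem = solve-∀ ring
      lem₂ : ∀ h n T c → h * (n * T + T) * c ≡ h * T * ((n + 1ℚ) * c)
      lem₂ = solve-∀ ring
      lem₃ : ∀ n c → (n + 1ℚ) * c + c ≡ (n + 1ℚ + 1ℚ) * c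
      lem₃ = solve-∀ ring

    ∣∑tangentGap∣≤ : ∀ n → ∣ ∑ (tangentGap x u) (suc n) ∣ ≤ h² * expSum M n
    ∣∑tangentGap∣≤ zero = ℚ.≤-reflexive (trans
      (cong ∣_∣ (trans (ℚ.+-identityˡ _) (tangentGap-zero x u))) (sym (ℚ.*-zeroʳ h²)))
    ∣∑tangentGap∣≤ (suc n) = ℚ.≤-trans
      (ℚ.∣p+q∣≤∣p∣+∣q∣ (∑ (tangentGap x u) (suc n)) (tangentGap x u (suc n)))
      (subst (_ ≤_) (sym (ℚ.*-distribˡ-+ h² (expSum M n) (expTerm M n)))
        (ℚ.+-mono-≤ (∣∑tangentGap∣≤ n) (∣tangentGap∣≤ n)))

  expSum-tangent : ∀ {x u} → 0ℚ ≤ x → 0ℚ ≤ u → ∀ n →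
                   expSum x (suc n) + (u - x) * expSum x n ≤ expSum u (suc n)
  expSum-tangent {x} {u} 0≤x 0≤u n = ≤-by-slack (∑ (tangentGap x u) n) (∑-0≤ (tangentGap-0≤ 0≤x 0≤u) n)
    (sym (∑-tangentGap x u n))

  expSum-≤-suc : ∀ {x} → 0ℚ ≤ x → ∀ n → expSum x n ≤ expSum x (suc n)
  expSum-≤-suc {x} 0≤x n = ≤-by-slack (expTerm x n) (expTerm-0≤ 0≤x n) refl

  expSum-0≤ : ∀ {x} → 0ℚ ≤ x → ∀ n → 0ℚ ≤ expSum x n
  expSum-0≤ 0≤x = ∑-0≤ (expTerm-0≤ 0≤x)

  expSum-mono : ∀ {x u} → 0ℚ ≤ x → x ≤ u → ∀ n → expSum x n ≤ expSum u n
  expSum-mono {x} {u} 0≤x x≤u = ∑-mono λ k → ℚ.≤-trans (ℚ.≤-reflexive (sym (ℚ.0≤p⇒∣p∣≡p (expTerm-0≤ 0≤x k))))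
    (ExpEstimates.expTerm-bound u (ℚ.≤-trans 0≤x x≤u) k
      (ℚ.≤-trans (ℚ.≤-reflexive (ℚ.0≤p⇒∣p∣≡p 0≤x)) x≤u))

  expSum-mono-ℕ : ∀ {x} → 0ℚ ≤ x → ∀ {m n} → m ℕ.≤ n → expSum x m ≤ expSum x n
  expSum-mono-ℕ {x} 0≤x m≤n = go (ℕ.≤⇒≤′ m≤n)
    where
    go : ∀ {m n} → m ℕ.≤′ n → expSum x m ≤ expSum x n
    go ℕ.≤′-refl               = ℚ.≤-refl
    go {n = suc n} (ℕ.≤′-step m≤n) = ℚ.≤-trans (go m≤n) (expSum-≤-suc 0≤x n)

  ∣expSum∣≤ : ∀ q n → ∣ expSum q n ∣ ≤ expSum ∣ q ∣ n
  ∣expSum∣≤ q = ∣∑∣≤∑ λ k → ExpEstimates.expTerm-bound ∣ q ∣ (ℚ.0≤∣p∣ q) k ℚ.≤-refl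

  -- The tangent at x + h, evaluated at x.
  expSum-step-≤ : ∀ {x h} → 0ℚ ≤ x → 0ℚ ≤ h → ∀ n → (1ℚ - h) * expSum (x + h) n ≤ expSum x n
  expSum-step-≤ {x} {h} 0≤x 0≤h zero = ℚ.≤-reflexive (ℚ.*-zeroʳ (1ℚ - h))
  expSum-step-≤ {x} {h} 0≤x 0≤h (suc n) = ℚ.≤-trans
    (≤-by-slack (h * (E′ - E)) (*-0≤ 0≤h (p≤q⇒0≤q-p (expSum-≤-suc 0≤u n))) (lem x h E E′))
    (expSum-tangent 0≤u 0≤x n)
    where
    0≤u = +-0≤ 0≤x 0≤h
    E = expSum (x + h) n
    E′ = expSum (x + h) (suc n)
    lem : ∀ x h E E′ → (1ℚ - h) * E′ + h * (E′ - E) ≡ E′ + (x - (x + h)) * E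
    lem = solve-∀ ring

  -- m steps of `expSum-step-≤` lead down to 0. This is exp x ≤ (1 - h) ^ (-m) without division.
  expSum-upper : ∀ {h} → 0ℚ ≤ h → h ≤ 1ℚ → ∀ m {x} → 0ℚ ≤ x → x ≤ fromℕℚ m * h →
                 ∀ n → (1ℚ - h) ^ m * expSum x n ≤ 1ℚ
  expSum-upper {h} 0≤h h≤1 m {x} 0≤x x≤mh n = ℚ.≤-trans
    (*-monoˡ (^-0≤ 0≤1-h m) (expSum-mono 0≤x x≤mh n)) (go m)
    where
    0≤1-h = p≤q⇒0≤q-p h≤1
    expSum-zero : ∀ n → expSum 0ℚ n ≤ 1ℚ
    expSum-zero zero          = 0≤1
    expSum-zero (suc zero)    = ℚ.≤-refl
    expSum-zero (suc (suc n)) = ℚ.≤-trans (ℚ.≤-reflexive (lem (expSum 0ℚ (suc n)) (expTerm 0ℚ n) (1/suc n)))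
                                          (expSum-zero (suc n))
      where
      lem : ∀ E T c → E + T * (0ℚ * c) ≡ E
      lem = solve-∀ ring
    go : ∀ m → (1ℚ - h) ^ m * expSum (fromℕℚ m * h) n ≤ 1ℚ
    go zero = subst (_≤ 1ℚ) (sym (trans (ℚ.*-identityˡ _) (cong (λ x → expSum x n) (ℚ.*-zeroˡ h)))) (expSum-zero n)
    go (suc m) = begin
      r * r ^ m * expSum (fromℕℚ (suc m) * h) n  ≡⟨ cong (λ t → r * r ^ m * expSum t n) eq ⟩
      r * r ^ m * expSum (fromℕℚ m * h + h) n    ≡⟨ lem r (r ^ m) _ ⟩
      r ^ m * (r * expSum (fromℕℚ m * h + h) n)  ≤⟨ *-monoˡ (^-0≤ 0≤1-h m) (expSum-step-≤ (*-0≤ (fromℕℚ-nonNeg m) 0≤h) 0≤h n) ⟩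
      r ^ m * expSum (fromℕℚ m * h) n            ≤⟨ go m ⟩
      1ℚ                                         ∎
      where
      open ℚ.≤-Reasoning
      r = 1ℚ - h
      lem₁ : ∀ m h → (m + 1ℚ) * h ≡ m * h + h
      lem₁ = solve-∀ ring
      eq : fromℕℚ (suc m) * h ≡ fromℕℚ m * h + h
      eq = trans (cong (_* h) (fromℕℚ-suc m)) (lem₁ (fromℕℚ m) h)
      lem : ∀ r p e → r * p * e ≡ p * (r * e)
      lem = solve-∀ ring

  -- The tangent at x, evaluated at x + h. Its slope has one term fewer than the sum, hence the
  -- shift of the index.
  expSum-step-≥ : ∀ {x h} → 0ℚ ≤ x → 0ℚ ≤ h → ∀ n → (1ℚ + h) * expSum x n ≤ expSum (x + h) (suc n)
  expSum-step-≥ {x} {h} 0≤x 0≤h n = ℚ.≤-trans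
    (≤-by-slack (expTerm x n) (expTerm-0≤ 0≤x n) (lem x h (expSum x n) (expTerm x n)))
    (expSum-tangent 0≤x (+-0≤ 0≤x 0≤h) n)
    where
    lem : ∀ x h E T → (1ℚ + h) * E + T ≡ E + T + (x + h - x) * E
    lem = solve-∀ ring

  -- Descending from 0 to -t in steps η multiplies the sum by 1 - η each time, up
  -- to the tail term and the second-order error.
  ∣expSum-neg∣≤ : ∀ {t η} → 0ℚ ≤ η → η ≤ 1ℚ → ∀ n m → fromℕℚ m * η ≤ t →
    ∣ expSum (- (fromℕℚ m * η)) (suc (suc n)) ∣ ≤ 1ℚ + fromℕℚ m * η * (expTerm t (suc n) + η * expSum t n)
  ∣expSum-neg∣≤ {t} {η} 0≤η η≤1 n zero 0≤t = ℚ.≤-reflexive (trans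
    (cong (λ x → ∣ expSum x (suc (suc n)) ∣) (lem₀ η)) (trans (cong ∣_∣ (expSum-zero n)) (lem₁ η (expTerm t (suc n) + η * expSum t n))))
    where
    lem₀ : ∀ η → - (0ℚ * η) ≡ 0ℚ
    lem₀ = solve-∀ ring
    lem₁ : ∀ η x → 1ℚ ≡ 1ℚ + 0ℚ * η * x
    lem₁ = solve-∀ ring
    lem : ∀ E T c → E + T * (0ℚ * c) ≡ E
    lem = solve-∀ ring
    expSum-zero : ∀ n → expSum 0ℚ (suc (suc n)) ≡ 1ℚ
    expSum-zero zero    = refl
    expSum-zero (suc n) = trans (lem (expSum 0ℚ (suc (suc n))) (expTerm 0ℚ (suc n)) (1/suc (suc n))) (expSum-zero n)
  ∣expSum-neg∣≤ {t} {η} 0≤η η≤1 n (suc m) [m+1]η≤t = begin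
    ∣ expSum u (suc (suc n)) ∣
      ≡⟨ cong ∣_∣ (∑-tangentGap x u (suc n)) ⟩
    ∣ E + (u - x) * E₀ + S ∣
      ≡⟨ cong ∣_∣ (trans (cong (λ h → E + h * E₀ + S) u-x≡-η) (lem₁ E₀ T′ S η)) ⟩
    ∣ (1ℚ - η) * E + (η * T′ + S) ∣
      ≤⟨ ℚ.≤-trans (ℚ.∣p+q∣≤∣p∣+∣q∣ ((1ℚ - η) * E) (η * T′ + S))
           (ℚ.+-monoʳ-≤ ∣ (1ℚ - η) * E ∣ (ℚ.∣p+q∣≤∣p∣+∣q∣ (η * T′) S)) ⟩
    ∣ (1ℚ - η) * E ∣ + (∣ η * T′ ∣ + ∣ S ∣)
      ≤⟨ ℚ.+-mono-≤ shrinks (ℚ.+-mono-≤ tail second) ⟩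
    ∣ E ∣ + (η * T + η * η * F)
      ≤⟨ ℚ.+-monoˡ-≤ (η * T + η * η * F) (∣expSum-neg∣≤ 0≤η η≤1 n m mη≤t) ⟩
    1ℚ + fromℕℚ m * η * (T + η * F) + (η * T + η * η * F)
      ≡⟨ lem₂ (fromℕℚ m) η T F ⟩
    1ℚ + (fromℕℚ m + 1ℚ) * η * (T + η * F)
      ≡⟨ cong (λ k → 1ℚ + k * η * (T + η * F)) (fromℕℚ-suc m) ⟨
    1ℚ + fromℕℚ (suc m) * η * (T + η * F) ∎
    where
    open ℚ.≤-Reasoning
    x = - (fromℕℚ m * η)
    u = - (fromℕℚ (suc m) * η)
    E₀ = expSum x (suc n)
    E = expSum x (suc (suc n))
    T′ = expTerm x (suc n)
    S = ∑ (tangentGap x u) (suc n)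
    T = expTerm t (suc n)
    F = expSum t n
    lem₁ : ∀ E₀ T S η → E₀ + T + (- η) * E₀ + S ≡ (1ℚ - η) * (E₀ + T) + (η * T + S)
    lem₁ = solve-∀ ring
    lem₂ : ∀ m η T F → 1ℚ + m * η * (T + η * F) + (η * T + η * η * F) ≡ 1ℚ + (m + 1ℚ) * η * (T + η * F)
    lem₂ = solve-∀ ring
    u-x≡-η : u - x ≡ - η
    u-x≡-η = trans (cong (λ k → - (k * η) - x) (fromℕℚ-suc m)) (lem (fromℕℚ m) η)
      where
      lem : ∀ m η → - ((m + 1ℚ) * η) - - (m * η) ≡ - η
      lem = solve-∀ ring
    ∣-mη∣ : ∀ m → ∣ - (fromℕℚ m * η) ∣ ≡ fromℕℚ m * η
    ∣-mη∣ m = trans (ℚ.∣-p∣≡∣p∣ (fromℕℚ m * η)) (ℚ.0≤p⇒∣p∣≡p (*-0≤ (fromℕℚ-nonNeg m) 0≤η))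
    mη≤t : fromℕℚ m * η ≤ t
    mη≤t = ℚ.≤-trans (*-monoʳ 0≤η (fromℕℚ-mono (ℕ.n≤1+n m))) [m+1]η≤t
    ∣x∣≤t : ∣ x ∣ ≤ t
    ∣x∣≤t = ℚ.≤-trans (ℚ.≤-reflexive (∣-mη∣ m)) mη≤t
    ∣u∣≤t : ∣ u ∣ ≤ t
    ∣u∣≤t = ℚ.≤-trans (ℚ.≤-reflexive (∣-mη∣ (suc m))) [m+1]η≤t
    0≤t = ℚ.≤-trans (ℚ.0≤∣p∣ x) ∣x∣≤t
    shrinks : ∣ (1ℚ - η) * E ∣ ≤ ∣ E ∣
    shrinks = begin
      ∣ (1ℚ - η) * E ∣         ≡⟨ ℚ.∣p*q∣≡∣p∣*∣q∣ (1ℚ - η) E ⟩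
      ∣ 1ℚ - η ∣ * ∣ E ∣       ≡⟨ cong (_* ∣ E ∣) (ℚ.0≤p⇒∣p∣≡p (p≤q⇒0≤q-p η≤1)) ⟩
      (1ℚ - η) * ∣ E ∣         ≤⟨ ≤-by-slack (η * ∣ E ∣) (*-0≤ 0≤η (ℚ.0≤∣p∣ E)) (lem η ∣ E ∣) ⟩
      ∣ E ∣                    ∎
      where
      lem : ∀ η E → (1ℚ - η) * E + η * E ≡ E
      lem = solve-∀ ring
    tail : ∣ η * T′ ∣ ≤ η * T
    tail = begin
      ∣ η * T′ ∣        ≡⟨ ℚ.∣p*q∣≡∣p∣*∣q∣ η T′ ⟩
      ∣ η ∣ * ∣ T′ ∣    ≡⟨ cong (_* ∣ T′ ∣) (ℚ.0≤p⇒∣p∣≡p 0≤η) ⟩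
      η * ∣ T′ ∣        ≤⟨ *-monoˡ 0≤η (ExpEstimates.expTerm-bound t 0≤t (suc n) ∣x∣≤t) ⟩
      η * T             ∎
    second : ∣ S ∣ ≤ η * η * F
    second = ℚ.≤-trans (∣∑tangentGap∣≤ ∣x∣≤t ∣u∣≤t n)
      (ℚ.≤-reflexive (trans (cong (λ h → h * h * F) u-x≡-η) (cong (_* F) (lem η))))
      where
      lem : ∀ η → - η * - η ≡ η * η
      lem = solve-∀ ring

  module GrowthFactor {h} (0≤h : 0ℚ ≤ h) where
    -- `φ` is a lower estimate of exp w, obtained from two steps of length h and one of length v.
    -- Here w = (2 + 4 h) h is the effect of the exponent 2 + 4 h on one step h. The step v is the
    -- surplus: it makes `φ` exceed (1 - h) ^ (-2), which the two steps h alone do not reach.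
    s v φ w : ℚ
    s = h * h
    v = s + s + (s + s)
    φ = (1ℚ + v) * ((1ℚ + h) * (1ℚ + h))
    w = h + h + v

    0≤v : 0ℚ ≤ v
    0≤v = +-0≤ (+-0≤ (square-0≤ h) (square-0≤ h)) (+-0≤ (square-0≤ h) (square-0≤ h))

    0≤w : 0ℚ ≤ w
    0≤w = +-0≤ (+-0≤ 0≤h 0≤h) 0≤v

    0≤1+v : 0ℚ ≤ 1ℚ + v
    0≤1+v = +-0≤ 0≤1 0≤v

    0≤1+h : 0ℚ ≤ 1ℚ + h
    0≤1+h = +-0≤ 0≤1 0≤h

    0≤φ : 0ℚ ≤ φ
    0≤φ = *-0≤ 0≤1+v (*-0≤ 0≤1+h 0≤1+h)

    -- Each factor `φ` takes three steps, and each step raises the number of terms by one; the start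
    -- is the single term 1.
    expSum-lower : ∀ k → φ ^ k ≤ expSum (fromℕℚ k * w) (suc (k ℕ.* 3))
    expSum-lower zero = ℚ.≤-refl
    expSum-lower (suc k) = begin
      φ * φ ^ k
        ≤⟨ *-monoˡ 0≤φ (expSum-lower k) ⟩
      φ * expSum x n
        ≡⟨ lem₁ (1ℚ + v) (1ℚ + h) (expSum x n) ⟩
      (1ℚ + v) * ((1ℚ + h) * ((1ℚ + h) * expSum x n))
        ≤⟨ *-monoˡ 0≤1+v (*-monoˡ 0≤1+h (expSum-step-≥ 0≤x 0≤h n)) ⟩
      (1ℚ + v) * ((1ℚ + h) * expSum (x + h) (suc n))
        ≤⟨ *-monoˡ 0≤1+v (expSum-step-≥ (+-0≤ 0≤x 0≤h) 0≤h (suc n)) ⟩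
      (1ℚ + v) * expSum (x + h + h) (suc (suc n))
        ≤⟨ expSum-step-≥ (+-0≤ (+-0≤ 0≤x 0≤h) 0≤h) 0≤v (suc (suc n)) ⟩
      expSum (x + h + h + v) (suc (suc (suc n)))
        ≡⟨ cong (λ y → expSum y (suc (suc (suc n)))) eq ⟩
      expSum (fromℕℚ (suc k) * w) (suc (suc (suc n))) ∎
      where
      open ℚ.≤-Reasoning
      x = fromℕℚ k * w
      n = suc (k ℕ.* 3)
      0≤x : 0ℚ ≤ x
      0≤x = *-0≤ (fromℕℚ-nonNeg k) 0≤w
      lem₁ : ∀ a b e → a * (b * b) * e ≡ a * (b * (b * e))
      lem₁ = solve-∀ ring
      lem₂ : ∀ k h v → k * (h + h + v) + h + h + v ≡ (k + 1ℚ) * (h + h + v)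
      lem₂ = solve-∀ ring
      eq : x + h + h + v ≡ fromℕℚ (suc k) * w
      eq = trans (lem₂ (fromℕℚ k) h v) (cong (_* w) (sym (fromℕℚ-suc k)))

    -- φ (1 - h)² = (1 + 4s)(1 - s)², and (1 + 4s)(1 - s)² - (1 + s) = s (1 - 7s + 4s²).
    φ-gain : s + s + (s + s) + (s + s + (s + s)) ≤ 1ℚ → 1ℚ + s ≤ φ * ((1ℚ - h) * (1ℚ - h))
    φ-gain 8s≤1 = ≤-by-slack (s * (1ℚ - (s + s + (s + s) + (s + s + (s + s))) + s + (s + s) * (s + s)))
      (*-0≤ (square-0≤ h) (+-0≤ (+-0≤ (p≤q⇒0≤q-p 8s≤1) (square-0≤ h)) (square-0≤ (s + s))))
      (lem h)
      where
      lem : ∀ h → 1ℚ + h * h + h * h * (1ℚ - (h * h + h * h + (h * h + h * h) + (h * h + h * h + (h * h + h * h))) + h * h + (h * h + h * h) * (h * h + h * h)) ≡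
            (1ℚ + (h * h + h * h + (h * h + h * h))) * ((1ℚ + h) * (1ℚ + h)) * ((1ℚ - h) * (1ℚ - h))
      lem = solve-∀ ring

  -- Natural numbers and powers in ℚ

  fromℕℚ-+ : ∀ m n → fromℕℚ (m ℕ.+ n) ≡ fromℕℚ m + fromℕℚ n
  fromℕℚ-+ zero    n = sym (ℚ.+-identityˡ (fromℕℚ n))
  fromℕℚ-+ (suc m) n = begin
    fromℕℚ (suc (m ℕ.+ n))        ≡⟨ fromℕℚ-suc (m ℕ.+ n) ⟩
    fromℕℚ (m ℕ.+ n) + 1ℚ         ≡⟨ cong (_+ 1ℚ) (fromℕℚ-+ m n) ⟩
    fromℕℚ m + fromℕℚ n + 1ℚ      ≡⟨ lem (fromℕℚ m) (fromℕℚ n) ⟩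
    fromℕℚ m + 1ℚ + fromℕℚ n      ≡⟨ cong (_+ fromℕℚ n) (fromℕℚ-suc m) ⟨
    fromℕℚ (suc m) + fromℕℚ n     ∎
    where
    open ≡-Reasoning
    lem : ∀ x y → x + y + 1ℚ ≡ x + 1ℚ + y
    lem = solve-∀ ring

  fromℕℚ-* : ∀ m n → fromℕℚ (m ℕ.* n) ≡ fromℕℚ m * fromℕℚ n
  fromℕℚ-* zero    n = sym (ℚ.*-zeroˡ (fromℕℚ n))
  fromℕℚ-* (suc m) n = begin
    fromℕℚ (n ℕ.+ m ℕ.* n)            ≡⟨ fromℕℚ-+ n (m ℕ.* n) ⟩
    fromℕℚ n + fromℕℚ (m ℕ.* n)       ≡⟨ cong (fromℕℚ n +_) (fromℕℚ-* m n) ⟩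
    fromℕℚ n + fromℕℚ m * fromℕℚ n    ≡⟨ lem (fromℕℚ m) (fromℕℚ n) ⟩
    (fromℕℚ m + 1ℚ) * fromℕℚ n        ≡⟨ cong (_* fromℕℚ n) (fromℕℚ-suc m) ⟨
    fromℕℚ (suc m) * fromℕℚ n         ∎
    where
    open ≡-Reasoning
    lem : ∀ x y → y + x * y ≡ (x + 1ℚ) * y
    lem = solve-∀ ring

  2^*½^ : ∀ m → fromℕℚ (2 ℕ.^ m) * ½ ^ m ≡ 1ℚ
  2^*½^ zero    = refl
  2^*½^ (suc m) = begin
    fromℕℚ (2 ℕ.* 2 ℕ.^ m) * (½ * ½ ^ m)          ≡⟨ cong (_* (½ * ½ ^ m)) (fromℕℚ-* 2 (2 ℕ.^ m)) ⟩
    fromℕℚ 2 * fromℕℚ (2 ℕ.^ m) * (½ * ½ ^ m)     ≡⟨ lem (fromℕℚ (2 ℕ.^ m)) (½ ^ m) ⟩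
    fromℕℚ (2 ℕ.^ m) * ½ ^ m                       ≡⟨ 2^*½^ m ⟩
    1ℚ                                             ∎
    where
    open ≡-Reasoning
    lem : ∀ x y → (1ℚ + 1ℚ) * x * (½ * y) ≡ x * y
    lem = solve-∀ ring

  <⇒≱ : ∀ {p q} → p < q → ¬ (q ≤ p)
  <⇒≱ p<q q≤p = ℚ.<-irrefl refl (ℚ.<-≤-trans p<q q≤p)

  ^-0< : ∀ {q} → 0ℚ < q → ∀ n → 0ℚ < q ^ n
  ^-0< 0<q zero    = ℚ.positive⁻¹ 1ℚ
  ^-0< 0<q (suc n) = *-0< 0<q (^-0< 0<q n)

  ^-mono-≤ : ∀ {p q} → 0ℚ ≤ p → p ≤ q → ∀ n → p ^ n ≤ q ^ n
  ^-mono-≤ 0≤p p≤q zero    = ℚ.≤-refl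
  ^-mono-≤ 0≤p p≤q (suc n) = *-mono 0≤p (^-0≤ (ℚ.≤-trans 0≤p p≤q) n) p≤q (^-mono-≤ 0≤p p≤q n)

  bernoulli : ∀ {s} → 0ℚ ≤ s → ∀ n → 1ℚ + fromℕℚ n * s ≤ (1ℚ + s) ^ n
  bernoulli {s} 0≤s zero    = ℚ.≤-reflexive (lem s)
    where
    lem : ∀ s → 1ℚ + 0ℚ * s ≡ 1ℚ
    lem = solve-∀ ring
  bernoulli {s} 0≤s (suc n) = begin
    1ℚ + fromℕℚ (suc n) * s               ≡⟨ cong (λ t → 1ℚ + t * s) (fromℕℚ-suc n) ⟩
    1ℚ + (fromℕℚ n + 1ℚ) * s              ≤⟨ ≤-by-slack (fromℕℚ n * (s * s))
                                               (*-0≤ (fromℕℚ-nonNeg n) (square-0≤ s)) (lem (fromℕℚ n) s) ⟩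
    (1ℚ + s) * (1ℚ + fromℕℚ n * s)        ≤⟨ *-monoˡ (+-0≤ 0≤1 0≤s) (bernoulli 0≤s n) ⟩
    (1ℚ + s) * (1ℚ + s) ^ n               ∎
    where
    open ℚ.≤-Reasoning
    lem : ∀ n s → 1ℚ + (n + 1ℚ) * s + n * (s * s) ≡ (1ℚ + s) * (1ℚ + n * s)
    lem = solve-∀ ring

  bernoulli⁻ : ∀ {h} → 0ℚ ≤ h → h ≤ 1ℚ → ∀ n → (1ℚ + fromℕℚ n * h) * (1ℚ - h) ^ n ≤ 1ℚ
  bernoulli⁻ {h} 0≤h h≤1 zero    = ℚ.≤-reflexive (lem h)
    where
    lem : ∀ h → (1ℚ + 0ℚ * h) * 1ℚ ≡ 1ℚ
    lem = solve-∀ ring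
  bernoulli⁻ {h} 0≤h h≤1 (suc n) = begin
    (1ℚ + fromℕℚ (suc n) * h) * (ρ * ρ ^ n)   ≡⟨ cong (λ t → (1ℚ + t * h) * (ρ * ρ ^ n)) (fromℕℚ-suc n) ⟩
    (1ℚ + (fromℕℚ n + 1ℚ) * h) * (ρ * ρ ^ n)  ≤⟨ ≤-by-slack ((fromℕℚ n + 1ℚ) * (h * h) * ρ ^ n)
                                                  (*-0≤ (*-0≤ (+-0≤ (fromℕℚ-nonNeg n) 0≤1) (square-0≤ h))
                                                        (^-0≤ (p≤q⇒0≤q-p h≤1) n)) (lem (fromℕℚ n) h (ρ ^ n)) ⟩
    (1ℚ + fromℕℚ n * h) * ρ ^ n               ≤⟨ bernoulli⁻ 0≤h h≤1 n ⟩
    1ℚ                                        ∎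
    where
    open ℚ.≤-Reasoning
    ρ = 1ℚ - h
    lem : ∀ n h r → (1ℚ + (n + 1ℚ) * h) * ((1ℚ - h) * r) + (n + 1ℚ) * (h * h) * r ≡ (1ℚ + n * h) * r
    lem = solve-∀ ring

  last-above-1 : ∀ (f : ℕ → ℚ) k₀ i → 1ℚ < f k₀ → f (i ℕ.+ k₀) ≤ 1ℚ →
                 ∃ λ k → k₀ ℕ.≤ k × 1ℚ < f k × f (suc k) ≤ 1ℚ
  last-above-1 f k₀ zero    above below = ⊥-elim (<⇒≱ above below)
  last-above-1 f k₀ (suc i) above below with f (i ℕ.+ k₀) ℚ.≤? 1ℚ
  ... | yes f≤1 = last-above-1 f k₀ i above f≤1
  ... | no  f≰1 = i ℕ.+ k₀ , ℕ.m≤n+m k₀ i , ℚ.≰⇒> f≰1 , below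

  -- Inequalities between approximations at large indices

  Eventually : (ℕ → Set) → Set
  Eventually P = ∃ λ N → ∀ {n} → N ℕ.≤ n → P n

  infixr 4 _∧_
  _∧_ : ∀ {P Q : ℕ → Set} → Eventually P → Eventually Q → Eventually (λ n → P n × Q n)
  (M , p) ∧ (N , q) = M ℕ.⊔ N , λ ≤n → p (ℕ.m⊔n≤o⇒m≤o M N ≤n) , q (ℕ.m⊔n≤o⇒n≤o M N ≤n)

  after : ∀ N → Eventually (N ℕ.≤_)
  after N = N , λ N≤n → N≤n

  mapᵉ : ∀ {P Q : ℕ → Set} → (∀ {n} → P n → Q n) → Eventually P → Eventually Q
  mapᵉ f (N , p) = N , λ N≤n → f (p N≤n)

  sample : ∀ {P : ℕ → Set} → Eventually P → ∃ P
  sample (N , p) = N , p ℕ.≤-refl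

  <⇒≤-ℝ : ∀ x y → x Real.< y → x Real.≤ y
  <⇒≤-ℝ x y (e , 0<e , N , lt) {ε} 0<ε = N , λ {n} N≤n → ℚ.≤-trans
    (≤-by-slack e (ℚ.<⇒≤ 0<e) refl) (ℚ.≤-trans (lt N≤n) (≤-by-slack ε (ℚ.<⇒≤ 0<ε) refl))

  ≤-trans-ℝ : ∀ x y z → x Real.≤ y → y Real.≤ z → x Real.≤ z
  ≤-trans-ℝ x y z x≤y y≤z {ε} 0<ε = mapᵉ
    (λ {n} (p , q) → ℚ.≤-trans p (ℚ.≤-trans (ℚ.+-monoˡ-≤ (½ * ε) q)
      (ℚ.≤-reflexive (trans (ℚ.+-assoc (seq z n) (½ * ε) (½ * ε)) (cong (seq z n +_) (½-split ε))))))
    (x≤y (½-pos 0<ε) ∧ y≤z (½-pos 0<ε))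

  eventually⇒≤ : ∀ x y → Eventually (λ n → seq x n ≤ seq y n) → x Real.≤ y
  eventually⇒≤ x y x≤y {ε} 0<ε = mapᵉ (λ p → ℚ.≤-trans p (≤-by-slack ε (ℚ.<⇒≤ 0<ε) refl)) x≤y

  -- Lower bounds for log N and its powers

  p≤∣p∣ : ∀ p → p ≤ ∣ p ∣
  p≤∣p∣ p with ℚ.≤-total 0ℚ p
  ... | inj₁ 0≤p = ℚ.≤-reflexive (sym (ℚ.0≤p⇒∣p∣≡p 0≤p))
  ... | inj₂ p≤0 = ℚ.≤-trans p≤0 (ℚ.0≤∣p∣ p)

  -- `expSum-upper` with h = ½: every half unit of the argument at most doubles the sum.
  expSum-≤2^ : ∀ m {q} → ∣ q ∣ ≤ fromℕℚ m * ½ → ∀ n → expSum q n ≤ fromℕℚ (2 ℕ.^ m)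
  expSum-≤2^ m {q} q≤½m n = begin
    expSum q n                                   ≤⟨ ℚ.≤-trans (p≤∣p∣ (expSum q n)) (∣expSum∣≤ q n) ⟩
    E                                            ≡⟨ ℚ.*-identityˡ E ⟨
    1ℚ * E                                       ≡⟨ cong (_* E) (2^*½^ m) ⟨
    fromℕℚ (2 ℕ.^ m) * ½ ^ m * E                 ≡⟨ ℚ.*-assoc (fromℕℚ (2 ℕ.^ m)) (½ ^ m) E ⟩
    fromℕℚ (2 ℕ.^ m) * (½ ^ m * E)               ≤⟨ *-monoˡ (fromℕℚ-nonNeg (2 ℕ.^ m))
                                                     (expSum-upper (ℚ.nonNegative⁻¹ ½) ½≤1 m (ℚ.0≤∣p∣ q) q≤½m n) ⟩
    fromℕℚ (2 ℕ.^ m) * 1ℚ                        ≡⟨ ℚ.*-identityʳ _ ⟩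
    fromℕℚ (2 ℕ.^ m)                             ∎
    where
    open ℚ.≤-Reasoning
    E = expSum ∣ q ∣ n
    ½≤1 : ½ ≤ 1ℚ
    ½≤1 = ≤-by-slack ½ (ℚ.nonNegative⁻¹ ½) refl

  ∣∣-≤ : ∀ {p q} → p ≤ q → - p ≤ q → ∣ p ∣ ≤ q
  ∣∣-≤ {p} {q} p≤q -p≤q with ℚ.∣p∣≡p∨∣p∣≡-p p
  ... | inj₁ eq = subst (_≤ q) (sym eq) p≤q
  ... | inj₂ eq = subst (_≤ q) (sym eq) -p≤q

  -- If `seq ℓ n` were at most (m + 1)/2, `expSum-≤2^` would give N ≤ 2 ^ (m + 1) + ½ < 2 ^ (m + 2).
  -- The sign of ℓ enters as `seq ℓ n ≥ -½`, which bounds the absolute value from the other side.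
  log-lower : ∀ m N ℓ → 2 ℕ.^ suc (suc m) ℕ.≤ N → fromℕ N Real.≤ exp ℓ → 0ℝ Real.≤ ℓ →
              Eventually λ n → fromℕℚ (suc m) * ½ < seq ℓ n
  log-lower m N ℓ 2^≤N N≤expℓ 0≤ℓ = mapᵉ
    (λ {n} (N≤ , 0≤) → ℚ.≰⇒> λ ℓ≤ → <⇒≱ (strict {n}) (ℚ.≤-trans (fromℕℚ-mono 2^≤N)
      (ℚ.≤-trans N≤ (ℚ.+-monoˡ-≤ ½ (expSum-≤2^ (suc m) (∣∣-≤ ℓ≤ (-ℓ≤ 0≤)) n)))))
    (N≤expℓ (ℚ.positive⁻¹ ½) ∧ 0≤ℓ (ℚ.positive⁻¹ ½))
    where
    -ℓ≤ : ∀ {p} → 0ℚ ≤ p + ½ → - p ≤ fromℕℚ (suc m) * ½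
    -ℓ≤ {p} 0≤p+½ = ℚ.≤-trans (≤-by-slack (p + ½) 0≤p+½ (lem p))
      (*-monoʳ (ℚ.nonNegative⁻¹ ½) (1≤fromℕℚ-suc m))
      where
      lem : ∀ p → - p + (p + ½) ≡ 1ℚ * ½
      lem = solve-∀ ring
    strict : ∀ {n : ℕ} → fromℕℚ (2 ℕ.^ suc m) + ½ < fromℕℚ (2 ℕ.^ suc (suc m))
    strict = begin-strict
      M + ½                   <⟨ ℚ.+-monoʳ-< M (ℚ.<-≤-trans ½<1 (fromℕℚ-mono (ℕ.m^n>0 2 (suc m)))) ⟩
      M + M                   ≡⟨ lem M ⟩
      (1ℚ + 1ℚ) * M           ≡⟨ fromℕℚ-* 2 (2 ℕ.^ suc m) ⟨
      fromℕℚ (2 ℕ.* 2 ℕ.^ suc m) ∎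
      where
      open ℚ.≤-Reasoning
      M = fromℕℚ (2 ℕ.^ suc m)
      ½<1 : ½ < 1ℚ
      ½<1 = toWitness {a? = ½ ℚ.<? 1ℚ} _
      lem : ∀ M → M + M ≡ (1ℚ + 1ℚ) * M
      lem = solve-∀ ring

  expTerm-vanishes : ∀ {B δ} → 0ℚ ≤ B → 0ℚ < δ → Eventually λ n → expTerm B n ≤ δ
  expTerm-vanishes {B} {δ} 0≤B 0<δ = let N , close = cauchy (exp (fromℚ B)) 0<δ in
    N , λ {n} N≤n → begin
      expTerm B n                              ≡⟨ ℚ.0≤p⇒∣p∣≡p (expTerm-0≤ 0≤B n) ⟨
      ∣ expTerm B n ∣                          ≡⟨ cong ∣_∣ (lem (expSum B n) (expTerm B n)) ⟩
      ∣ expSum B (suc n) - expSum B n ∣        ≤⟨ close (ℕ.m≤n⇒m≤1+n N≤n) N≤n ⟩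
      δ                                        ∎
    where
    open ℚ.≤-Reasoning
    lem : ∀ E T → T ≡ E + T - E
    lem = solve-∀ ring

  expSum-neg-≤2 : ∀ {t n} → 0ℚ ≤ t → t * expTerm t (suc n) ≤ ½ → ∣ expSum (- t) (suc (suc n)) ∣ ≤ 1ℚ + 1ℚ
  expSum-neg-≤2 {t} {n} 0≤t small = begin
    ∣ expSum (- t) (suc (suc n)) ∣               ≡⟨ cong (λ x → ∣ expSum (- x) (suc (suc n)) ∣) jη≡t ⟨
    ∣ expSum (- (J * η)) (suc (suc n)) ∣         ≤⟨ ∣expSum-neg∣≤ 0≤η η≤1 n (suc j) (ℚ.≤-reflexive jη≡t) ⟩
    1ℚ + J * η * (T + η * F)                     ≡⟨ cong (λ x → 1ℚ + x * (T + η * F)) jη≡t ⟩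
    1ℚ + t * (T + η * F)                         ≡⟨ lem t T c F ⟩
    1ℚ + (t * T + t * t * F * c)                 ≤⟨ ℚ.+-monoʳ-≤ 1ℚ (ℚ.+-mono-≤ small second) ⟩
    1ℚ + 1ℚ                                      ∎
    where
    open ℚ.≤-Reasoning
    T = expTerm t (suc n)
    F = expSum t n
    0≤F = expSum-0≤ 0≤t n
    v = t * t * F
    0≤v : 0ℚ ≤ v
    0≤v = *-0≤ (*-0≤ 0≤t 0≤t) 0≤F
    -- The number of steps is at least t + 2 v: the summand t gives η ≤ 1, the summand 2 v makes the
    -- second-order error at most ½.
    arch = archimedeanᵃ (t + (v + v))
    j = proj₁ arch
    J = fromℕℚ (suc j)
    c = 1/suc j
    0≤c = 0≤1/suc j
    η = t * c
    0≤η : 0ℚ ≤ η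
    0≤η = *-0≤ 0≤t 0≤c
    large : t + (v + v) ≤ J
    large = ℚ.≤-trans (proj₂ arch) (fromℕℚ-mono (ℕ.n≤1+n j))
    jη≡t : J * η ≡ t
    jη≡t = trans (lem₁ J t c) (trans (cong (t *_) (1/suc-inverse j)) (ℚ.*-identityʳ t))
      where
      lem₁ : ∀ J t c → J * (t * c) ≡ t * (J * c)
      lem₁ = solve-∀ ring
    η≤1 : η ≤ 1ℚ
    η≤1 = subst (η ≤_) (1/suc-inverse j)
      (*-monoʳ {c} {t} {J} 0≤c (ℚ.≤-trans (≤-by-slack {t} (v + v) (+-0≤ 0≤v 0≤v) refl) large))
    second : t * t * F * c ≤ ½
    second = begin
      v * c              ≡⟨ lem₂ v c ⟩
      ½ * ((v + v) * c)  ≤⟨ *-monoˡ (ℚ.nonNegative⁻¹ ½) (*-monoʳ {c} {v + v} {J} 0≤c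
                              (ℚ.≤-trans (≤-by-slack {v + v} t 0≤t (ℚ.+-comm (v + v) t)) large)) ⟩
      ½ * (J * c)        ≡⟨ cong (½ *_) (1/suc-inverse j) ⟩
      ½                  ∎
      where
      lem₂ : ∀ v c → v * c ≡ ½ * ((v + v) * c)
      lem₂ = solve-∀ ring
    lem : ∀ t T c F → 1ℚ + t * (T + t * c * F) ≡ 1ℚ + (t * T + t * t * F * c)
    lem = solve-∀ ring

  -- Contrapositively, a partial sum above 2 certifies a positive argument. This is needed for log
  -- log N, about whose sign `IsPower` says nothing; monotonicity of the partial sums is available
  -- only on nonnegative arguments.
  exp-neg-≤2 : ∀ x → Eventually λ n → seq x n ≤ 0ℚ → expSum (seq x n) n ≤ 1ℚ + 1ℚ
  exp-neg-≤2 x =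
    let B , 0≤B , N , bd   = bounded {seq x} (cauchy x)
        δ , 0<δ , Bδ≤½     = shrinkᵃ B (ℚ.positive⁻¹ ½)
        M , vanish         = expTerm-vanishes 0≤B 0<δ
    in mapᵉ
      (λ { {zero} (_ , _ , ()) ; {suc zero} (_ , _ , ℕ.s≤s ())
         ; {suc (suc n)} (∣x∣≤B , M≤n , _) x≤0 →
           let t = - seq x (suc (suc n))
               0≤t : 0ℚ ≤ t
               0≤t = ℚ.neg-antimono-≤ x≤0
               t≤B : t ≤ B
               t≤B = ℚ.≤-trans (ℚ.≤-reflexive (trans (sym (ℚ.0≤p⇒∣p∣≡p 0≤t)) (ℚ.∣-p∣≡∣p∣ (seq x (suc (suc n)))))) ∣x∣≤B
               T≤ : expTerm t (suc n) ≤ expTerm B (suc n)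
               T≤ = ℚ.≤-trans (ℚ.≤-reflexive (sym (ℚ.0≤p⇒∣p∣≡p (expTerm-0≤ 0≤t (suc n)))))
                      (ExpEstimates.expTerm-bound B 0≤B (suc n) (ℚ.≤-trans (ℚ.≤-reflexive (ℚ.0≤p⇒∣p∣≡p 0≤t)) t≤B))
               small : t * expTerm t (suc n) ≤ ½
               small = ℚ.≤-trans (*-mono 0≤t (ℚ.<⇒≤ 0<δ) t≤B (ℚ.≤-trans T≤ (vanish (ℕ.s≤s⁻¹ M≤n)))) Bδ≤½
           in ℚ.≤-trans (p≤∣p∣ (expSum (seq x (suc (suc n))) (suc (suc n))))
                (subst (λ y → ∣ expSum y (suc (suc n)) ∣ ≤ 1ℚ + 1ℚ) (lem (seq x (suc (suc n))))
                  (expSum-neg-≤2 {n = n} 0≤t small)) })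
      ((N , bd) ∧ after (suc M) ∧ after 2)
    where
    lem : ∀ x → - (- x) ≡ x
    lem = solve-∀ ring

  4h : ℚ → ℚ
  4h h = h + h + (h + h)

  module PowerBound {h} (0<h : 0ℚ < h) (4h≤½ : 4h h ≤ ½) (D : ℕ) where
    private
      0≤h = ℚ.<⇒≤ 0<h
      ρ = 1ℚ - h
      open GrowthFactor 0≤h

      h≤1 : h ≤ 1ℚ
      h≤1 = ℚ.≤-trans (≤-by-slack (h + (h + h)) (+-0≤ 0≤h (+-0≤ 0≤h 0≤h)) (lem h))
                      (ℚ.≤-trans 4h≤½ (≤-by-slack ½ (ℚ.nonNegative⁻¹ ½) refl))
        where
        lem : ∀ h → h + (h + (h + h)) ≡ h + h + (h + h)
        lem = solve-∀ ring

      0<ρ : 0ℚ < ρ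
      0<ρ = ℚ.<-≤-trans (ℚ.positive⁻¹ ½) (≤-by-slack (½ - 4h h + (h + h + h))
        (+-0≤ (p≤q⇒0≤q-p 4h≤½) (+-0≤ (+-0≤ 0≤h 0≤h) 0≤h)) (lem h))
        where
        lem : ∀ h → ½ + (½ - (h + h + (h + h)) + (h + h + h)) ≡ 1ℚ - h
        lem = solve-∀ ring

      0≤ρ = ℚ.<⇒≤ 0<ρ

      8s≤1 : s + s + (s + s) + (s + s + (s + s)) ≤ 1ℚ
      8s≤1 = ℚ.≤-trans (≤-by-slack (4h h * 4h h + 4h h * 4h h - (s + s + (s + s) + (s + s + (s + s))))
          (subst (0ℚ ≤_) (lem₁ h) (+-0≤ 0≤12s 0≤12s)) (lem₂ (s + s + (s + s) + (s + s + (s + s))) (4h h * 4h h + 4h h * 4h h)))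
        (ℚ.≤-trans (ℚ.+-mono-≤ sq sq) (≤-by-slack ½ (ℚ.nonNegative⁻¹ ½) refl))
        where
        12s = s + s + (s + s) + (s + s + (s + s)) + (s + s + (s + s))
        0≤s = square-0≤ h
        0≤4s : 0ℚ ≤ s + s + (s + s)
        0≤4s = +-0≤ (+-0≤ 0≤s 0≤s) (+-0≤ 0≤s 0≤s)
        0≤12s : 0ℚ ≤ 12s
        0≤12s = +-0≤ (+-0≤ 0≤4s 0≤4s) 0≤4s
        0≤4h : 0ℚ ≤ 4h h
        0≤4h = +-0≤ (+-0≤ 0≤h 0≤h) (+-0≤ 0≤h 0≤h)
        sq : 4h h * 4h h ≤ ½ * ½
        sq = *-mono 0≤4h (ℚ.nonNegative⁻¹ ½) 4h≤½ 4h≤½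
        lem₁ : ∀ h → (h * h + h * h + (h * h + h * h) + (h * h + h * h + (h * h + h * h)) + (h * h + h * h + (h * h + h * h))) + (h * h + h * h + (h * h + h * h) + (h * h + h * h + (h * h + h * h)) + (h * h + h * h + (h * h + h * h))) ≡ (h + h + (h + h)) * (h + h + (h + h)) + (h + h + (h + h)) * (h + h + (h + h)) - (h * h + h * h + (h * h + h * h) + (h * h + h * h + (h * h + h * h)))
        lem₁ = solve-∀ ring
        lem₂ : ∀ x y → x + (y - x) ≡ y
        lem₂ = solve-∀ ring

      0<s : 0ℚ < s
      0<s = *-0< 0<h 0<h

      16D = fromℕℚ (16 ℕ.* D)
      -- From `k₀` on, Bernoulli's inequality gives ρ² (1 + s) ^ k ≥ 16 D.
      k₀-spec = archimedean-*ᵃ 16D (*-0< (*-0< 0<ρ 0<ρ) 0<s)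
      k₀ = suc (proj₁ k₀-spec)
      m₀-spec = archimedean-*ᵃ (1ℚ + 1ℚ) (^-0< 0<ρ k₀)

    -- The threshold beyond which ρ ^ k₀ X ≥ 2 for X = m / 2.
    m₀ : ℕ
    m₀ = 5 ℕ.+ 2 ℕ.* suc (proj₁ m₀-spec)

    module _ {m} (m₀≤m : m₀ ℕ.≤ m) where
      private
        X = fromℕℚ m * ½

        0≤X : 0ℚ ≤ X
        0≤X = *-0≤ (fromℕℚ-nonNeg m) (ℚ.nonNegative⁻¹ ½)

        above : 1ℚ < ρ ^ k₀ * X
        above = ℚ.<-≤-trans (toWitness {a? = 1ℚ ℚ.<? 1ℚ + 1ℚ} _) (ℚ.≤-trans (proj₂ m₀-spec)
          (*-monoˡ (^-0≤ 0≤ρ k₀) (ℚ.≤-trans (ℚ.≤-reflexive (lem₁ j))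
            (*-monoʳ (ℚ.nonNegative⁻¹ ½) (fromℕℚ-mono (ℕ.≤-trans (ℕ.m≤n+m (2 ℕ.* j) 5) m₀≤m))))))
          where
          j = suc (proj₁ m₀-spec)
          lem₂ : ∀ j → j ≡ (1ℚ + 1ℚ) * j * ½
          lem₂ = solve-∀ ring
          lem₁ : ∀ j → fromℕℚ j ≡ fromℕℚ (2 ℕ.* j) * ½
          lem₁ j = trans (lem₂ (fromℕℚ j)) (cong (_* ½) (sym (fromℕℚ-* 2 j)))

        i-spec = archimedean-*ᵃ X 0<h
        i = suc (proj₁ i-spec)

        below : ρ ^ (i ℕ.+ k₀) * X ≤ 1ℚ
        below = begin
          ρ ^ (i ℕ.+ k₀) * X
            ≤⟨ *-monoˡ (^-0≤ 0≤ρ (i ℕ.+ k₀)) (ℚ.≤-trans (proj₂ i-spec)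
                 (ℚ.≤-trans (*-monoˡ 0≤h (fromℕℚ-mono (ℕ.m≤m+n i k₀)))
                   (≤-by-slack 1ℚ 0≤1 (lem h (fromℕℚ (i ℕ.+ k₀)))))) ⟩
          ρ ^ (i ℕ.+ k₀) * (1ℚ + fromℕℚ (i ℕ.+ k₀) * h)
            ≡⟨ ℚ.*-comm (ρ ^ (i ℕ.+ k₀)) _ ⟩
          (1ℚ + fromℕℚ (i ℕ.+ k₀) * h) * ρ ^ (i ℕ.+ k₀)
            ≤⟨ bernoulli⁻ 0≤h h≤1 (i ℕ.+ k₀) ⟩
          1ℚ ∎
          where
          open ℚ.≤-Reasoning
          lem : ∀ h n → h * n + 1ℚ ≡ 1ℚ + n * h
          lem = solve-∀ ring

        -- `k` is a discrete logarithm of X to the base 1/ρ: it satisfies ρ ^ (-k) < X ≤ ρ ^ (-(k +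
        -- 1)).
        k-spec = last-above-1 (λ k → ρ ^ k * X) k₀ i above below
        k = proj₁ k-spec
        k₀≤k = proj₁ (proj₂ k-spec)
        1<ρᵏX = proj₁ (proj₂ (proj₂ k-spec))
        ρᵏ⁺¹X≤1 = proj₂ (proj₂ (proj₂ k-spec))

      -- φ ^ k ≥ (1 + s) ^ k ρ ^ (- 2 k) ≥ (1 + s) ^ k ρ² X².
      φ^k-large : 16D * (X * X) ≤ φ ^ k
      φ^k-large = begin
        16D * (X * X)
          ≤⟨ *-monoʳ (square-0≤ X) (ℚ.≤-trans (proj₂ k₀-spec)
               (ℚ.≤-trans (*-monoˡ (*-0≤ (*-0≤ 0≤ρ 0≤ρ) (square-0≤ h)) (fromℕℚ-mono k₀≤k))
                 (≤-by-slack (ρ * ρ) (*-0≤ 0≤ρ 0≤ρ) (lem₁ (ρ * ρ) s (fromℕℚ k))))) ⟩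
        (ρ * ρ) * (1ℚ + fromℕℚ k * s) * (X * X)
          ≤⟨ *-monoʳ (square-0≤ X) (*-monoˡ (*-0≤ 0≤ρ 0≤ρ) (ℚ.≤-trans (bernoulli (square-0≤ h) k)
               (^-mono-≤ (+-0≤ 0≤1 (square-0≤ h)) (φ-gain 8s≤1) k))) ⟩
        (ρ * ρ) * (φ * (ρ * ρ)) ^ k * (X * X)
          ≡⟨ cong (λ t → (ρ * ρ) * t * (X * X)) (trans (^-distrib-* φ (ρ * ρ) k) (cong (φ ^ k *_) (^-distrib-* ρ ρ k))) ⟩
        (ρ * ρ) * (φ ^ k * (ρ ^ k * ρ ^ k)) * (X * X)
          ≡⟨ lem₂ ρ (φ ^ k) (ρ ^ k) X ⟩
        φ ^ k * ((ρ * ρ ^ k * X) * (ρ * ρ ^ k * X))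
          ≤⟨ *-monoˡ (^-0≤ 0≤φ k) (*-mono 0≤Y 0≤1 ρᵏ⁺¹X≤1 ρᵏ⁺¹X≤1) ⟩
        φ ^ k * (1ℚ * 1ℚ)
          ≡⟨ ℚ.*-identityʳ (φ ^ k) ⟩
        φ ^ k ∎
        where
        open ℚ.≤-Reasoning
        0≤Y : 0ℚ ≤ ρ * ρ ^ k * X
        0≤Y = *-0≤ (^-0≤ 0≤ρ (suc k)) 0≤X
        lem₁ : ∀ r s k → r * s * k + r ≡ r * (1ℚ + k * s)
        lem₁ = solve-∀ ring
        lem₂ : ∀ ρ f r X → (ρ * ρ) * (f * (r * r)) * (X * X) ≡ f * ((ρ * r * X) * (ρ * r * X))
        lem₂ = solve-∀ ring

      -- If x ≤ k h, the upper estimate would give ρ ^ k X ≤ 1, against the choice of `k`. So x > k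
      -- h, hence y x ≥ (2 + 4 h) k h = k w, where the lower estimate yields φ ^ k.
      power-large : ∀ {x y n} → X ≤ expSum x n → (x ≤ 0ℚ → expSum x n ≤ 1ℚ + 1ℚ) →
                    1ℚ + 1ℚ + 4h h ≤ y → suc (k ℕ.* 3) ℕ.≤ n → 16D * (X * X) ≤ expSum (y * x) n
      power-large {x} {y} {n} X≤E neg-bound y-large n-large = ℚ.≤-trans φ^k-large (ℚ.≤-trans (expSum-lower k)
        (ℚ.≤-trans (expSum-mono-ℕ 0≤kw n-large) (expSum-mono 0≤kw kw≤yx n)))
        where
        0≤kw : 0ℚ ≤ fromℕℚ k * w
        0≤kw = *-0≤ (fromℕℚ-nonNeg k) 0≤w
        -- The summand 5 in `m₀` gives X ≥ 5/2, above the bound 2 for nonpositive arguments.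
        2<X : 1ℚ + 1ℚ < X
        2<X = ℚ.<-≤-trans (toWitness {a? = 1ℚ + 1ℚ ℚ.<? fromℕℚ 5 * ½} _)
          (*-monoʳ (ℚ.nonNegative⁻¹ ½) (fromℕℚ-mono (ℕ.≤-trans (ℕ.m≤m+n 5 _) m₀≤m)))
        0<x : 0ℚ < x
        0<x = ℚ.≰⇒> λ x≤0 → <⇒≱ 2<X (ℚ.≤-trans X≤E (neg-bound x≤0))
        kh≤x : fromℕℚ k * h ≤ x
        kh≤x = ℚ.<⇒≤ (ℚ.≰⇒> λ x≤kh → <⇒≱ 1<ρᵏX (ℚ.≤-trans (*-monoˡ (^-0≤ 0≤ρ k) X≤E)
          (expSum-upper 0≤h h≤1 k (ℚ.<⇒≤ 0<x) x≤kh n)))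
        kw≤yx : fromℕℚ k * w ≤ y * x
        kw≤yx = ℚ.≤-trans (ℚ.≤-reflexive (lem (fromℕℚ k) h))
          (*-mono 0≤2+4h (ℚ.<⇒≤ 0<x) y-large kh≤x)
          where
          0≤2+4h : 0ℚ ≤ 1ℚ + 1ℚ + 4h h
          0≤2+4h = +-0≤ (+-0≤ 0≤1 0≤1) (+-0≤ (+-0≤ 0≤h 0≤h) (+-0≤ 0≤h 0≤h))
          lem : ∀ k h → k * (h + h + (h * h + h * h + (h * h + h * h))) ≡ (1ℚ + 1ℚ + (h + h + (h + h))) * (k * h)
          lem = solve-∀ ring

      threshold : ℕ
      threshold = suc (k ℕ.* 3)

  power-dominates : ∀ ε → 0ℝ Real.< ε → ∀ D → ∃ λ L₀ → ∀ {L} → L₀ ℕ.≤ L → ∀ {N} → 2 ℕ.^ L ℕ.≤ N →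
    ∀ ℓ b → IsLog (fromℕ N) ℓ → IsPower ℓ (fromℕ 2 Real.+ ε) b → fromℕ (D ℕ.* (L ℕ.* L)) Real.≤ b
  power-dominates ε (e , 0<e , ε-lower) D = 2 ℕ.+ m₀ , bound
    where
    -- The cap ½ keeps h small enough for `φ-gain`.
    e′ = e ⊓ ½
    0<e′ : 0ℚ < e′
    0<e′ with ℚ.⊓-sel e ½
    ... | inj₁ eq = subst (0ℚ <_) (sym eq) 0<e
    ... | inj₂ eq = subst (0ℚ <_) (sym eq) (ℚ.positive⁻¹ ½)
    h-spec = shrinkᵃ (fromℕℚ 4) 0<e′
    h = proj₁ h-spec
    4h≤e′ : 4h h ≤ e′
    4h≤e′ = ℚ.≤-trans (ℚ.≤-reflexive (lem h)) (proj₂ (proj₂ h-spec))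
      where
      lem : ∀ h → h + h + (h + h) ≡ (1ℚ + 1ℚ + (1ℚ + 1ℚ)) * h
      lem = solve-∀ ring
    open PowerBound (proj₁ (proj₂ h-spec)) (ℚ.≤-trans 4h≤e′ (ℚ.p⊓q≤q e ½)) D

    bound : ∀ {L} → 2 ℕ.+ m₀ ℕ.≤ L → ∀ {N} → 2 ℕ.^ L ℕ.≤ N →
      ∀ ℓ b → IsLog (fromℕ N) ℓ → IsPower ℓ (fromℕ 2 Real.+ ε) b → fromℕ (D ℕ.* (L ℕ.* L)) Real.≤ b
    -- A base equal to 0 is impossible here: it has approximations at most ½, but `log-lower` puts
    -- them above (m + 1)/2.
    bound {suc (suc m)} (ℕ.s≤s (ℕ.s≤s m₀≤m)) {N} 2^L≤N ℓ b (_ , N≤expℓ) (zero-base (ℓ≤0 , 0≤ℓ) _ _) =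
      let _ , ½m<ℓ , ℓ≤½ = sample (log-lower m N ℓ 2^L≤N N≤expℓ 0≤ℓ ∧ ℓ≤0 (ℚ.positive⁻¹ ½))
      in ⊥-elim (<⇒≱ ½m<ℓ (ℚ.≤-trans ℓ≤½ (*-monoʳ {½} {1ℚ} (ℚ.nonNegative⁻¹ ½) (1≤fromℕℚ-suc m))))
    bound {suc (suc m)} (ℕ.s≤s (ℕ.s≤s m₀≤m)) {N} 2^L≤N ℓ b (_ , N≤expℓ) (positive-base {ℓ′} 0<ℓ (_ , ℓ≤expℓ′) (_ , power≤b)) =
      ≤-trans-ℝ (fromℕ (D ℕ.* (L ℕ.* L))) (exp ((fromℕ 2 Real.+ ε) Real.* ℓ′)) b
        (eventually⇒≤ (fromℕ (D ℕ.* (L ℕ.* L))) (exp ((fromℕ 2 Real.+ ε) Real.* ℓ′)) (mapᵉ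
          (λ { (½m<ℓ , ℓ≤E+½ , neg-bound , e≤ε , n-large) →
               ℚ.≤-trans DL²≤ (power-large m₀≤m (X≤ ½m<ℓ ℓ≤E+½) neg-bound
                 (ℚ.+-monoʳ-≤ (1ℚ + 1ℚ) (ℚ.≤-trans 4h≤e′ (ℚ.≤-trans (ℚ.p⊓q≤p e ½)
                   (ℚ.≤-trans (ℚ.≤-reflexive (sym (ℚ.+-identityˡ e))) e≤ε))))
                 n-large) })
          (log-lower m N ℓ 2^L≤N N≤expℓ (<⇒≤-ℝ 0ℝ ℓ 0<ℓ) ∧ ℓ≤expℓ′ (ℚ.positive⁻¹ ½) ∧ exp-neg-≤2 ℓ′
            ∧ ε-lower ∧ after (threshold m₀≤m))))
        power≤b
      where
      L = suc (suc m)
      x = fromℕℚ m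
      X≤ : ∀ {y E} → fromℕℚ (suc m) * ½ < y → y ≤ E + ½ → x * ½ ≤ E
      X≤ {y} {E} <y y≤ = 0≤q-p⇒p≤q (subst (0ℚ ≤_) (trans (cong (λ t → E + ½ - t * ½) (fromℕℚ-suc m)) (lem E x))
        (p≤q⇒0≤q-p (ℚ.≤-trans (ℚ.<⇒≤ <y) y≤)))
        where
        lem : ∀ E x → E + ½ - (x + 1ℚ) * ½ ≡ E - x * ½
        lem = solve-∀ ring
      L≤2m : L ℕ.≤ 2 ℕ.* m
      L≤2m = ℕ.≤-trans (ℕ.+-monoˡ-≤ m (ℕ.≤-trans (ℕ.m≤m+n 2 _) m₀≤m)) (ℕ.≤-reflexive (cong (m ℕ.+_) (sym (ℕ.+-identityʳ m))))
      -- The 16 arises from L = m + 2 ≤ 2 m = 4 X, where X = m/2.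
      DL²≤ : fromℕℚ (D ℕ.* (L ℕ.* L)) ≤ fromℕℚ (16 ℕ.* D) * ((x * ½) * (x * ½))
      DL²≤ = begin
        fromℕℚ (D ℕ.* (L ℕ.* L))
          ≤⟨ fromℕℚ-mono (ℕ.*-monoʳ-≤ D (ℕ.*-mono-≤ L≤2m L≤2m)) ⟩
        fromℕℚ (D ℕ.* (2 ℕ.* m ℕ.* (2 ℕ.* m)))
          ≡⟨ trans (fromℕℚ-* D _) (cong (fromℕℚ D *_) (trans (fromℕℚ-* (2 ℕ.* m) (2 ℕ.* m)) (cong₂ _*_ (fromℕℚ-* 2 m) (fromℕℚ-* 2 m)))) ⟩
        fromℕℚ D * (fromℕℚ 2 * x * (fromℕℚ 2 * x))
          ≡⟨ lem (fromℕℚ D) x ⟩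
        fromℕℚ 16 * fromℕℚ D * ((x * ½) * (x * ½))
          ≡⟨ cong (_* ((x * ½) * (x * ½))) (fromℕℚ-* 16 D) ⟨
        fromℕℚ (16 ℕ.* D) * ((x * ½) * (x * ½)) ∎
        where
        open ℚ.≤-Reasoning
        lem : ∀ D x → D * ((1ℚ + 1ℚ) * x * ((1ℚ + 1ℚ) * x)) ≡
          (1ℚ + 1ℚ) * (1ℚ + 1ℚ) * ((1ℚ + 1ℚ) * (1ℚ + 1ℚ)) * D * ((x * ½) * (x * ½))
        lem = solve-∀ ring

  -- Gaps between points modulo 1

  toℚᵘ-/1 : ∀ i → ℚ.toℚᵘ (i ℚ./ 1) ℚᵘ.≃ ℚᵘ.mkℚᵘ i 0
  toℚᵘ-/1 i = ℚ.toℚᵘ-fromℚᵘ (ℚᵘ.mkℚᵘ i 0)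

  /1-+ : ∀ i j → (i ℤ.+ j) ℚ./ 1 ≡ i ℚ./ 1 + j ℚ./ 1
  /1-+ i j = ℚ.toℚᵘ-injective (ℚᵘ.≃-trans (toℚᵘ-/1 (i ℤ.+ j)) (ℚᵘ.≃-sym
    (ℚᵘ.≃-trans (ℚ.toℚᵘ-homo-+ (i ℚ./ 1) (j ℚ./ 1)) (ℚᵘ.≃-trans (ℚᵘ.+-cong (toℚᵘ-/1 i) (toℚᵘ-/1 j))
      (ℚᵘ.*≡* (cong (ℤ._* pos 1) (cong₂ ℤ._+_ (ℤ.*-identityʳ i) (ℤ.*-identityʳ j))))))))

  /1-mono : ∀ {i j} → i ℤ.≤ j → i ℚ./ 1 ≤ j ℚ./ 1
  /1-mono {i} {j} i≤j = ℚ.toℚᵘ-cancel-≤ (ℚᵘ.≤-respˡ-≃ (ℚᵘ.≃-sym (toℚᵘ-/1 i)) (ℚᵘ.≤-respʳ-≃ (ℚᵘ.≃-sym (toℚᵘ-/1 j))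
    (ℚᵘ.*≤* (ℤ.*-monoʳ-≤-nonNeg (pos 1) i≤j))))

  -- All that the gap argument uses about an integer translation κ.
  data Trichotomy (κ : ℚ) : Set where
    ≤-1 : κ ≤ - 1ℚ → Trichotomy κ
    ≡0  : κ ≡ 0ℚ → Trichotomy κ
    ≥1  : 1ℚ ≤ κ → Trichotomy κ

  /1-trichotomy : ∀ i → Trichotomy (i ℚ./ 1)
  /1-trichotomy (pos zero)    = ≡0 refl
  /1-trichotomy (pos (suc n))   = ≥1 (1≤fromℕℚ-suc n)
  /1-trichotomy (-[1+ n ])  = ≤-1 (/1-mono { -[1+ n ]} { -[1+ 0 ]} (ℤ.-≤- ℕ.z≤n))

  shift-trichotomy : ∀ i m n → Trichotomy (i ℚ./ 1 + fromℕℚ m - fromℕℚ n)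
  shift-trichotomy i m n = subst Trichotomy eq (/1-trichotomy (i ℤ.+ pos m ℤ.+ ℤ.- pos n))
    where
    -/1 : ∀ n → (ℤ.- pos n) ℚ./ 1 ≡ - fromℕℚ n
    -/1 n = trans (lem ((ℤ.- pos n) ℚ./ 1) (fromℕℚ n)) (trans (cong (_- fromℕℚ n)
      (trans (sym (/1-+ (ℤ.- pos n) (pos n))) (cong (ℚ._/ 1) (ℤ.+-inverseˡ (pos n))))) (ℚ.+-identityˡ (- fromℕℚ n)))
      where
      lem : ∀ x y → x ≡ x + y - y
      lem = solve-∀ ring
    eq : (i ℤ.+ pos m ℤ.+ ℤ.- pos n) ℚ./ 1 ≡ i ℚ./ 1 + fromℕℚ m - fromℕℚ n
    eq = trans (/1-+ (i ℤ.+ pos m) (ℤ.- pos n)) (cong₂ _+_ (/1-+ i (pos m)) (-/1 n))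

  fraction : ∀ {x} → 0ℚ ≤ x → ∃₂ λ P D → x * fromℕℚ (suc D) ≡ fromℕℚ P
  fraction {x@(mkℚ (pos P) D _)} 0≤x = P , D , ℚ.toℚᵘ-injective
    (ℚᵘ.≃-trans (ℚ.toℚᵘ-homo-* x (fromℕℚ (suc D)))
      (ℚᵘ.≃-trans (ℚᵘ.*-congˡ {ℚ.toℚᵘ x} (toℚᵘ-/1 (pos (suc D))))
        (ℚᵘ.≃-trans (ℚᵘ.*≡* (ℤ.*-assoc (pos P) (pos (suc D)) (pos 1)) ) (ℚᵘ.≃-sym (toℚᵘ-/1 (pos P))))))
  fraction {mkℚ (-[1+ _ ]) _ _} 0≤x with ℚ.nonNegative 0≤x
  ... | ()

  floor-spec : ∀ {x} P D → x * fromℕℚ (suc D) ≡ fromℕℚ P → ∀ M → let k = P ℕ.* M ℕ./ suc D in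
               fromℕℚ k ≤ x * fromℕℚ M × x * fromℕℚ M ≤ fromℕℚ (suc k)
  floor-spec {x} P D xD≡P M =
    cancel (begin
      fromℕℚ k * d             ≡⟨ fromℕℚ-* k (suc D) ⟨
      fromℕℚ (k ℕ.* suc D)     ≤⟨ fromℕℚ-mono (ℕ.m/n*n≤m (P ℕ.* M) (suc D)) ⟩
      fromℕℚ (P ℕ.* M)         ≡⟨ xMd ⟨
      x * fromℕℚ M * d         ∎) ,
    cancel (begin
      x * fromℕℚ M * d         ≡⟨ xMd ⟩
      fromℕℚ (P ℕ.* M)         ≤⟨ fromℕℚ-mono (ℕ.<⇒≤ (<[1+/]* (P ℕ.* M) (suc D))) ⟩
      fromℕℚ (suc k ℕ.* suc D) ≡⟨ fromℕℚ-* (suc k) (suc D) ⟩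
      fromℕℚ (suc k) * d       ∎)
    where
    open ℚ.≤-Reasoning
    k = P ℕ.* M ℕ./ suc D
    d = fromℕℚ (suc D)
    cancel : ∀ {p q} → p * d ≤ q * d → p ≤ q
    cancel = ℚ.*-cancelʳ-≤-pos d {{ℚ.positive (0<fromℕℚ-suc D)}}
    lem : ∀ x m d → x * m * d ≡ x * d * m
    lem = solve-∀ ring
    xMd : x * fromℕℚ M * d ≡ fromℕℚ (P ℕ.* M)
    xMd = trans (lem x (fromℕℚ M) d) (trans (cong (_* fromℕℚ M) xD≡P) (sym (fromℕℚ-* P M)))

  no-shrink : ∀ {p δ} → 0ℚ < δ → p + δ ≤ p → ⊥
  no-shrink {p} {δ} 0<δ p+δ≤p = <⇒≱ (subst (_< p + δ) (ℚ.+-identityʳ p) (ℚ.+-monoʳ-< p 0<δ)) p+δ≤p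

  -- Past an index from which both sequences vary by at most ε/4, a violation by ε at a single index
  -- persists with margin ε/4 and so proves y < x. Only the decidable order of ℚ is consulted, and a
  -- proof of `≤` may then proceed by contradiction.
  ≤-from-¬< : ∀ x y → ¬ (y Real.< x) → x Real.≤ y
  ≤-from-¬< x y y≮x {ε} 0<ε =
    let M , cx = cauchy x 0<δ
        N , cy = cauchy y 0<δ
        n₀ = M ℕ.⊔ N
    in n₀ , λ {n} n₀≤n → ℚ.≮⇒≥ λ y+ε<x → y≮x (δ , 0<δ , n , λ {k} n≤k → begin
      seq y k + δ              ≤⟨ ℚ.+-monoˡ-≤ δ (close-≤ (seq y k) (seq y n) (cy (ℕ.≤-trans (ℕ.m⊔n≤o⇒n≤o M N n₀≤n) n≤k) (ℕ.m⊔n≤o⇒n≤o M N n₀≤n))) ⟩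
      seq y n + δ + δ          ≡⟨ lem₁ (seq y n) δ ⟩
      seq y n + (δ + δ + (δ + δ)) - (δ + δ)  ≡⟨ cong (λ t → seq y n + t - (δ + δ)) (quarter ε) ⟩
      seq y n + ε - (δ + δ)    ≤⟨ ℚ.+-monoˡ-≤ (- (δ + δ)) (ℚ.<⇒≤ y+ε<x) ⟩
      seq x n - (δ + δ)        ≤⟨ ≤-by-slack δ (ℚ.<⇒≤ 0<δ) (lem₂ (seq x n) δ) ⟩
      seq x n - δ              ≤⟨ ℚ.+-monoˡ-≤ (- δ) (close-≤ (seq x n) (seq x k) (cx (ℕ.m⊔n≤o⇒m≤o M N n₀≤n) (ℕ.≤-trans (ℕ.m⊔n≤o⇒m≤o M N n₀≤n) n≤k))) ⟩
      seq x k + δ - δ          ≡⟨ lem₃ (seq x k) δ ⟩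
      seq x k                  ∎)
    where
    open ℚ.≤-Reasoning
    δ = ½ * (½ * ε)
    0<δ = ½-pos (½-pos 0<ε)
    quarter : ∀ ε → ½ * (½ * ε) + ½ * (½ * ε) + (½ * (½ * ε) + ½ * (½ * ε)) ≡ ε
    quarter = solve-∀ ring
    lem₁ : ∀ y d → y + d + d ≡ y + (d + d + (d + d)) - (d + d)
    lem₁ = solve-∀ ring
    lem₂ : ∀ x d → x - (d + d) + d ≡ x - d
    lem₂ = solve-∀ ring
    lem₃ : ∀ x d → x + d - d ≡ x
    lem₃ = solve-∀ ring
    close-≤ : ∀ p q {d} → ∣ p - q ∣ ≤ d → p ≤ q + d
    close-≤ p q close = ℚ.≤-trans (ℚ.≤-reflexive (lem p q)) (ℚ.+-monoʳ-≤ q (ℚ.≤-trans (p≤∣p∣ (p - q)) close))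
      where
      lem : ∀ p q → p ≡ q + (p - q)
      lem = solve-∀ ring

  8× : ℚ → ℚ
  8× η = η + η + (η + η) + (η + η + (η + η))

  module _ {η} (0<η : 0ℚ < η) where
    private
      0≤η = ℚ.<⇒≤ 0<η

    -- The point with fractional part y lies strictly inside the gap (u, v),
    -- although it should be one of its end points or outside.
    outside-gap : ∀ {u v y y₀ κ} → Trichotomy κ →
      - η ≤ u → y ≤ 1ℚ + η → y₀ ≤ y + η → v ≤ 1ℚ + y₀ + η → y ≤ u + η ⊎ v ≤ y + η →
      u + (η + η + (η + η) + η) ≤ y + κ → y + κ ≤ v - (η + η + (η + η)) → ⊥
    outside-gap {u} {v} {y} {y₀} {κ} (≤-1 κ≤-1) -η≤u y≤1+η _ _ _ u≤ _ = no-shrink {η} (ℚ.+-mono-< (ℚ.+-mono-< 0<η 0<η) 0<η) (begin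
      η + (η + η + η)                          ≡⟨ lem₁ η ⟩
      - η + (η + η + (η + η) + η)              ≤⟨ ℚ.+-monoˡ-≤ _ -η≤u ⟩
      u + (η + η + (η + η) + η)                ≤⟨ u≤ ⟩
      y + κ                                    ≤⟨ ℚ.+-mono-≤ y≤1+η κ≤-1 ⟩
      1ℚ + η + - 1ℚ                            ≡⟨ lem₂ η ⟩
      η                                        ∎)
      where
      open ℚ.≤-Reasoning
      lem₁ : ∀ η → η + (η + η + η) ≡ - η + (η + η + (η + η) + η)
      lem₁ = solve-∀ ring
      lem₂ : ∀ η → 1ℚ + η + - 1ℚ ≡ η
      lem₂ = solve-∀ ring
    outside-gap {u} {v} {y} {y₀} {κ} (≥1 1≤κ) _ _ y₀≤ v≤ _ _ ≤v = no-shrink {y + 1ℚ} (ℚ.+-mono-< 0<η 0<η) (begin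
      y + 1ℚ + (η + η)                         ≤⟨ ℚ.+-monoˡ-≤ (η + η) (ℚ.+-monoʳ-≤ y 1≤κ) ⟩
      y + κ + (η + η)                          ≤⟨ ℚ.+-monoˡ-≤ (η + η) ≤v ⟩
      v - (η + η + (η + η)) + (η + η)          ≤⟨ ℚ.+-monoˡ-≤ (η + η) (ℚ.+-monoˡ-≤ (- (η + η + (η + η)))
                                                    (ℚ.≤-trans v≤ (ℚ.+-monoˡ-≤ η (ℚ.+-monoʳ-≤ 1ℚ y₀≤)))) ⟩
      1ℚ + (y + η) + η - (η + η + (η + η)) + (η + η) ≡⟨ lem y η ⟩
      y + 1ℚ                                   ∎)
      where
      open ℚ.≤-Reasoning
      lem : ∀ y η → 1ℚ + (y + η) + η - (η + η + (η + η)) + (η + η) ≡ y + 1ℚ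
      lem = solve-∀ ring
    outside-gap {u} {v} {y} (≡0 refl) _ _ _ _ (inj₁ y≤u+η) u≤ _ =
      no-shrink {u + η} (ℚ.+-mono-< (ℚ.+-mono-< 0<η 0<η) (ℚ.+-mono-< 0<η 0<η)) (begin
        u + η + (η + η + (η + η))              ≡⟨ lem u η ⟩
        u + (η + η + (η + η) + η)              ≤⟨ u≤ ⟩
        y + 0ℚ                                 ≡⟨ ℚ.+-identityʳ y ⟩
        y                                      ≤⟨ y≤u+η ⟩
        u + η                                  ∎)
      where
      open ℚ.≤-Reasoning
      lem : ∀ u η → u + η + (η + η + (η + η)) ≡ u + (η + η + (η + η) + η)
      lem = solve-∀ ring
    outside-gap {u} {v} {y} (≡0 refl) _ _ _ _ (inj₂ v≤y+η) _ ≤v =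
      no-shrink {y} (ℚ.+-mono-< (ℚ.+-mono-< 0<η 0<η) 0<η) (begin
        y + (η + η + η)                        ≤⟨ ℚ.+-monoˡ-≤ (η + η + η) (ℚ.≤-trans (ℚ.≤-reflexive (sym (ℚ.+-identityʳ y))) ≤v) ⟩
        v - (η + η + (η + η)) + (η + η + η)    ≤⟨ ℚ.+-monoˡ-≤ (η + η + η) (ℚ.+-monoˡ-≤ (- (η + η + (η + η))) v≤y+η) ⟩
        y + η - (η + η + (η + η)) + (η + η + η) ≡⟨ lem y η ⟩
        y                                      ∎)
      where
      open ℚ.≤-Reasoning
      lem : ∀ y η → y + η - (η + η + (η + η)) + (η + η + η) ≡ y
      lem = solve-∀ ring

    -- x lies in a translate by e - W of the arc [c₀ c, (c₀ + 1) c], c = 8η, whose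
    -- left end point exceeds u by between c and 2c; z is the congruent point
    -- y + i of the sequence.
    inside-gap : ∀ {u u′ v y i x pa c₀ e W} → u ≤ u′ → u′ ≤ u + η → u + (8× η + 8× η + (8× η + 8× η)) ≤ v →
      u′ + 8× η ≤ c₀ → c₀ ≤ u′ + (8× η + 8× η) →
      c₀ + e - W ≤ x → x ≤ c₀ + e - W + 8× η →
      pa ≤ x → x ≤ pa + (η + η) → pa ≤ y + i + η → y + i ≤ pa + η →
      u + (η + η + (η + η) + η) ≤ y + (i + W - e) × y + (i + W - e) ≤ v - (η + η + (η + η))
    inside-gap {u} {u′} {v} {y} {i} {x} {pa} {c₀} {e} {W} u≤u′ u′≤ ≤v lo hi x≥ x≤ pa≤x x≤pa pa≤ ≤pa = left , right
      where
      open ℚ.≤-Reasoning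
      lem₁ : ∀ u η e W → u + (η + η + (η + η) + η) ≡ u + 8× η + e - W - (η + η) - η + (W - e)
      lem₁ = go
        where
        go : ∀ u η e W → u + (η + η + (η + η) + η) ≡ u + (η + η + (η + η) + (η + η + (η + η))) + e - W - (η + η) - η + (W - e)
        go = solve-∀ ring
      lem₂ : ∀ y i η e W → y + i + η - η + (W - e) ≡ y + (i + W - e)
      lem₂ = solve-∀ ring
      lem₃ : ∀ p η e W → p + (η + η) - (η + η) - η + (W - e) ≡ p - η + (W - e)
      lem₃ = solve-∀ ring
      left : u + (η + η + (η + η) + η) ≤ y + (i + W - e)
      left = begin
        u + (η + η + (η + η) + η)                     ≡⟨ lem₁ u η e W ⟩
        u + 8× η + e - W - (η + η) - η + (W - e)      ≤⟨ mono (mono (mono (mono (mono (ℚ.≤-trans (mono u≤u′) lo))))) ⟩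
        c₀ + e - W - (η + η) - η + (W - e)            ≤⟨ mono (mono (mono (ℚ.≤-trans x≥ x≤pa))) ⟩
        pa + (η + η) - (η + η) - η + (W - e)          ≡⟨ lem₃ pa η e W ⟩
        pa - η + (W - e)                              ≤⟨ mono (mono pa≤) ⟩
        y + i + η - η + (W - e)                       ≡⟨ lem₂ y i η e W ⟩
        y + (i + W - e)                               ∎
        where
        mono : ∀ {p q r} → p ≤ q → p + r ≤ q + r
        mono {r = r} = ℚ.+-monoˡ-≤ r
      lem₄ : ∀ y i W e → y + (i + W - e) ≡ y + i + (W - e)
      lem₄ = solve-∀ ring
      lem₅ : ∀ u η e W → u + η + (8× η + 8× η) + e - W + 8× η + η + (W - e) + (η + η) ≡ u + (8× η + 8× η + (8× η + 8× η)) - (η + η + (η + η))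
      lem₅ = go
        where
        go : ∀ u η e W → u + η + ((η + η + (η + η) + (η + η + (η + η))) + (η + η + (η + η) + (η + η + (η + η)))) + e - W + (η + η + (η + η) + (η + η + (η + η))) + η + (W - e) + (η + η) ≡ u + ((η + η + (η + η) + (η + η + (η + η))) + (η + η + (η + η) + (η + η + (η + η))) + ((η + η + (η + η) + (η + η + (η + η))) + (η + η + (η + η) + (η + η + (η + η))))) - (η + η + (η + η))
        go = solve-∀ ring
      right : y + (i + W - e) ≤ v - (η + η + (η + η))
      right = begin
        y + (i + W - e)                               ≡⟨ lem₄ y i W e ⟩
        y + i + (W - e)                               ≤⟨ mono (ℚ.≤-trans ≤pa (mono (ℚ.≤-trans pa≤x x≤))) ⟩
        c₀ + e - W + 8× η + η + (W - e)               ≤⟨ mono (mono (mono (mono (mono (ℚ.≤-trans hi (mono u′≤)))))) ⟩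
        u + η + (8× η + 8× η) + e - W + 8× η + η + (W - e)
          ≤⟨ ≤-by-slack (η + η) (+-0≤ 0≤η 0≤η) refl ⟩
        u + η + (8× η + 8× η) + e - W + 8× η + η + (W - e) + (η + η)
          ≡⟨ lem₅ u η e W ⟩
        u + (8× η + 8× η + (8× η + 8× η)) - (η + η + (η + η)) ≤⟨ mono ≤v ⟩
        v - (η + η + (η + η))                         ∎
        where
        mono : ∀ {p q r} → p ≤ q → p + r ≤ q + r
        mono {r = r} = ℚ.+-monoˡ-≤ r

  ∀ᵉ : ∀ {m} {P : Fin m → ℕ → Set} → (∀ i → Eventually (P i)) → Eventually (λ n → ∀ i → P i n)
  ∀ᵉ {zero}  ev = 0 , λ _ ()
  ∀ᵉ {suc m} ev = mapᵉ (λ { (p , ps) Fin.zero → p ; (p , ps) (Fin.suc i) → ps i }) (ev Fin.zero ∧ ∀ᵉ (λ i → ev (Fin.suc i)))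

  insertAt-top : ∀ {A : Set} {m} (xs : Fin m → A) x → insertAt xs (Fin.fromℕ m) x (Fin.fromℕ m) ≡ x
  insertAt-top {m = zero}  xs x = refl
  insertAt-top {m = suc m} xs x = insertAt-top (λ i → xs (Fin.suc i)) x

  insertAt-inject₁ : ∀ {A : Set} {m} (xs : Fin m → A) x i → insertAt xs (Fin.fromℕ m) x (inject₁ i) ≡ xs i
  insertAt-inject₁ xs x Fin.zero    = refl
  insertAt-inject₁ xs x (Fin.suc i) = insertAt-inject₁ (λ i → xs (Fin.suc i)) x i

  data NextPoint {m} (y : Fin (suc m) → ℝ) (i : Fin (suc m)) : Set where
    wrap : closeUp y (Fin.suc i) ≡ 1ℝ Real.+ y Fin.zero → (∀ (s : Fin (suc m)) → toℕ s ℕ.≤ toℕ i) → NextPoint y i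
    next : ∀ j → toℕ j ≡ suc (toℕ i) → closeUp y (Fin.suc i) ≡ y j → NextPoint y i

  nextPoint : ∀ {m} (y : Fin (suc m) → ℝ) i → NextPoint y i
  nextPoint {m} y i with view i
  ... | ‵fromℕ = wrap (insertAt-top y (1ℝ Real.+ y Fin.zero)) (λ s → subst (toℕ s ℕ.≤_) (sym (Fin.toℕ-fromℕ m)) (ℕ.s≤s⁻¹ (Fin.toℕ<n s)))
  ... | ‵inject₁ j = next (Fin.suc j) (cong suc (sym (Fin.toℕ-inject₁ j))) (insertAt-inject₁ y (1ℝ Real.+ y Fin.zero) (Fin.suc j))

  module Geometry {m} {z y : Fin (suc m) → ℝ} (sr : SortedRepresentatives z y) (i : Fin (suc m)) where
    open SortedRepresentatives sr

    private
      V = closeUp y (Fin.suc i)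

      y≤1 : ∀ s → y s Real.≤ 1ℝ
      y≤1 s = <⇒≤-ℝ (y s) 1ℝ (y<1 s)

    -- The facts about the sorted representatives that the contradiction needs, all at one index and
    -- with one tolerance. The disjunction expresses that no point lies inside the i-th gap.
    Located : ℚ → ℕ → Set
    Located η n =
      (∀ s → 0ℚ ≤ seq (y s) n + η) ×
      (∀ s → seq (y s) n ≤ 1ℚ + η) ×
      (∀ s → seq (y Fin.zero) n ≤ seq (y s) n + η) ×
      seq V n ≤ 1ℚ + seq (y Fin.zero) n + η ×
      (∀ s → seq (y s) n ≤ seq (y i) n + η ⊎ seq V n ≤ seq (y s) n + η) ×
      (∀ s → let k = proj₁ (congruent s) in
        seq (z (reorder ⟨$⟩ʳ s)) n ≤ seq (y s) n + k ℚ./ 1 + η × seq (y s) n + k ℚ./ 1 ≤ seq (z (reorder ⟨$⟩ʳ s)) n + η)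

    located : ∀ {η} → 0ℚ < η → Eventually (Located η)
    located {η} 0<η =
      ∀ᵉ (λ s → 0≤y s 0<η) ∧ ∀ᵉ (λ s → y≤1 s 0<η) ∧ ∀ᵉ (λ s → sorted {Fin.zero} {s} ℕ.z≤n 0<η) ∧
      V≤1+y₀ 0<η ∧ ∀ᵉ beside ∧
      ∀ᵉ (λ s → proj₁ (proj₂ (congruent s)) 0<η ∧ proj₂ (proj₂ (congruent s)) 0<η)
      where
      V≤1+y₀ : V Real.≤ 1ℝ Real.+ y Fin.zero
      V≤1+y₀ with nextPoint y i
      ... | wrap eq _   = subst (Real._≤ 1ℝ Real.+ y Fin.zero) (sym eq) (eventually⇒≤ (1ℝ Real.+ y Fin.zero) (1ℝ Real.+ y Fin.zero) (0 , λ _ → ℚ.≤-refl))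
      ... | next j _ eq = subst (Real._≤ 1ℝ Real.+ y Fin.zero) (sym eq) (≤-trans-ℝ (y j) 1ℝ (1ℝ Real.+ y Fin.zero) (y≤1 j)
        (λ {ε} 0<ε → mapᵉ (λ {n} 0≤ → subst (1ℚ ≤_) (sym (ℚ.+-assoc 1ℚ (seq (y Fin.zero) n) ε)) (≤-by-slack (seq (y Fin.zero) n + ε) 0≤ refl)) (0≤y Fin.zero 0<ε)))
      beside : ∀ s → Eventually λ n → seq (y s) n ≤ seq (y i) n + η ⊎ seq V n ≤ seq (y s) n + η
      beside s with nextPoint y i | toℕ s ℕ.≤? toℕ i
      ... | wrap _ top    | _       = mapᵉ inj₁ (sorted {s} {i} (top s) 0<η)
      ... | next j _ _    | yes s≤i = mapᵉ inj₁ (sorted {s} {i} s≤i 0<η)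
      ... | next j j≡ eq  | no s≰i  = mapᵉ inj₂ (subst (Real._≤ y s) (sym eq)
        (sorted {j} {s} (subst (ℕ._≤ toℕ s) (sym j≡) (ℕ.≰⇒> s≰i))) 0<η)

  -- A long gap forces α into a cell

  module Covering (b : ℕ → ℕ) (b-mono : ∀ {i j} → i ℕ.≤ j → b i ℕ.≤ b j)
    (K′ : ℕ) (growth : ∀ n → 4 ℕ.* suc (b n) ℕ.≤ suc (b (suc K′ ℕ.+ n)))
    (l : ℕ) (large : 4 ℕ.* suc K′ ℕ.* (suc l ℕ.* suc (suc l)) ℕ.≤ 2 ℕ.^ suc l) where

    open Scale b K′ growth l large public

    abstract
      -- `c` is the arc length, `w` the width of a cell at the last scale, and `η` the tolerance,
      -- eight of which make one arc length.
      c w η : ℚ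
      c = 1/suc q
      w = 1/suc (ℕ.pred (Q ℕ.* A J))
      η = ½ * (½ * (½ * c))

      0<c : 0ℚ < c
      0<c = 1/suc-pos q

      0<w : 0ℚ < w
      0<w = 1/suc-pos (ℕ.pred (Q ℕ.* A J))

      0<η : 0ℚ < η
      0<η = ½-pos (½-pos (½-pos 0<c))

      Qc≡1 : fromℕℚ Q * c ≡ 1ℚ
      Qc≡1 = 1/suc-inverse q

      QAw≡1 : fromℕℚ (Q ℕ.* A J) * w ≡ 1ℚ
      QAw≡1 = 1/suc-inverse (ℕ.pred (Q ℕ.* A J))

      8×η≡c : 8× η ≡ c
      8×η≡c = lem c
        where
        lem : ∀ c → 8× (½ * (½ * (½ * c))) ≡ c
        lem c = lem′ c
          where
          lem′ : ∀ c → ½ * (½ * (½ * c)) + ½ * (½ * (½ * c)) + (½ * (½ * (½ * c)) + ½ * (½ * (½ * c))) + (½ * (½ * (½ * c)) + ½ * (½ * (½ * c)) + (½ * (½ * (½ * c)) + ½ * (½ * (½ * c)))) ≡ c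
          lem′ = solve-∀ ring

    0≤c : 0ℚ ≤ c
    0≤c = ℚ.<⇒≤ 0<c

    0≤w : 0ℚ ≤ w
    0≤w = ℚ.<⇒≤ 0<w

    -- The closed cell [k w, (k + 1) w], enlarged on both sides by its width.
    cellInterval : ℕ → Interval
    cellInterval k = record
      { lower       = (fromℕℚ k - 1ℚ) * w
      ; upper       = (fromℕℚ k + 1ℚ + 1ℚ) * w
      ; lower≤upper = ≤-by-slack (w + w + w) (+-0≤ (+-0≤ 0≤w 0≤w) 0≤w) (lem (fromℕℚ k) w)
      }
      where
      lem : ∀ k w → (k - 1ℚ) * w + (w + w + w) ≡ (k + 1ℚ + 1ℚ) * w
      lem = solve-∀ ring

    width-cellInterval : ∀ k → width (cellInterval k) ≡ fromℕℚ 3 * w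
    width-cellInterval k = lem (fromℕℚ k) w
      where
      lem : ∀ k w → (k + 1ℚ + 1ℚ) * w - (k - 1ℚ) * w ≡ (1ℚ + 1ℚ + 1ℚ) * w
      lem = solve-∀ ring

    -- The offset moves the residue of c₀ to q, so the hypothesis means k ≡ c₀ modulo Q. Both
    -- quotients are kept explicit because c₀ itself may be Q or larger.
    shift-by-period : ∀ k c₀ → (k ℕ.+ (q ℕ.∸ c₀ ℕ.% Q)) ℕ.% Q ≡ q →
      k ℕ.+ c₀ ℕ./ Q ℕ.* Q ≡ c₀ ℕ.+ (k ℕ.+ (q ℕ.∸ c₀ ℕ.% Q)) ℕ./ Q ℕ.* Q
    shift-by-period k c₀ hits = ℕ.+-cancelˡ-≡ q _ _ (begin
      q ℕ.+ (k ℕ.+ W ℕ.* Q)                ≡⟨ cong (ℕ._+ (k ℕ.+ W ℕ.* Q)) (ℕ.m∸n+n≡m r≤q) ⟨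
      d ℕ.+ r ℕ.+ (k ℕ.+ W ℕ.* Q)          ≡⟨ lem d r k (W ℕ.* Q) ⟩
      k ℕ.+ d ℕ.+ (r ℕ.+ W ℕ.* Q)          ≡⟨ cong (k ℕ.+ d ℕ.+_) (ℕ.m≡m%n+[m/n]*n c₀ Q) ⟨
      k ℕ.+ d ℕ.+ c₀                       ≡⟨ cong (ℕ._+ c₀) (ℕ.m≡m%n+[m/n]*n (k ℕ.+ d) Q) ⟩
      (k ℕ.+ d) ℕ.% Q ℕ.+ e ℕ.* Q ℕ.+ c₀   ≡⟨ cong (λ x → x ℕ.+ e ℕ.* Q ℕ.+ c₀) hits ⟩
      q ℕ.+ e ℕ.* Q ℕ.+ c₀                 ≡⟨ lem₂ q (e ℕ.* Q) c₀ ⟩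
      q ℕ.+ (c₀ ℕ.+ e ℕ.* Q)               ∎)
      where
      open ≡-Reasoning
      r = c₀ ℕ.% Q
      d = q ℕ.∸ r
      W = c₀ ℕ./ Q
      e = (k ℕ.+ d) ℕ./ Q
      r≤q : r ℕ.≤ q
      r≤q = ℕ.s≤s⁻¹ (ℕ.m%n<n c₀ Q)
      lem : ∀ d r k x → d ℕ.+ r ℕ.+ (k ℕ.+ x) ≡ k ℕ.+ d ℕ.+ (r ℕ.+ x)
      lem = ℕ-solve-∀
      lem₂ : ∀ q x y → q ℕ.+ x ℕ.+ y ≡ q ℕ.+ (y ℕ.+ x)
      lem₂ = ℕ-solve-∀

    scaled-floor : ∀ {x} P D → x * fromℕℚ (suc D) ≡ fromℕℚ P → ∀ a → let k = P ℕ.* Q ℕ.* a ℕ./ suc D in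
      fromℕℚ k * c ≤ x * fromℕℚ a × x * fromℕℚ a ≤ fromℕℚ k * c + c
    scaled-floor {x} P D xD≡P a =
      let lo , hi = floor-spec {x} P D xD≡P (Q ℕ.* a)
      in ℚ.≤-trans (ℚ.≤-reflexive (cong (λ k → fromℕℚ k * c) k≡)) (ℚ.≤-trans (*-monoʳ {c} 0≤c lo) (ℚ.≤-reflexive xQac)) ,
         ℚ.≤-trans (ℚ.≤-reflexive (sym xQac)) (ℚ.≤-trans (*-monoʳ 0≤c hi) (ℚ.≤-reflexive
           (trans (cong (_* c) (fromℕℚ-suc (P ℕ.* (Q ℕ.* a) ℕ./ suc D)))
             (trans (lem₂ (fromℕℚ (P ℕ.* (Q ℕ.* a) ℕ./ suc D)) c) (cong (λ k → fromℕℚ k * c + c) (sym k≡))))))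
      where
      k≡ : P ℕ.* Q ℕ.* a ℕ./ suc D ≡ P ℕ.* (Q ℕ.* a) ℕ./ suc D
      k≡ = cong (ℕ._/ suc D) (ℕ.*-assoc P Q a)
      lem : ∀ x Q a c → x * (Q * a) * c ≡ x * a * (Q * c)
      lem = solve-∀ ring
      lem₂ : ∀ k c → (k + 1ℚ) * c ≡ k * c + c
      lem₂ = solve-∀ ring
      xQac : x * fromℕℚ (Q ℕ.* a) * c ≡ x * fromℕℚ a
      xQac = trans (cong (λ t → x * t * c) (fromℕℚ-* Q a)) (trans (lem x (fromℕℚ Q) (fromℕℚ a) c)
        (trans (cong (x * fromℕℚ a *_) Qc≡1) (ℚ.*-identityʳ (x * fromℕℚ a))))

    ⊔0-≤ : ∀ {p δ} → 0ℚ ≤ δ → 0ℚ ≤ p + δ → p ⊔ 0ℚ ≤ p + δ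
    ⊔0-≤ {p} {δ} 0≤δ 0≤p+δ = ℚ.⊔-lub (≤-by-slack {p} δ 0≤δ refl) 0≤p+δ

    module _ (α : ℝ) (0≤α : 0ℝ Real.≤ α) (α≤1 : α Real.≤ 1ℝ)
      (uncovered : ∀ {k} → k ∈ allCells → ¬ (α ∈° cellInterval k))
      {m} (2^L≤m : 2 ℕ.^ L ℕ.≤ m) {z : Fin (suc m) → ℝ}
      (z-seq : ∀ i n → seq (z i) n ≡ seq α n * fromℕℚ (suc (b (toℕ i))))
      where

      private
        aₘ = fromℕℚ (suc (b m))
        -- A change of α by δ moves each of the m + 1 points by at most 2 η.
        δ-spec = shrinkᵃ aₘ (ℚ.+-mono-< 0<η 0<η)
        δ = proj₁ δ-spec
        0<δ = proj₁ (proj₂ δ-spec)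
        0≤δ = ℚ.<⇒≤ 0<δ

        aδ≤ : ∀ {t} → t ℕ.≤ m → fromℕℚ (suc (b t)) * δ ≤ η + η
        aδ≤ t≤m = ℚ.≤-trans (*-monoʳ 0≤δ (fromℕℚ-mono (ℕ.s≤s (b-mono t≤m)))) (proj₂ (proj₂ δ-spec))

        -- `A J` is one of the coefficients, since J s ≤ 2 ^ L ≤ m. Hence 4 δ A J ≤ 8 η = 1/Q.
        4δ≤w : δ + δ + (δ + δ) ≤ w
        4δ≤w = begin
          δ + δ + (δ + δ)
            ≡⟨ ℚ.*-identityʳ (δ + δ + (δ + δ)) ⟨
          (δ + δ + (δ + δ)) * 1ℚ
            ≡⟨ cong ((δ + δ + (δ + δ)) *_) (trans (cong (_* w) (sym (fromℕℚ-* Q (A J)))) QAw≡1) ⟨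
          (δ + δ + (δ + δ)) * (fromℕℚ Q * fromℕℚ (A J) * w)
            ≡⟨ lem₁ δ (fromℕℚ Q) (fromℕℚ (A J)) w ⟩
          fromℕℚ Q * w * (fromℕℚ (A J) * δ + fromℕℚ (A J) * δ + (fromℕℚ (A J) * δ + fromℕℚ (A J) * δ))
            ≤⟨ *-monoˡ (*-0≤ (fromℕℚ-nonNeg Q) 0≤w) (ℚ.+-mono-≤ (ℚ.+-mono-≤ Aδ Aδ) (ℚ.+-mono-≤ Aδ Aδ)) ⟩
          fromℕℚ Q * w * (η + η + (η + η) + (η + η + (η + η)))
            ≡⟨ cong (fromℕℚ Q * w *_) 8×η≡c ⟩
          fromℕℚ Q * w * c
            ≡⟨ lem₂ (fromℕℚ Q) w c ⟩
          w * (fromℕℚ Q * c)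
            ≡⟨ trans (cong (w *_) Qc≡1) (ℚ.*-identityʳ w) ⟩
          w ∎
          where
          open ℚ.≤-Reasoning
          Aδ = aδ≤ (ℕ.≤-trans Js≤2^L 2^L≤m)
          lem₁ : ∀ d Q A w → (d + d + (d + d)) * (Q * A * w) ≡ Q * w * (A * d + A * d + (A * d + A * d))
          lem₁ = solve-∀ ring
          lem₂ : ∀ Q w c → Q * w * c ≡ w * (Q * c)
          lem₂ = solve-∀ ring

      -- The truncated approximation lies in the closed cell, and later approximations of α stay
      -- within 2 δ ≤ w/2 of it. The other half of the widening by `w` is the margin that `<`
      -- requires.
      ∈-cellInterval : ∀ {n} → (∀ {k} → n ℕ.≤ k → ∣ seq α k - seq α n ∣ ≤ δ) → 0ℚ ≤ seq α n + δ →
        ∀ P D → (seq α n ⊔ 0ℚ) * fromℕℚ (suc D) ≡ fromℕℚ P → α ∈° cellInterval (cellOf P (suc D) J)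
      ∈-cellInterval {n} close 0≤p+δ P D p̂D≡P =
        (½ * w , ½-pos 0<w , n , λ {i} n≤i → begin
          (fromℕℚ k - 1ℚ) * w + ½ * w            ≡⟨ lem₁ (fromℕℚ k) w ⟩
          fromℕℚ k * w - ½ * w                   ≤⟨ ℚ.+-monoˡ-≤ (- (½ * w)) kw≤p̂ ⟩
          p̂ - ½ * w                              ≤⟨ ℚ.+-monoˡ-≤ (- (½ * w)) (⊔0-≤ {p} 0≤δ 0≤p+δ) ⟩
          p + δ - ½ * w                          ≤⟨ ℚ.+-monoˡ-≤ (- (½ * w)) (ℚ.+-monoˡ-≤ δ (p≤ i n≤i)) ⟩
          seq α i + δ + δ - ½ * w                ≤⟨ ≤-by-slack (½ * w - (δ + δ)) (p≤q⇒0≤q-p 2δ≤½w) (lem₂ (seq α i) δ (½ * w)) ⟩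
          seq α i                                ∎) ,
        (½ * w , ½-pos 0<w , n , λ {i} n≤i → begin
          seq α i + ½ * w                        ≤⟨ ℚ.+-monoˡ-≤ (½ * w) (≤p i n≤i) ⟩
          p + δ + ½ * w                          ≤⟨ ℚ.+-monoˡ-≤ (½ * w) (ℚ.+-mono-≤ (ℚ.≤-trans (ℚ.p≤p⊔q p 0ℚ) p̂≤) δ≤½w) ⟩
          fromℕℚ k * w + w + ½ * w + ½ * w       ≡⟨ lem₃ (fromℕℚ k) w ⟩
          (fromℕℚ k + 1ℚ + 1ℚ) * w               ∎)
        where
        open ℚ.≤-Reasoning
        p = seq α n
        p̂ = p ⊔ 0ℚ
        k = cellOf P (suc D) J
        p̂M = floor-spec {p̂} P D p̂D≡P (Q ℕ.* A J)
        k≡ : k ≡ P ℕ.* (Q ℕ.* A J) ℕ./ suc D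
        k≡ = cong (ℕ._/ suc D) (ℕ.*-assoc P Q (A J))
        p̂QAw : p̂ * fromℕℚ (Q ℕ.* A J) * w ≡ p̂
        p̂QAw = trans (ℚ.*-assoc p̂ (fromℕℚ (Q ℕ.* A J)) w) (trans (cong (p̂ *_) QAw≡1) (ℚ.*-identityʳ p̂))
        kw≤p̂ : fromℕℚ k * w ≤ p̂
        kw≤p̂ = ℚ.≤-trans (ℚ.≤-reflexive (cong (λ k → fromℕℚ k * w) k≡)) (subst (_ ≤_) p̂QAw (*-monoʳ 0≤w (proj₁ p̂M)))
        p̂≤ : p̂ ≤ fromℕℚ k * w + w
        p̂≤ = subst (_≤ fromℕℚ k * w + w) p̂QAw (ℚ.≤-trans (*-monoʳ 0≤w (proj₂ p̂M)) (ℚ.≤-reflexive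
          (trans (cong (_* w) (trans (cong (λ k → fromℕℚ (suc k)) (sym k≡)) (fromℕℚ-suc k))) (lem (fromℕℚ k) w))))
          where
          lem : ∀ k w → (k + 1ℚ) * w ≡ k * w + w
          lem = solve-∀ ring
        2δ≤½w : δ + δ ≤ ½ * w
        2δ≤½w = subst (_≤ ½ * w) (lem δ) (*-monoˡ (ℚ.nonNegative⁻¹ ½) 4δ≤w)
          where
          lem : ∀ d → ½ * (d + d + (d + d)) ≡ d + d
          lem = solve-∀ ring
        δ≤½w : δ ≤ ½ * w
        δ≤½w = ℚ.≤-trans (≤-by-slack δ 0≤δ refl) 2δ≤½w
        p≤ : ∀ i → n ℕ.≤ i → p ≤ seq α i + δ
        p≤ i n≤i = ℚ.≤-trans (≤-by-slack (δ - (p - seq α i)) (p≤q⇒0≤q-p (ℚ.≤-trans (p≤∣p∣ (p - seq α i))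
          (subst (_≤ δ) (∣-∣-sym (seq α i) p) (close n≤i)))) refl) (ℚ.≤-reflexive (lem p (seq α i) δ))
          where
          lem : ∀ p a d → p + (d - (p - a)) ≡ a + d
          lem = solve-∀ ring
        ≤p : ∀ i → n ℕ.≤ i → seq α i ≤ p + δ
        ≤p i n≤i = ℚ.≤-trans (≤-by-slack (δ - (seq α i - p)) (p≤q⇒0≤q-p (ℚ.≤-trans (p≤∣p∣ (seq α i - p)) (close n≤i))) refl)
          (ℚ.≤-reflexive (lem (seq α i) p δ))
          where
          lem : ∀ p a d → p + (d - (p - a)) ≡ a + d
          lem = solve-∀ ring
        lem₁ : ∀ k w → (k - 1ℚ) * w + ½ * w ≡ k * w - ½ * w
        lem₁ = solve-∀ ring
        lem₂ : ∀ a d w → a + d + d - w + (w - (d + d)) ≡ a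
        lem₂ = solve-∀ ring
        lem₃ : ∀ k w → k * w + w + ½ * w + ½ * w ≡ (k + 1ℚ + 1ℚ) * w
        lem₃ = solve-∀ ring

      -- A gap longer than 4 c contains a grid arc of length c with at least c to spare on both
      -- sides. `outside-gap` shows that no point falls into that arc, so `∈-allCells` puts α into
      -- one of the cells, contrary to `uncovered`.
      gap-bound : ∀ {g} → IsMaximalGap z g → g Real.≤ fromℚ (c + c + (c + c))
      gap-bound {g} (y , sr , _ , i , g≤gapᵢ , _) = ≤-from-¬< g (fromℚ (c + c + (c + c)))
        λ { (e , 0<e , 4c+e≤g) → contradict e (sample
              (4c+e≤g ∧ g≤gapᵢ 0<e ∧ located 0<η ∧ 0≤α 0<δ ∧ α≤1 (ℚ.positive⁻¹ ½) ∧ near-α)) }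
        where
        open Geometry sr i
        open SortedRepresentatives sr using (reorder; congruent)
        near-α : Eventually λ n → ∀ {k} → n ℕ.≤ k → ∣ seq α k - seq α n ∣ ≤ δ
        near-α = let N , close = cauchy α 0<δ in N , λ N≤n n≤k → close (ℕ.≤-trans N≤n n≤k) N≤n

        contradict : ∀ e → ∃ (λ n → c + c + (c + c) + e ≤ seq g n × seq g n ≤ seq (gaps y i) n + e × Located η n ×
          0ℚ ≤ seq α n + δ × seq α n ≤ 1ℚ + ½ × (∀ {k} → n ℕ.≤ k → ∣ seq α k - seq α n ∣ ≤ δ)) → ⊥
        contradict e (n , 4c+e≤ , g≤ , (0≤y , y≤ , y₀≤ , v≤ , beside , congr) , 0≤p+δ , p≤ , close) =
          uncovered (∈-allCells P (suc D) P<2D {d} (ℕ.m∸n≤m q (c₀ ℕ.% Q)) avoids) (∈-cellInterval close 0≤p+δ P D p̂D≡P)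
          where
          open ℚ.≤-Reasoning
          p = seq α n
          -- Approximations of a nonnegative real may be slightly negative, whereas cells and arcs
          -- are numbered by ℕ; `u′` is truncated for the same reason.
          p̂ = p ⊔ 0ℚ
          u = seq (y i) n
          u′ = u ⊔ 0ℚ
          v = seq (closeUp y (Fin.suc i)) n
          p̂-fraction = fraction (ℚ.p≤q⊔p p 0ℚ)
          P = proj₁ p̂-fraction
          D = proj₁ (proj₂ p̂-fraction)
          p̂D≡P = proj₂ (proj₂ p̂-fraction)
          u′-fraction = fraction (ℚ.p≤q⊔p u 0ℚ)
          Pᵤ = proj₁ u′-fraction
          Dᵤ = proj₁ (proj₂ u′-fraction)
          f = Pᵤ ℕ.* Q ℕ./ suc Dᵤ
          f-spec = floor-spec {u′} Pᵤ Dᵤ (proj₂ (proj₂ u′-fraction)) Q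
          -- From f c ≤ u′ ≤ (f + 1) c it follows that skipping two arcs puts the left end between c
          -- and 2 c beyond u′.
          c₀ = 2 ℕ.+ f
          d = q ℕ.∸ c₀ ℕ.% Q

          gap : u + (8× η + 8× η + (8× η + 8× η)) ≤ v
          gap = subst (λ t → u + (t + t + (t + t)) ≤ v) (sym 8×η≡c) (0≤q-p⇒p≤q (subst (0ℚ ≤_)
            (trans (cong (λ t → v + - t + e - (c + c + (c + c) + e)) (cong (λ x → seq x n) (insertAt-inject₁ y (1ℝ Real.+ y Fin.zero) i)))
                   (lem v u e (c + c + (c + c))))
            (p≤q⇒0≤q-p (ℚ.≤-trans 4c+e≤ g≤))))
            where
            lem : ∀ v u e x → v + - u + e - (x + e) ≡ v - (u + x)
            lem = solve-∀ ring

          P<2D : P ℕ.< 2 ℕ.* suc D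
          P<2D = ℕ.≰⇒> λ 2D≤P → no-shrink {fromℕℚ (suc D) + fromℕℚ (suc D) * ½} (*-0< (0<fromℕℚ-suc D) (ℚ.positive⁻¹ ½)) (begin
            fromℕℚ (suc D) + fromℕℚ (suc D) * ½ + fromℕℚ (suc D) * ½ ≡⟨ lem₁ (fromℕℚ (suc D)) ⟩
            fromℕℚ 2 * fromℕℚ (suc D)              ≡⟨ fromℕℚ-* 2 (suc D) ⟨
            fromℕℚ (2 ℕ.* suc D)                   ≤⟨ fromℕℚ-mono 2D≤P ⟩
            fromℕℚ P                               ≡⟨ p̂D≡P ⟨
            p̂ * fromℕℚ (suc D)                     ≤⟨ *-monoʳ (fromℕℚ-nonNeg (suc D)) (ℚ.⊔-lub p≤ (+-0≤ 0≤1 (ℚ.nonNegative⁻¹ ½))) ⟩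
            (1ℚ + ½) * fromℕℚ (suc D)              ≡⟨ lem₂ (fromℕℚ (suc D)) ⟩
            fromℕℚ (suc D) + fromℕℚ (suc D) * ½    ∎)
            where
            lem₁ : ∀ d → d + d * ½ + d * ½ ≡ (1ℚ + 1ℚ) * d
            lem₁ = solve-∀ ring
            lem₂ : ∀ d → (1ℚ + ½) * d ≡ d + d * ½
            lem₂ = solve-∀ ring

          u′c : u′ * fromℕℚ Q * c ≡ u′
          u′c = trans (ℚ.*-assoc u′ (fromℕℚ Q) c) (trans (cong (u′ *_) Qc≡1) (ℚ.*-identityʳ u′))
          c₀c≡ : fromℕℚ c₀ * c ≡ fromℕℚ f * c + (c + c)
          c₀c≡ = trans (cong (_* c) (trans (fromℕℚ-suc (suc f)) (cong (_+ 1ℚ) (fromℕℚ-suc f)))) (lem (fromℕℚ f) c)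
            where
            lem : ∀ f c → (f + 1ℚ + 1ℚ) * c ≡ f * c + (c + c)
            lem = solve-∀ ring
          c₀-lo : u′ + 8× η ≤ fromℕℚ c₀ * c
          c₀-lo = begin
            u′ + 8× η                     ≡⟨ cong₂ _+_ (sym u′c) 8×η≡c ⟩
            u′ * fromℕℚ Q * c + c         ≤⟨ ℚ.+-monoˡ-≤ c (*-monoʳ 0≤c (proj₂ f-spec)) ⟩
            fromℕℚ (suc f) * c + c        ≡⟨ trans (cong (λ t → t * c + c) (fromℕℚ-suc f)) (lem (fromℕℚ f) c) ⟩
            fromℕℚ f * c + (c + c)        ≡⟨ c₀c≡ ⟨
            fromℕℚ c₀ * c                 ∎
            where
            lem : ∀ f c → (f + 1ℚ) * c + c ≡ f * c + (c + c)
            lem = solve-∀ ring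
          c₀-hi : fromℕℚ c₀ * c ≤ u′ + (8× η + 8× η)
          c₀-hi = begin
            fromℕℚ c₀ * c                 ≡⟨ c₀c≡ ⟩
            fromℕℚ f * c + (c + c)        ≤⟨ ℚ.+-monoˡ-≤ (c + c) (*-monoʳ 0≤c (proj₁ f-spec)) ⟩
            u′ * fromℕℚ Q * c + (c + c)   ≡⟨ cong₂ _+_ u′c (sym (cong₂ _+_ 8×η≡c 8×η≡c)) ⟩
            u′ + (8× η + 8× η)            ∎

          avoids : ∀ {t} → t ℕ.≤ 2 ℕ.^ L → (P ℕ.* Q ℕ.* suc (b t) ℕ./ suc D ℕ.+ d) ℕ.% Q ≡ q → ⊥
          avoids {t} t≤ hits = outside-gap 0<η {u} {v} {yₛ} {seq (y Fin.zero) n} {κ} (shift-trichotomy kₛ W e′)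
            (0≤q-p⇒p≤q (subst (0ℚ ≤_) (lem₀ u η) (0≤y i)))
            (y≤ σ) (y₀≤ σ) v≤ (beside σ) (proj₁ inside) (proj₂ inside)
            where
            t≤m : t ℕ.≤ m
            t≤m = ℕ.≤-trans t≤ 2^L≤m
            τ = Fin.fromℕ< (ℕ.s≤s t≤m)
            σ = reorder ⟨$⟩ˡ τ
            yₛ = seq (y σ) n
            kₛ = proj₁ (congruent σ)
            k = P ℕ.* Q ℕ.* suc (b t) ℕ./ suc D
            W = c₀ ℕ./ Q
            e′ = (k ℕ.+ d) ℕ./ Q
            κ = kₛ ℚ./ 1 + fromℕℚ W - fromℕℚ e′
            a = fromℕℚ (suc (b t))
            lem₀ : ∀ u η → u + η ≡ u - - η
            lem₀ = solve-∀ ring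
            z≡ : seq (z (reorder ⟨$⟩ʳ σ)) n ≡ p * a
            z≡ = trans (cong (λ j → seq (z j) n) (inverseʳ reorder))
                   (trans (z-seq τ n) (cong (λ j → p * fromℕℚ (suc (b j))) (Fin.toℕ-fromℕ< (ℕ.s≤s t≤m))))
            kc≡ : fromℕℚ k * c ≡ fromℕℚ c₀ * c + fromℕℚ e′ - fromℕℚ W
            kc≡ = begin-equality
              fromℕℚ k * c
                ≡⟨ lem₁ (fromℕℚ k) (fromℕℚ W) (fromℕℚ Q) c ⟩
              (fromℕℚ k + fromℕℚ W * fromℕℚ Q) * c - fromℕℚ W * (fromℕℚ Q * c)
                ≡⟨ cong (λ t → t * c - fromℕℚ W * (fromℕℚ Q * c)) shifted ⟩
              (fromℕℚ c₀ + fromℕℚ e′ * fromℕℚ Q) * c - fromℕℚ W * (fromℕℚ Q * c)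
                ≡⟨ lem₂ (fromℕℚ c₀) (fromℕℚ e′) (fromℕℚ Q) c (fromℕℚ W) ⟩
              fromℕℚ c₀ * c + fromℕℚ e′ * (fromℕℚ Q * c) - fromℕℚ W * (fromℕℚ Q * c)
                ≡⟨ cong (λ t → fromℕℚ c₀ * c + fromℕℚ e′ * t - fromℕℚ W * t) Qc≡1 ⟩
              fromℕℚ c₀ * c + fromℕℚ e′ * 1ℚ - fromℕℚ W * 1ℚ
                ≡⟨ cong₂ (λ x y → fromℕℚ c₀ * c + x - y) (ℚ.*-identityʳ (fromℕℚ e′)) (ℚ.*-identityʳ (fromℕℚ W)) ⟩
              fromℕℚ c₀ * c + fromℕℚ e′ - fromℕℚ W ∎
              where
              shifted : fromℕℚ k + fromℕℚ W * fromℕℚ Q ≡ fromℕℚ c₀ + fromℕℚ e′ * fromℕℚ Q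
              shifted = trans (sym (trans (fromℕℚ-+ k (W ℕ.* Q)) (cong (λ t → fromℕℚ k + t) (fromℕℚ-* W Q))))
                (trans (cong fromℕℚ (shift-by-period k c₀ hits))
                  (trans (fromℕℚ-+ c₀ (e′ ℕ.* Q)) (cong (λ t → fromℕℚ c₀ + t) (fromℕℚ-* e′ Q))))
              lem₁ : ∀ k W Q c → k * c ≡ (k + W * Q) * c - W * (Q * c)
              lem₁ = solve-∀ ring
              lem₂ : ∀ k e Q c W → (k + e * Q) * c - W * (Q * c) ≡ k * c + e * (Q * c) - W * (Q * c)
              lem₂ = solve-∀ ring
            cell = scaled-floor {p̂} P D p̂D≡P (suc (b t))
            p̂a≤ : p̂ * a ≤ p * a + (η + η)
            p̂a≤ = begin
              p̂ * a                ≤⟨ *-monoʳ (fromℕℚ-nonNeg (suc (b t))) (⊔0-≤ {p} 0≤δ 0≤p+δ) ⟩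
              (p + δ) * a          ≡⟨ lem p δ a ⟩
              p * a + a * δ        ≤⟨ ℚ.+-monoʳ-≤ (p * a) (aδ≤ t≤m) ⟩
              p * a + (η + η)      ∎
              where
              lem : ∀ p d a → (p + d) * a ≡ p * a + a * d
              lem = solve-∀ ring
            inside = inside-gap 0<η {u} {u′} {v} {yₛ} {kₛ ℚ./ 1} {p̂ * a} {p * a} {fromℕℚ c₀ * c} {fromℕℚ e′} {fromℕℚ W}
              (ℚ.p≤p⊔q u 0ℚ) (⊔0-≤ {u} (ℚ.<⇒≤ 0<η) (0≤y i)) gap c₀-lo c₀-hi
              (subst (_≤ p̂ * a) kc≡ (proj₁ cell))
              (subst (p̂ * a ≤_) (cong₂ _+_ kc≡ (sym 8×η≡c)) (proj₂ cell))
              (*-monoʳ (fromℕℚ-nonNeg (suc (b t))) (ℚ.p≤p⊔q p 0ℚ)) p̂a≤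
              (subst (_≤ yₛ + kₛ ℚ./ 1 + η) z≡ (proj₁ (congr σ)))
              (subst (λ x → yₛ + kₛ ℚ./ 1 ≤ x + η) z≡ (proj₂ (congr σ)))

  -- Covering the exceptional set

  pointInterval : Interval
  pointInterval = record { lower = 0ℚ ; upper = 0ℚ ; lower≤upper = ℚ.≤-refl }

  totalWidth : List Interval → ℚ
  totalWidth []       = 0ℚ
  totalWidth (I ∷ Is) = width I + totalWidth Is

  0≤width : ∀ I → 0ℚ ≤ width I
  0≤width I = p≤q⇒0≤q-p (lower≤upper I)

  0≤totalWidth : ∀ Is → 0ℚ ≤ totalWidth Is
  0≤totalWidth []       = ℚ.≤-refl
  0≤totalWidth (I ∷ Is) = +-0≤ (0≤width I) (0≤totalWidth Is)

  totalWidth-map : ∀ {f : ℕ → Interval} {w} → (∀ k → width (f k) ≡ w) → ∀ ks →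
                   totalWidth (map f ks) ≡ fromℕℚ (length ks) * w
  totalWidth-map {w = w} f≡w []       = sym (ℚ.*-zeroˡ w)
  totalWidth-map {w = w} f≡w (k ∷ ks) = trans (cong₂ _+_ (f≡w k) (totalWidth-map f≡w ks))
    (trans (lem w (fromℕℚ (length ks))) (cong (_* w) (sym (fromℕℚ-suc (length ks)))))
    where
    lem : ∀ w n → w + n * w ≡ (n + 1ℚ) * w
    lem = solve-∀ ring

  ∑-head : ∀ (f : ℕ → ℚ) n → ∑ f (suc n) ≡ f 0 + ∑ (f ∘ suc) n
  ∑-head f zero    = ℚ.+-comm 0ℚ (f 0)
  ∑-head f (suc n) = trans (cong (_+ f (suc n)) (∑-head f n)) (ℚ.+-assoc (f 0) (∑ (f ∘ suc) n) (f (suc n)))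

  -- Enumerates Is, F s, F (s + 1), … with a degenerate interval before each F i,
  -- so that empty lists do no harm.
  enumerate : (ℕ → List Interval) → List Interval → ℕ → ℕ → Interval
  enumerate F []       s zero    = pointInterval
  enumerate F []       s (suc n) = enumerate F (F s) (suc s) n
  enumerate F (I ∷ Is) s zero    = I
  enumerate F (I ∷ Is) s (suc n) = enumerate F Is s n

  module _ {F : ℕ → List Interval} where

    ∈⇒enumerated : ∀ {I Is s} → I ∈ Is → ∃ λ n → enumerate F Is s n ≡ I
    ∈⇒enumerated (here refl) = zero , refl
    ∈⇒enumerated (there I∈)  = let n , eq = ∈⇒enumerated I∈ in suc n , eq

    enumerates : ∀ {I} i Is s → I ∈ F (i ℕ.+ s) → ∃ λ n → enumerate F Is s n ≡ I
    enumerates zero    []       s I∈ = let n , eq = ∈⇒enumerated I∈ in suc n , eq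
    enumerates {I} (suc i) []   s I∈ =
      let n , eq = enumerates i (F s) (suc s) (subst (λ t → I ∈ F t) (sym (ℕ.+-suc i s)) I∈) in suc n , eq
    enumerates i       (_ ∷ Is) s I∈ = let n , eq = enumerates i Is s I∈ in suc n , eq

    -- `β s` is a budget for the lists from `F s` onwards. Every partial sum is bounded by the
    -- pending list plus the budget, so no infinite series has to be formed.
    ∑-enumerate : ∀ {β : ℕ → ℚ} → (∀ s → 0ℚ ≤ β s) → (∀ s → totalWidth (F s) + β (suc s) ≤ β s) →
                  ∀ Is s n → ∑ (width ∘ enumerate F Is s) n ≤ totalWidth Is + β s
    ∑-enumerate 0≤β decay Is       s zero    = +-0≤ (0≤totalWidth Is) (0≤β s)
    ∑-enumerate {β} 0≤β decay [] s (suc n) = begin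
      ∑ (width ∘ enumerate F [] s) (suc n)                ≡⟨ ∑-head (width ∘ enumerate F [] s) n ⟩
      0ℚ + ∑ (width ∘ enumerate F (F s) (suc s)) n        ≤⟨ ℚ.+-monoʳ-≤ 0ℚ (ℚ.≤-trans (∑-enumerate 0≤β decay (F s) (suc s) n) (decay s)) ⟩
      0ℚ + β s                                            ∎
      where open ℚ.≤-Reasoning
    ∑-enumerate {β} 0≤β decay (I ∷ Is) s (suc n) = begin
      ∑ (width ∘ enumerate F (I ∷ Is) s) (suc n)          ≡⟨ ∑-head (width ∘ enumerate F (I ∷ Is) s) n ⟩
      width I + ∑ (width ∘ enumerate F Is s) n            ≤⟨ ℚ.+-monoʳ-≤ (width I) (∑-enumerate 0≤β decay Is s n) ⟩
      width I + (totalWidth Is + β s)                     ≡⟨ ℚ.+-assoc (width I) (totalWidth Is) (β s) ⟨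
      width I + totalWidth Is + β s                       ∎
      where open ℚ.≤-Reasoning

  -- Rational form of the real hypotheses, and assembly

  fromℕℚ-cancel-≤ : ∀ {m n} → fromℕℚ m ≤ fromℕℚ n → m ℕ.≤ n
  fromℕℚ-cancel-≤ {m} {n} m≤n = ℕ.≮⇒≥ λ n<m → no-shrink {fromℕℚ n} (ℚ.positive⁻¹ 1ℚ)
    (ℚ.≤-trans (ℚ.≤-reflexive (sym (fromℕℚ-suc n))) (ℚ.≤-trans (fromℕℚ-mono n<m) m≤n))

  ≤-from-≤+ε : ∀ {p q} → (∀ {ε} → 0ℚ < ε → p ≤ q + ε) → p ≤ q
  ≤-from-≤+ε {p} {q} p≤q+ε = ℚ.≮⇒≥ λ q<p →
    let 0<d = subst (_< p - q) (ℚ.+-inverseʳ q) (ℚ.+-monoˡ-< (- q) q<p)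
    in no-shrink {q + ½ * (p - q)} (½-pos 0<d) (ℚ.≤-trans (ℚ.≤-reflexive (lem p q)) (p≤q+ε (½-pos 0<d)))
    where
    lem : ∀ p q → q + ½ * (p - q) + ½ * (p - q) ≡ p
    lem = solve-∀ ring

  -- The witness of 1 < r bounds the approximations of r below by 1 + e, and j is taken with e (j +
  -- 1) ≥ 1. The tolerance in `Lacunary` disappears because (1 + e) a n and a (n + 1) are fixed
  -- rationals.
  lacunary-ratio : ∀ r → 1ℝ Real.< r → ∃ λ j → ∀ a → Lacunary r a → ∀ n → suc (suc j) ℕ.* a n ℕ.≤ suc j ℕ.* a (suc n)
  lacunary-ratio r (e , 0<e , r-large) = j , λ a lacunary n → fromℕℚ-cancel-≤ (ratio a n (≤-from-≤+ε λ {ε} 0<ε →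
    let k , 1+e≤r , ra≤ = sample (r-large ∧ lacunary n 0<ε)
    in ℚ.≤-trans (*-monoʳ (fromℕℚ-nonNeg (a n)) 1+e≤r) ra≤))
    where
    open ℚ.≤-Reasoning
    j-spec = archimedean-*ᵃ 1ℚ 0<e
    j = proj₁ j-spec
    d = fromℕℚ (suc j)
    ratio : ∀ a n → (1ℚ + e) * fromℕℚ (a n) ≤ fromℕℚ (a (suc n)) → fromℕℚ (suc (suc j) ℕ.* a n) ≤ fromℕℚ (suc j ℕ.* a (suc n))
    ratio a n growing = begin
      fromℕℚ (suc (suc j) ℕ.* a n)          ≡⟨ trans (fromℕℚ-* (suc (suc j)) (a n)) (cong (_* fromℕℚ (a n)) (fromℕℚ-suc (suc j))) ⟩
      (d + 1ℚ) * fromℕℚ (a n)               ≤⟨ *-monoʳ (fromℕℚ-nonNeg (a n)) (ℚ.+-monoʳ-≤ d (proj₂ j-spec)) ⟩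
      (d + e * d) * fromℕℚ (a n)            ≡⟨ lem d e (fromℕℚ (a n)) ⟩
      d * ((1ℚ + e) * fromℕℚ (a n))         ≤⟨ *-monoˡ (fromℕℚ-nonNeg (suc j)) growing ⟩
      d * fromℕℚ (a (suc n))                ≡⟨ fromℕℚ-* (suc j) (a (suc n)) ⟨
      fromℕℚ (suc j ℕ.* a (suc n))          ∎
      where
      lem : ∀ d e a → (d + e * d) * a ≡ d * ((1ℚ + e) * a)
      lem = solve-∀ ring

  ½^-small : ∀ B {δ} → 0ℚ < δ → ∃ λ l₀ → ∀ {l} → l₀ ℕ.≤ l → B * ½ ^ l ≤ δ
  ½^-small B {δ} 0<δ = j , λ {l} j≤l → begin
    B * ½ ^ l                            ≤⟨ *-monoʳ (0≤½^ l) (ℚ.≤-trans (proj₂ j-spec) (*-monoˡ (ℚ.<⇒≤ 0<δ) (fromℕℚ-mono (ℕ.≤-trans (ℕ.s≤s j≤l) (1+n≤2^n l))))) ⟩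
    δ * fromℕℚ (2 ℕ.^ l) * ½ ^ l         ≡⟨ ℚ.*-assoc δ (fromℕℚ (2 ℕ.^ l)) (½ ^ l) ⟩
    δ * (fromℕℚ (2 ℕ.^ l) * ½ ^ l)       ≡⟨ trans (cong (δ *_) (2^*½^ l)) (ℚ.*-identityʳ δ) ⟩
    δ                                    ∎
    where
    open ℚ.≤-Reasoning
    j-spec = archimedean-*ᵃ B 0<δ
    j = proj₁ j-spec
    0≤½^ : ∀ l → 0ℚ ≤ ½ ^ l
    0≤½^ = ^-0≤ (ℚ.nonNegative⁻¹ ½)

  *-fromℚ-mono : ∀ x y {c} → 0ℚ ≤ c → c ≤ 1ℚ → x Real.≤ y → x Real.* fromℚ c Real.≤ y Real.* fromℚ c
  *-fromℚ-mono x y {c} 0≤c c≤1 x≤y {ε} 0<ε = mapᵉ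
    (λ {n} le → ℚ.≤-trans (*-monoʳ 0≤c le) (ℚ.≤-trans (ℚ.≤-reflexive (ℚ.*-distribʳ-+ c (seq y n) ε))
      (ℚ.+-monoʳ-≤ (seq y n * c) (subst (ε * c ≤_) (ℚ.*-identityʳ ε) (*-monoˡ (ℚ.<⇒≤ 0<ε) c≤1)))))
    (x≤y 0<ε)


  conclude : ∀ {g b γ} X m → g Real.≤ fromℚ γ → γ ≤ fromℕℚ X * 1/suc m → fromℕ X Real.≤ b →
             g Real.≤ b Real.* fromℚ (1/suc m)
  conclude {g} {b} {γ} X m g≤γ γ≤X/N X≤b = ≤-trans-ℝ g (fromℚ γ) (b Real.* fromℚ (1/suc m)) g≤γ
    (≤-trans-ℝ (fromℚ γ) (fromℕ X Real.* fromℚ (1/suc m)) (b Real.* fromℚ (1/suc m))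
      (eventually⇒≤ (fromℚ γ) (fromℕ X Real.* fromℚ (1/suc m)) (0 , λ _ → γ≤X/N))
      (*-fromℚ-mono (fromℕ X) b (0≤1/suc m) 1/suc≤1 X≤b))
    where
    1/suc≤1 : 1/suc m ≤ 1ℚ
    1/suc≤1 = subst (_≤ 1ℚ) (ℚ.*-identityˡ (1/suc m)) (subst (1ℚ * 1/suc m ≤_) (1/suc-inverse m) (*-monoʳ (0≤1/suc m) (1≤fromℕℚ-suc m)))

  maximalGap-bound : ∀ (ε r : ℝ) → 0ℝ Real.< ε → 1ℝ Real.< r → (a : ℕ → ℕ) →
    (∀ n → 0 ℕ.< a n) → (∀ n → a n ℕ.< a (suc n)) → Lacunary r a →
    AlmostAll[0,1] λ α → ∃ λ N₀ → ∀ m → let N = suc m in N₀ ℕ.≤ N → ∀ g ℓ β →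
      IsMaximalGap {m} (λ i → α Real.* fromℕ (a (toℕ i))) g → IsLog (fromℕ N) ℓ →
      IsPower ℓ (fromℕ 2 Real.+ ε) β → g Real.≤ β Real.* fromℚ (1/suc m)
  maximalGap-bound ε r 0<ε 1<r a 0<a increasing lacunary {δ} 0<δ =
    enumerate F [] 0 ,
    (λ n → ℚ.≤-trans (∑-enumerate 0≤β decay [] 0 n) (ℚ.≤-trans (ℚ.≤-reflexive (ℚ.+-identityˡ (β 0))) β₀≤δ)) ,
    -- Indices 0, ..., 2 ^ L are sampled, so it is m = N - 1 that is placed between powers of 2.
    λ α 0≤α α≤1 uncovered → suc (2 ℕ.^ suc l₀) , λ { m (ℕ.s≤s 2^≤m) g ℓ b′ maxGap isLog isPower →
      let i , 2^L≤m , m<2^[L+1] = bracket l₀ 2^≤m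
      in conclude {g} {b′} (D ℕ.* (suc (i ℕ.+ l₀) ℕ.* suc (i ℕ.+ l₀))) m
           (gap-at i α 0≤α α≤1 uncovered {m} 2^L≤m {g} maxGap)
           (4c≤X/N i m m<2^[L+1])
           (power-at i m 2^L≤m ℓ b′ isLog isPower) }
    where
    b : ℕ → ℕ
    b n = ℕ.pred (a n)
    a≡ : ∀ n → suc (b n) ≡ a n
    a≡ n = ℕ.suc-pred (a n) {{ℕ.>-nonZero (0<a n)}}
    b-mono : ∀ {i j} → i ℕ.≤ j → b i ℕ.≤ b j
    b-mono {i} {j} i≤j = ℕ.pred-mono-≤ (subst (λ t → a i ℕ.≤ a t) (ℕ.m∸n+n≡m i≤j) (Growth.a-mono a increasing i (j ℕ.∸ i)))
    ratio = lacunary-ratio r 1<r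
    j = proj₁ ratio
    -- Chosen so that `suc K′` unfolds to `3 * suc j`, the distance over which `quadrupling`
    -- applies.
    K′ = j ℕ.+ 2 ℕ.* suc j
    -- 128 = 4 · 2 · 2 · 8, from the bound 4 c, from N ≤ 2 · 2 ^ L, from 2 ^ L ≤ 2 Q X, and from X ≤
    -- 8 K L².
    D = 128 ℕ.* suc K′
    growth : ∀ n → 4 ℕ.* suc (b n) ℕ.≤ suc (b (suc K′ ℕ.+ n))
    growth n = subst (λ x → 4 ℕ.* x ℕ.≤ suc (b (suc K′ ℕ.+ n))) (sym (a≡ n))
      (subst (4 ℕ.* a n ℕ.≤_) (sym (a≡ (suc K′ ℕ.+ n))) (Growth.quadrupling a increasing j (proj₂ ratio a lacunary) n))

    small = ½^-small (fromℕℚ 18) 0<δ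
    quadratic = quadratic≤2^ (4 ℕ.* suc K′)
    power = power-dominates ε 0<ε D
    l₀ : ℕ
    l₀ = proj₁ small ℕ.+ proj₁ quadratic ℕ.+ proj₁ power

    large : ∀ i → 4 ℕ.* suc K′ ℕ.* (suc (i ℕ.+ l₀) ℕ.* suc (suc (i ℕ.+ l₀))) ℕ.≤ 2 ℕ.^ suc (i ℕ.+ l₀)
    large i = proj₂ quadratic (suc (i ℕ.+ l₀)) (ℕ.≤-trans (ℕ.≤-trans (ℕ.m≤n+m (proj₁ quadratic) (proj₁ small)) (ℕ.m≤m+n _ (proj₁ power)))
      (ℕ.≤-trans (ℕ.m≤n+m l₀ i) (ℕ.n≤1+n (i ℕ.+ l₀))))

    module C (i : ℕ) = Covering b b-mono K′ growth (i ℕ.+ l₀) (large i)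

    F : ℕ → List Interval
    F i = map (C.cellInterval i) (C.allCells i)

    β : ℕ → ℚ
    -- The cells at level L have total width at most 9 · 2 ^ (-L): a 3 from `length-allCells` and a
    -- 3 from the widening of each cell. The geometric tail doubles this to 18.
    β i = fromℕℚ 18 * ½ ^ suc (i ℕ.+ l₀)

    0≤½^ : ∀ n → 0ℚ ≤ ½ ^ n
    0≤½^ = ^-0≤ (ℚ.nonNegative⁻¹ ½)

    0≤β : ∀ i → 0ℚ ≤ β i
    0≤β i = *-0≤ (fromℕℚ-nonNeg 18) (0≤½^ (suc (i ℕ.+ l₀)))

    β₀≤δ : β 0 ≤ δ
    β₀≤δ = proj₂ small (ℕ.≤-trans (ℕ.≤-trans (ℕ.m≤m+n (proj₁ small) (proj₁ quadratic)) (ℕ.m≤m+n _ (proj₁ power))) (ℕ.n≤1+n l₀))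

    totalWidth-F : ∀ i → totalWidth (F i) ≤ fromℕℚ 9 * ½ ^ suc (i ℕ.+ l₀)
    totalWidth-F i = begin
      totalWidth (F i)                     ≡⟨ totalWidth-map {cellInterval} width-cellInterval allCells ⟩
      n * (fromℕℚ 3 * w)                   ≡⟨ ℚ.*-identityʳ (n * (fromℕℚ 3 * w)) ⟨
      n * (fromℕℚ 3 * w) * 1ℚ              ≡⟨ cong (n * (fromℕℚ 3 * w) *_) (2^*½^ L) ⟨
      n * (fromℕℚ 3 * w) * (fromℕℚ (2 ℕ.^ L) * ½ ^ L) ≡⟨ lem₁ n (fromℕℚ 3) w (fromℕℚ (2 ℕ.^ L)) (½ ^ L) ⟩
      n * fromℕℚ (2 ℕ.^ L) * (fromℕℚ 3 * w * ½ ^ L)   ≤⟨ *-monoʳ (*-0≤ (*-0≤ (fromℕℚ-nonNeg 3) 0≤w) (0≤½^ L)) count ⟩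
      fromℕℚ 3 * fromℕℚ M * (fromℕℚ 3 * w * ½ ^ L)    ≡⟨ lem₂ (fromℕℚ 3) (fromℕℚ M) w (½ ^ L) ⟩
      fromℕℚ 3 * fromℕℚ 3 * (fromℕℚ M * w) * ½ ^ L    ≡⟨ cong (λ t → fromℕℚ 3 * fromℕℚ 3 * t * ½ ^ L) QAw≡1 ⟩
      fromℕℚ 3 * fromℕℚ 3 * 1ℚ * ½ ^ L                ≡⟨⟩
      fromℕℚ 9 * ½ ^ L                     ∎
      where
      open ℚ.≤-Reasoning
      open C i
      n = fromℕℚ (length allCells)
      M = Q ℕ.* A J
      count : n * fromℕℚ (2 ℕ.^ L) ≤ fromℕℚ 3 * fromℕℚ M
      count = begin
        n * fromℕℚ (2 ℕ.^ L)                  ≡⟨ fromℕℚ-* (length allCells) (2 ℕ.^ L) ⟨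
        fromℕℚ (length allCells ℕ.* 2 ℕ.^ L)  ≤⟨ fromℕℚ-mono length-allCells ⟩
        fromℕℚ (3 ℕ.* M)                      ≡⟨ fromℕℚ-* 3 M ⟩
        fromℕℚ 3 * fromℕℚ M                   ∎
      lem₁ : ∀ n t w p h → n * (t * w) * (p * h) ≡ n * p * (t * w * h)
      lem₁ = solve-∀ ring
      lem₂ : ∀ t m w h → t * m * (t * w * h) ≡ t * t * (m * w) * h
      lem₂ = solve-∀ ring

    decay : ∀ i → totalWidth (F i) + β (suc i) ≤ β i
    decay i = ℚ.≤-trans (ℚ.+-monoˡ-≤ (β (suc i)) (totalWidth-F i)) (ℚ.≤-reflexive (lem (½ ^ suc (i ℕ.+ l₀))))
      where
      lem : ∀ h → fromℕℚ 9 * h + fromℕℚ 18 * (½ * h) ≡ fromℕℚ 18 * h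
      lem h = trans (cong (fromℕℚ 9 * h +_) (sym (ℚ.*-assoc (fromℕℚ 18) ½ h)))
                    (sym (ℚ.*-distribʳ-+ h (fromℕℚ 9) (fromℕℚ 9)))

    enumerated : ∀ i {k} → k ∈ C.allCells i → ∃ λ n → enumerate F [] 0 n ≡ C.cellInterval i k
    enumerated i {k} k∈ = enumerates {F} i [] 0 (subst (λ t → C.cellInterval i k ∈ F t) (sym (ℕ.+-identityʳ i)) (∈-map⁺ (C.cellInterval i) k∈))

    power-at : ∀ i m → 2 ℕ.^ suc (i ℕ.+ l₀) ℕ.≤ m → ∀ ℓ b′ → IsLog (fromℕ (suc m)) ℓ → IsPower ℓ (fromℕ 2 Real.+ ε) b′ →
      fromℕ (D ℕ.* (suc (i ℕ.+ l₀) ℕ.* suc (i ℕ.+ l₀))) Real.≤ b′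
    power-at i m 2^L≤m = proj₂ power (ℕ.≤-trans (ℕ.m≤n+m (proj₁ power) (proj₁ small ℕ.+ proj₁ quadratic)) (ℕ.≤-trans (ℕ.m≤n+m l₀ i) (ℕ.n≤1+n (i ℕ.+ l₀))))
      {suc m} (ℕ.m≤n⇒m≤1+n 2^L≤m)

    gap-at : ∀ i α → 0ℝ Real.≤ α → α Real.≤ 1ℝ → (∀ n → ¬ (α ∈° enumerate F [] 0 n)) →
      ∀ {m} → 2 ℕ.^ suc (i ℕ.+ l₀) ℕ.≤ m → ∀ {g} → IsMaximalGap {m} (λ i → α Real.* fromℕ (a (toℕ i))) g →
      g Real.≤ fromℚ (C.c i + C.c i + (C.c i + C.c i))
    gap-at i α 0≤α α≤1 uncovered {m} 2^L≤m {g} = C.gap-bound i α 0≤α α≤1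
      (λ k∈ α∈ → let n , eq = enumerated i k∈ in uncovered n (subst (α ∈°_) (sym eq) α∈))
      {m} 2^L≤m {λ i → α Real.* fromℕ (a (toℕ i))} (λ i n → cong (λ x → seq α n * fromℕℚ x) (sym (a≡ (toℕ i)))) {g}

    4c≤X/N : ∀ i m → m ℕ.< 2 ℕ.^ suc (suc (i ℕ.+ l₀)) → let open C i in
      c + c + (c + c) ≤ fromℕℚ (D ℕ.* (L ℕ.* L)) * 1/suc m
    4c≤X/N i m m< = begin
      c + c + (c + c)                        ≡⟨ ℚ.*-identityʳ _ ⟨
      (c + c + (c + c)) * 1ℚ                 ≡⟨ cong ((c + c + (c + c)) *_) (1/suc-inverse m) ⟨
      (c + c + (c + c)) * (N * ν)            ≡⟨ lem₁ c N ν ⟩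
      (fromℕℚ 4 * N) * (c * ν)               ≤⟨ *-monoʳ (*-0≤ 0≤c (0≤1/suc m)) 4N≤XQ ⟩
      (x * fromℕℚ Q) * (c * ν)               ≡⟨ lem₂ x (fromℕℚ Q) c ν ⟩
      (fromℕℚ Q * c) * (x * ν)               ≡⟨ cong (_* (x * ν)) Qc≡1 ⟩
      1ℚ * (x * ν)                           ≡⟨ ℚ.*-identityˡ (x * ν) ⟩
      x * ν                                  ∎
      where
      open ℚ.≤-Reasoning
      open C i
      N = fromℕℚ (suc m)
      ν = 1/suc m
      x = fromℕℚ (D ℕ.* (L ℕ.* L))
      lem₁ : ∀ c N ν → (c + c + (c + c)) * (N * ν) ≡ ((1ℚ + 1ℚ) * (1ℚ + 1ℚ) * N) * (c * ν)
      lem₁ = solve-∀ ring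
      lem₂ : ∀ x Q c ν → (x * Q) * (c * ν) ≡ (Q * c) * (x * ν)
      lem₂ = solve-∀ ring
      4N≤ : 4 ℕ.* suc m ℕ.≤ D ℕ.* (L ℕ.* L) ℕ.* Q
      4N≤ = ℕ.≤-trans (ℕ.*-monoʳ-≤ 4 (ℕ.≤-trans m< (ℕ.*-monoʳ-≤ 2 (ℕ.≤-trans 2^L≤2QX
        (ℕ.*-monoʳ-≤ (2 ℕ.* Q) (ℕ.*-monoʳ-≤ (4 ℕ.* suc K′) (ℕ.*-monoʳ-≤ L (ℕ.+-monoˡ-≤ L (ℕ.s≤s (ℕ.z≤n {i ℕ.+ l₀})))))))))) (ℕ.≤-reflexive (lem Q (suc K′) L))
        where
        lem : ∀ Q K L → 4 ℕ.* (2 ℕ.* (2 ℕ.* Q ℕ.* (4 ℕ.* K ℕ.* (L ℕ.* (L ℕ.+ L))))) ≡ 128 ℕ.* K ℕ.* (L ℕ.* L) ℕ.* Q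
        lem = ℕ-solve-∀
      4N≤XQ : fromℕℚ 4 * N ≤ x * fromℕℚ Q
      4N≤XQ = subst (_≤ x * fromℕℚ Q) (fromℕℚ-* 4 (suc m)) (subst (fromℕℚ (4 ℕ.* suc m) ≤_) (fromℕℚ-* (D ℕ.* (L ℕ.* L)) Q) (fromℕℚ-mono 4N≤))

open import Defs

theorem2p3 :
  ∀ (ε r : ℝ) → 0ℝ < ε → 1ℝ < r →
  (a : ℕ → ℕ) →
  (∀ n → 0 ℕ.< a n) →
  (∀ n → a n ℕ.< a (suc n)) →
  Lacunary r a →
  AlmostAll[0,1] λ α →
    ∃ λ N₀ → ∀ m → let N = suc m in N₀ ℕ.≤ N →
      ∀ g ℓ b →
      IsMaximalGap {m} (λ i → α * fromℕ (a (toℕ i))) g →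
      IsLog (fromℕ N) ℓ →
      IsPower ℓ (fromℕ 2 + ε) b →
      g ≤ b * fromℚ (1/suc m)
theorem2p3 = GapBound.maximalGap-bound
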